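{- Suppose that $\theta<\kappa$ are regular cardinals, $\kappa$ is measurable, and the measurability of $\kappa$ is indestructible under forcing with $\mathrm{Add}(\kappa,1)$. Suppose also that $W$ is a uniform ultrafilter over $\theta$. Let $\mathbb P=\mathbb P(\kappa,\theta)$. Then, in $V^{\mathbb P}$, there is a uniform ultrafilter $U$ over $\kappa$ such that for every cardinal $\mu<\kappa$, $U$ is $\mu$-decomposable if and only if $W$ is $\mu$-decomposable. In particular, $U$ is $\mu$-indecomposable for every cardinal $\mu\in[\theta^+,\kappa)$.
   Context: $\mathrm{Add}(\kappa,1)$ is the forcing adding a Cohen subset of $\kappa$. For a set of ordinals $A$, $\mathrm{acc}(A)=\{\alpha\in A\mid\sup(A\cap\alpha)=\alpha>0\}$. $\mathbb P(\kappa,\theta)$ is the poset of all sequences $p=\langle C^p_{\alpha,i}\mid \alpha\in\mathrm{acc}(\gamma^p+1),\ i(\alpha)^p\le i<\theta\rangle$ such that: $\gamma^p\in\mathrm{acc}(\kappa)$; for every $\alpha\in\mathrm{acc}(\gamma^p+1)$, $i(\alpha)^p<\theta$ and $\langle C^p_{\alpha,i}\mid i(\alpha)^p\le i<\theta\rangle$ is a $\subseteq$-increasing sequence of clubs in $\alpha$ with $\mathrm{acc}(\alpha)=\bigcup_i\mathrm{acc}(C^p_{\alpha,i})$; and for all $\alpha$, $i(\alpha)^p\le i<\theta$, $\bar\alpha\in\mathrm{acc}(C^p_{\alpha,i})$, we have $i(\bar\alpha)^p\le i$ and $C^p_{\bar\alpha,i}=C^p_{\alpha,i}\cap\bar\alpha$.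 It is ordered by end-extension. An ultrafilter $U$ over a cardinal is uniform if all its members have the size of that cardinal. For an infinite cardinal $\mu$, an ultrafilter $U$ over $I$ is $\mu$-decomposable if there is $f:I\to\mu$ with $f^{ -1}[H]\notin U$ for all $H\subseteq\mu$ with $|H|<\mu$, and $\mu$-indecomposable otherwise. -}

module Defs where

open import Level using (Level; suc; Lift; lift; lower)
open import Data.Empty.Polymorphic using (⊥)
open import Data.Product using (Σ; ∃; _×_; _,_; proj₁; proj₂)
open import Data.Sum using (_⊎_)
open import Relation.Binary.Bundles using (Poset)
open import Relation.Binary.Structures using (IsEquivalence)
import Relation.Binary.Construct.On as On
import Relation.Binary.Construct.Add.Supremum.NonStrict as AddTop
open import Relation.Nullary.Construct.Add.Supremum using (_⁺; ⊤⁺; [_])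

variable
  ℓ d : Level
  D : Set d

------------------------------------------------------------------------
-- First-order formulas of the language {∈, =}
--
-- Parametric higher-order abstract syntax: a formula with n free
-- variables is a function D → … → D → Formula D polymorphic in D.  The
-- same formula is interpreted both in the universe V and, through the
-- forcing relation, in its generic extensions.

infix  7 _∈̇_ _≐_ _⊆̇_
infix  6 ¬̇_
infixr 5 _∧̇_
infixr 4 _∨̇_
infixr 3 _⇒̇_
infix  2 _⇔̇_

data Formula (D : Set d) : Set d where
  _∈̇_ _≐_         : D → D → Formula D
  ⊥̇               : Formula D
  _∧̇_ _∨̇_ _⇒̇_     : Formula D → Formula D → Formula D
  ∀̇ ∃̇             : (D → Formula D) → Formula D

¬̇_ : Formula D → Formula D
¬̇ φ = φ ⇒̇ ⊥̇

_⇔̇_ : Formula D → Formula D → Formula D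
φ ⇔̇ ψ = (φ ⇒̇ ψ) ∧̇ (ψ ⇒̇ φ)

∀∈ ∃∈ : D → (D → Formula D) → Formula D
∀∈ a φ = ∀̇ λ x → x ∈̇ a ⇒̇ φ x
∃∈ a φ = ∃̇ λ x → x ∈̇ a ∧̇ φ x

------------------------------------------------------------------------
-- Sets, pairs, functions

_⊆̇_ : D → D → Formula D
x ⊆̇ y = ∀∈ x λ z → z ∈̇ y

IsEmpty Inhabited : D → Formula D
IsEmpty x   = ∀̇ λ z → ¬̇ z ∈̇ x
Inhabited x = ∃̇ λ z → z ∈̇ x

-- z = {x , y}
IsPair : D → D → D → Formula D
IsPair z x y = ∀̇ λ w → w ∈̇ z ⇔̇ w ≐ x ∨̇ w ≐ y

-- z = ⟨x , y⟩ = {{x} , {x , y}}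
IsOrdPair : D → D → D → Formula D
IsOrdPair z x y = ∃̇ λ a → ∃̇ λ b → IsPair a x x ∧̇ IsPair b x y ∧̇ IsPair z a b

-- z = x ∩ y
IsInter : D → D → D → Formula D
IsInter z x y = ∀̇ λ w → w ∈̇ z ⇔̇ w ∈̇ x ∧̇ w ∈̇ y

-- z = x ∖ y
IsDiff : D → D → D → Formula D
IsDiff z x y = ∀̇ λ w → w ∈̇ z ⇔̇ w ∈̇ x ∧̇ ¬̇ w ∈̇ y

-- f(x) = y, for a function f
Maps : D → D → D → Formula D
Maps f x y = ∃∈ f λ z → IsOrdPair z x y

-- f : A → B
IsFunction : D → D → D → Formula D
IsFunction f A B =
    (∀∈ f λ z → ∃∈ A λ x → ∃∈ B λ y → IsOrdPair z x y)
  ∧̇ (∀∈ A λ x → ∃∈ B λ y → Maps f x y)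
  ∧̇ (∀̇ λ x → ∀̇ λ y → ∀̇ λ y′ → Maps f x y ⇒̇ Maps f x y′ ⇒̇ y ≐ y′)

IsBijection : D → D → D → Formula D
IsBijection f A B =
    IsFunction f A B
  ∧̇ (∀∈ B λ y → ∃∈ A λ x → Maps f x y)
  ∧̇ (∀̇ λ x → ∀̇ λ x′ → ∀̇ λ y → Maps f x y ⇒̇ Maps f x′ y ⇒̇ x ≐ x′)

Equinumerous : D → D → Formula D
Equinumerous A B = ∃̇ λ f → IsBijection f A B

-- |A| < μ, for a cardinal μ
SizeBelow : D → D → Formula D
SizeBelow A μ = ∃∈ μ λ β → Equinumerous A β

------------------------------------------------------------------------
-- Ordinals and cardinals

IsTransitive : D → Formula D
IsTransitive x = ∀∈ x λ y → y ⊆̇ x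

IsOrdinal : D → Formula D
IsOrdinal α = IsTransitive α ∧̇ (∀∈ α λ β → IsTransitive β)

-- β = α + 1
IsSuccessor : D → D → Formula D
IsSuccessor β α = ∀̇ λ ξ → ξ ∈̇ β ⇔̇ ξ ∈̇ α ∨̇ ξ ≐ α

IsLimit : D → Formula D
IsLimit α = IsOrdinal α ∧̇ Inhabited α ∧̇ (∀∈ α λ β → ∃∈ α λ γ → β ∈̇ γ)

IsOmega : D → Formula D
IsOmega w = IsLimit w ∧̇ (∀∈ w λ n → ¬̇ IsLimit n)

IsCardinal : D → Formula D
IsCardinal μ = IsOrdinal μ ∧̇ (∀∈ μ λ β → ¬̇ Equinumerous β μ)

IsInfiniteCardinal : D → Formula D
IsInfiniteCardinal μ = IsCardinal μ ∧̇ (∃̇ λ w → IsOmega w ∧̇ w ⊆̇ μ)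

-- ν = θ⁺
IsSuccessorCardinal : D → D → Formula D
IsSuccessorCardinal ν θ =
  IsCardinal ν ∧̇ θ ∈̇ ν ∧̇ (∀̇ λ μ → IsCardinal μ ⇒̇ θ ∈̇ μ ⇒̇ ν ⊆̇ μ)

IsRegular : D → Formula D
IsRegular κ =
    IsInfiniteCardinal κ
  ∧̇ (∀∈ κ λ α → ∀̇ λ f → IsFunction f α κ ⇒̇
       (∃∈ κ λ β → ∀̇ λ ξ → ∀̇ λ η → Maps f ξ η ⇒̇ η ∈̇ β))

-- sup(A ∩ α) = α > 0; the supremum of a set of ordinals is its union.
SupIs : D → D → Formula D
SupIs A α =
    Inhabited α
  ∧̇ (∀̇ λ β → β ∈̇ α ⇔̇ (∃∈ A λ δ → δ ∈̇ α ∧̇ β ∈̇ δ))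

-- α ∈ acc(A)
InAcc : D → D → Formula D
InAcc A α = α ∈̇ A ∧̇ SupIs A α

IsClub : D → D → Formula D
IsClub C α = C ⊆̇ α ∧̇ SupIs C α ∧̇ (∀∈ α λ β → SupIs C β ⇒̇ β ∈̇ C)

------------------------------------------------------------------------
-- Ultrafilters

IsUltrafilter : D → D → Formula D
IsUltrafilter U I =
    (∀∈ U λ X → X ⊆̇ I ∧̇ Inhabited X)
  ∧̇ I ∈̇ U
  ∧̇ (∀∈ U λ X → ∀̇ λ Y → X ⊆̇ Y ⇒̇ Y ⊆̇ I ⇒̇ Y ∈̇ U)
  ∧̇ (∀∈ U λ X → ∀∈ U λ Y → ∀̇ λ Z → IsInter Z X Y ⇒̇ Z ∈̇ U)
  ∧̇ (∀̇ λ X → X ⊆̇ I ⇒̇ (∀̇ λ Y → IsDiff Y I X ⇒̇ X ∈̇ U ∨̇ Y ∈̇ U))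

IsUniformUltrafilter : D → D → Formula D
IsUniformUltrafilter U κ =
  IsUltrafilter U κ ∧̇ (∀∈ U λ X → Equinumerous X κ)

IsNonprincipal : D → D → Formula D
IsNonprincipal U I = ∀∈ I λ x → ∀̇ λ X → IsPair X x x ⇒̇ ¬̇ X ∈̇ U

-- U is closed under intersections (taken within I) of fewer than κ members.
IsComplete : D → D → D → Formula D
IsComplete U I κ =
  ∀̇ λ F → F ⊆̇ U ⇒̇ SizeBelow F κ ⇒̇
    (∀̇ λ Y → (∀̇ λ x → x ∈̇ Y ⇔̇ x ∈̇ I ∧̇ (∀∈ F λ X → x ∈̇ X)) ⇒̇ Y ∈̇ U)

IsMeasurable : D → Formula D
IsMeasurable κ =
    IsCardinal κ
  ∧̇ (∃̇ λ w → IsOmega w ∧̇ w ∈̇ κ)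
  ∧̇ (∃̇ λ U → IsUltrafilter U κ ∧̇ IsNonprincipal U κ ∧̇ IsComplete U κ κ)

-- Y = f⁻¹[H], for f with domain I
IsPreimage : D → D → D → D → Formula D
IsPreimage Y f I H = ∀̇ λ x → x ∈̇ Y ⇔̇ x ∈̇ I ∧̇ (∃∈ H λ y → Maps f x y)

-- The ultrafilter U over I is μ-decomposable.
IsDecomposable : D → D → D → Formula D
IsDecomposable U I μ =
  ∃̇ λ f → IsFunction f I μ ∧̇
    (∀̇ λ H → H ⊆̇ μ ⇒̇ SizeBelow H μ ⇒̇
      (∀̇ λ Y → IsPreimage Y f I H ⇒̇ ¬̇ Y ∈̇ U))

------------------------------------------------------------------------
-- Conditions of Add(κ,1): partial functions from κ to 2 of size < κ

-- t = 2 = {0 , {0}}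
IsTwo : D → Formula D
IsTwo t = ∀̇ λ w → w ∈̇ t ⇔̇ IsEmpty w ∨̇ (∀̇ λ v → v ∈̇ w ⇔̇ IsEmpty v)

IsAddCondition : D → D → Formula D
IsAddCondition κ p =
  ∃̇ λ A → ∃̇ λ t → A ⊆̇ κ ∧̇ SizeBelow A κ ∧̇ IsTwo t ∧̇ IsFunction p A t

------------------------------------------------------------------------
-- Conditions of ℙ(κ,θ): p is the function ⟨α , i⟩ ↦ C^p_{α,i}

-- e = ⟨⟨α , i⟩ , c⟩
IsEntry : D → D → D → D → Formula D
IsEntry e α i c = ∃̇ λ z → IsOrdPair z α i ∧̇ IsOrdPair e z c

-- C^p_{α,i} = c
Seq : D → D → D → D → Formula D
Seq p α i c = ∃∈ p λ e → IsEntry e α i c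

-- i(α)^p = ι: the i for which C^p_{α,i} is defined are those with ι ≤ i < θ.
StartsAt : D → D → D → D → Formula D
StartsAt θ p α ι =
  ι ∈̇ θ ∧̇ (∀̇ λ i → (∃̇ λ c → Seq p α i c) ⇔̇ i ∈̇ θ ∧̇ ι ⊆̇ i)

-- Below, s is γ + 1 for γ = γ^p.
IsℙCondition : D → D → D → Formula D
IsℙCondition κ θ p = ∃̇ λ γ → ∃̇ λ s →
    InAcc κ γ ∧̇ IsSuccessor s γ
  ∧̇ (∀∈ p λ e → ∃̇ λ α → ∃̇ λ i → ∃̇ λ c → InAcc s α ∧̇ IsEntry e α i c)
  ∧̇ (∀̇ λ α → ∀̇ λ i → ∀̇ λ c → ∀̇ λ c′ →
       Seq p α i c ⇒̇ Seq p α i c′ ⇒̇ c ≐ c′)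
  ∧̇ (∀̇ λ α → InAcc s α ⇒̇ (∃̇ λ ι → StartsAt θ p α ι))
  ∧̇ (∀̇ λ α → ∀̇ λ i → ∀̇ λ c → Seq p α i c ⇒̇ IsClub c α)
  ∧̇ (∀̇ λ α → ∀̇ λ i → ∀̇ λ j → ∀̇ λ c → ∀̇ λ c′ →
       Seq p α i c ⇒̇ Seq p α j c′ ⇒̇ i ⊆̇ j ⇒̇ c ⊆̇ c′)
  ∧̇ (∀̇ λ α → InAcc s α ⇒̇
       (∀̇ λ β → InAcc α β ⇔̇ (∃̇ λ i → ∃̇ λ c → Seq p α i c ∧̇ InAcc c β)))
  ∧̇ (∀̇ λ α → ∀̇ λ i → ∀̇ λ c → ∀̇ λ ᾱ → Seq p α i c ⇒̇ InAcc c ᾱ ⇒̇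
         (∃̇ λ ι → StartsAt θ p ᾱ ι ∧̇ ι ⊆̇ i)
       ∧̇ (∃̇ λ c̄ → Seq p ᾱ i c̄ ∧̇ IsInter c̄ c ᾱ))

-- The first index of the entry e is at most the first index of some entry
-- of p; for a condition p, this says that it is at most γ^p.
WithinHeight : D → D → Formula D
WithinHeight e p =
  ∃̇ λ α → ∃̇ λ i → ∃̇ λ c → IsEntry e α i c ∧̇
    (∃̇ λ α′ → ∃̇ λ i′ → ∃̇ λ c′ → Seq p α′ i′ c′ ∧̇ α ⊆̇ α′)

-- Inclusion alone would allow i(α)^q < i(α)^p.
EndExtends : D → D → Formula D
EndExtends q p = p ⊆̇ q ∧̇ (∀∈ q λ e → WithinHeight e p ⇒̇ e ∈̇ p)

------------------------------------------------------------------------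
-- The universe of sets
--
-- Aczel's iterative sets: sup A f is the set { f a ∣ a : A }.  Given
-- excluded middle and function extensionality this is a model of ZFC.
-- (Excluded middle in the form ∀ P → Dec P already chooses elements of
-- inhabited types; extensionality makes such choices on A → Bool respect
-- equality of subsets, as the axiom of choice in V requires.)

data V ℓ : Set (suc ℓ) where
  sup : (A : Set ℓ) → (A → V ℓ) → V ℓ

infix 4 _≈_ _∈_

_≈_ : V ℓ → V ℓ → Set ℓ
sup A f ≈ sup B g = (∀ a → ∃ λ b → f a ≈ g b) × (∀ b → ∃ λ a → f a ≈ g b)

_∈_ : V ℓ → V ℓ → Set ℓ
x ∈ sup B g = ∃ λ b → x ≈ g b

infix 1 V⊨_

V⊨_ : Formula (V ℓ) → Set (suc ℓ)
V⊨_ {ℓ} (x ∈̇ y)  = Lift (suc ℓ) (x ∈ y)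
V⊨_ {ℓ} (x ≐ y)  = Lift (suc ℓ) (x ≈ y)
V⊨ ⊥̇             = ⊥
V⊨ (φ ∧̇ ψ)       = (V⊨ φ) × (V⊨ ψ)
V⊨ (φ ∨̇ ψ)       = (V⊨ φ) ⊎ (V⊨ ψ)
V⊨ (φ ⇒̇ ψ)       = (V⊨ φ) → (V⊨ ψ)
V⊨ (∀̇ φ)         = ∀ x → V⊨ φ x
V⊨ (∃̇ φ)         = ∃ λ x → V⊨ φ x

≈-refl : (x : V ℓ) → x ≈ x
≈-refl (sup A f) = (λ a → a , ≈-refl (f a)) , (λ a → a , ≈-refl (f a))

≈-sym : (x y : V ℓ) → x ≈ y → y ≈ x
≈-sym (sup A f) (sup B g) (r , s) =
    (λ b → proj₁ (s b) , ≈-sym (f (proj₁ (s b))) (g b) (proj₂ (s b)))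
  , (λ a → proj₁ (r a) , ≈-sym (f a) (g (proj₁ (r a))) (proj₂ (r a)))

≈-trans : (x y z : V ℓ) → x ≈ y → y ≈ z → x ≈ z
≈-trans (sup A f) (sup B g) (sup C h) (r , s) (r′ , s′) =
    (λ a → let (b , p) = r a ; (c , q) = r′ b in
           c , ≈-trans (f a) (g b) (h c) p q)
  , (λ c → let (b , q) = s′ c ; (a , p) = s b in
           a , ≈-trans (f a) (g b) (h c) p q)

≈-isEquivalence : IsEquivalence (_≈_ {ℓ})
≈-isEquivalence = record
  { refl  = λ {x} → ≈-refl x
  ; sym   = λ {x} {y} → ≈-sym x y
  ; trans = λ {x} {y} {z} → ≈-trans x y z
  }

∈-respʳ : (z x y : V ℓ) → x ≈ y → z ∈ x → z ∈ y
∈-respʳ z (sup A f) (sup B g) (r , _) (a , p) =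
  let (b , q) = r a in b , ≈-trans z (f a) (g b) p q

≈⇒⊆ : (x y : V ℓ) → x ≈ y → V⊨ x ⊆̇ y
≈⇒⊆ x y x≈y z (lift z∈x) = lift (∈-respʳ z x y x≈y z∈x)

⊆-antisym : (x y : V ℓ) → (V⊨ x ⊆̇ y) → (V⊨ y ⊆̇ x) → x ≈ y
⊆-antisym (sup A f) (sup B g) x⊆y y⊆x =
    (λ a → lower (x⊆y (f a) (lift (a , ≈-refl (f a)))))
  , (λ b → let (a , p) = lower (y⊆x (g b) (lift (b , ≈-refl (g b)))) in
           a , ≈-sym (g b) (f a) p)

------------------------------------------------------------------------
-- The two forcing posets; q ≤ p means that q is the stronger condition.

⊇-poset : ∀ ℓ → Poset (suc ℓ) ℓ (suc ℓ)
⊇-poset ℓ = record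
  { Carrier = V ℓ
  ; _≈_ = _≈_
  ; _≤_ = λ q p → V⊨ p ⊆̇ q
  ; isPartialOrder = record
    { isPreorder = record
      { isEquivalence = ≈-isEquivalence
      ; reflexive = λ {q} {p} e → ≈⇒⊆ p q (≈-sym q p e)
      ; trans = λ r≤q q≤p z z∈p → r≤q z (q≤p z z∈p)
      }
    ; antisym = λ {q} {p} q≤p p≤q → ⊆-antisym q p p≤q q≤p
    }
  }

endExtension-poset : ∀ ℓ → Poset (suc ℓ) ℓ (suc ℓ)
endExtension-poset ℓ = record
  { Carrier = V ℓ
  ; _≈_ = _≈_
  ; _≤_ = λ q p → V⊨ EndExtends q p
  ; isPartialOrder = record
    { isPreorder = record
      { isEquivalence = ≈-isEquivalence
      ; reflexive = λ {q} {p} e →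
          ≈⇒⊆ p q (≈-sym q p e) , (λ z z∈q _ → ≈⇒⊆ q p e z z∈q)
      ; trans = λ { (q⊆r , r-ends) (p⊆q , q-ends) →
            (λ z z∈p → q⊆r z (p⊆q z z∈p))
          , (λ { e e∈r w@(α , i , c , entry , α′ , i′ , c′ ,
                          (e′ , e′∈p , entry′) , α≤α′) →
                 q-ends e
                   (r-ends e e∈r (α , i , c , entry , α′ , i′ , c′ ,
                                  (e′ , p⊆q e′ e′∈p , entry′) , α≤α′))
                   w }) }
      }
    ; antisym = λ {q} {p} q≤p p≤q →
        ⊆-antisym q p (proj₁ p≤q) (proj₁ q≤p)
    }
  }

Add[_,1] : V ℓ → Poset (suc ℓ) ℓ (suc ℓ)
Add[_,1] {ℓ} κ =
  On.poset (⊇-poset ℓ) (proj₁ {B = λ p → V⊨ IsAddCondition κ p})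

ℙ[_,_] : V ℓ → V ℓ → Poset (suc ℓ) ℓ (suc ℓ)
ℙ[_,_] {ℓ} κ θ =
  On.poset (endExtension-poset ℓ) (proj₁ {B = λ p → V⊨ IsℙCondition κ θ p})

------------------------------------------------------------------------
-- Names and the forcing relation

-- sup A x r is the name { ⟨ x a , r a ⟩ ∣ a : A }.  As ℙ(κ,θ) has no
-- weakest condition, names may also use a formal one, ⊤⁺, as a label.
data Name (P : Poset (suc ℓ) ℓ (suc ℓ)) : Set (suc ℓ) where
  sup : (A : Set ℓ) → (A → Name P) → (A → Poset.Carrier P ⁺) → Name P

check : {P : Poset (suc ℓ) ℓ (suc ℓ)} → V ℓ → Name P
check (sup A f) = sup A (λ a → check (f a)) (λ _ → ⊤⁺)

Below : (P : Poset (suc ℓ) ℓ (suc ℓ)) →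
        Poset.Carrier P → Poset.Carrier P ⁺ → Set (suc ℓ)
Below P q r = AddTop._≤⁺_ (Poset._≤_ P) [ q ] r

DenseBelow : (P : Poset (suc ℓ) ℓ (suc ℓ)) → Poset.Carrier P →
             (Poset.Carrier P → Set (suc ℓ)) → Set (suc ℓ)
DenseBelow P p Φ = ∀ q → q ≤ p → ∃ λ r → r ≤ q × Φ r
  where open Poset P using (_≤_)

-- p ⊩ x = y, that is, p ⊩ x ⊆ y and p ⊩ y ⊆ x
Forces≈ : (P : Poset (suc ℓ) ℓ (suc ℓ)) →
          Poset.Carrier P → Name P → Name P → Set (suc ℓ)
Forces≈ P p (sup A x r) (sup B y s) =
    (∀ a q → q ≤ p → Below P q (r a) →
       DenseBelow P q λ q′ → ∃ λ b → Below P q′ (s b) × Forces≈ P q′ (x a) (y b))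
  × (∀ b q → q ≤ p → Below P q (s b) →
       DenseBelow P q λ q′ → ∃ λ a → Below P q′ (r a) × Forces≈ P q′ (x a) (y b))
  where open Poset P using (_≤_)

Forces∈ : (P : Poset (suc ℓ) ℓ (suc ℓ)) →
          Poset.Carrier P → Name P → Name P → Set (suc ℓ)
Forces∈ P p x (sup B y s) =
  DenseBelow P p λ q → ∃ λ b → Below P q (s b) × Forces≈ P q x (y b)

Forces : (P : Poset (suc ℓ) ℓ (suc ℓ)) →
         Poset.Carrier P → Formula (Name P) → Set (suc ℓ)
Forces P p (x ∈̇ y) = Forces∈ P p x y
Forces P p (x ≐ y) = Forces≈ P p x y
Forces P p ⊥̇       = ⊥
Forces P p (φ ∧̇ ψ) = Forces P p φ × Forces P p ψ
Forces P p (φ ∨̇ ψ) = DenseBelow P p λ q → Forces P q φ ⊎ Forces P q ψ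
Forces P p (φ ⇒̇ ψ) = ∀ q → Poset._≤_ P q p → Forces P q φ → Forces P q ψ
Forces P p (∀̇ φ)   = ∀ x → Forces P p (φ x)
Forces P p (∃̇ φ)   = DenseBelow P p λ q → ∃ λ x → Forces P q (φ x)

-- Truth in the generic extension: being forced by every condition.
infix 1 V^_⊨_

V^_⊨_ : (P : Poset (suc ℓ) ℓ (suc ℓ)) → Formula (Name P) → Set (suc ℓ)
V^ P ⊨ φ = ∀ p → Forces P p φ

{-# OPTIONS --safe #-}

-- For i < θ let S_i consist of the conditions p of ℙ(κ,θ) for which C^p_{γ^p,i}
-- is defined, where q is stronger than p if moreover γ^p = γ^q or
-- γ^p ∈ acc(C^q_{γ^q,i}).  S_i is a κ-closed tree with few nodes of each height,
-- and so has a dense subset isomorphic to a dense subset of Add(κ,1), the tree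
-- of sequences of successor length below κ over κ.  Through it the measure in
-- V^{Add(κ,1)} becomes an S_i-name for a measure U_i.  If q ≤ p in ℙ(κ,θ), then
-- q ≤ p in S_i for all large i, so that what p decides about U_i is still decided
-- by q for all large i; and since S_i is κ-closed and every p in S_i with an
-- extension q in ℙ(κ,θ) has an extension in S_i that is below q, one condition
-- can decide a given set for all large i at once.  Hence "almost all U_i, in the
-- sense of W, contain X_i" defines an ultrafilter U in V^{ℙ(κ,θ)}, where X_i is
-- the part of X in the i-th of θ many pieces of κ.  Sending the i-th piece to i
-- maps U to W.  Conversely, a function from κ to μ < κ is almost everywhere
-- constant on the i-th piece, with value g(i) say, and maps U to the image of W
-- under g.
module Submission where

open import Defs hiding (ℓ; d; D)
open import Level using (Level; suc; _⊔_; Lift; lift; lower)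
open import Axiom.ExcludedMiddle using (ExcludedMiddle)
open import Axiom.Extensionality.Propositional using (Extensionality; lower-extensionality)
open import Data.Bool using (Bool; true; false; T)
import Data.Empty.Polymorphic as Polymorphic
open import Data.Empty using (⊥; ⊥-elim)
open import Data.Unit using (⊤; tt)
open import Data.Product using (Σ; ∃; _×_; _,_; proj₁; proj₂)
open import Data.Sum using (_⊎_; inj₁; inj₂; [_,_]′)
open import Function using (_∘_; case_of_)
open import Induction.WellFounded using (WellFounded; Acc; acc)
open import Relation.Binary.Bundles using (Poset)
import Relation.Binary.Construct.Add.Supremum.NonStrict as AddTop
open import Relation.Binary.PropositionalEquality using (_≡_; _≢_; refl; sym; trans; cong; cong₂; subst)
open import Relation.Nullary using (¬_; Dec; yes; no)
open import Relation.Nullary.Decidable using (True; toWitness; fromWitness; recompute)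
open import Relation.Nullary.Construct.Add.Supremum using (_⁺; ⊤⁺; [_])

-- Generic objects never appear; everything is phrased through what conditions force. One tree, `Q`,
-- is embedded densely both into S_i below a condition `p₀` and into Add(κ,1) below a string forcing
-- `U` to be a measure, and properties of conditions travel from ℙ(κ,θ) through `Q` to Add(κ,1),
-- where the measure can judge them. The obstacle is that S_i has fewer extensions than ℙ(κ,θ): a
-- property must survive all extensions in ℙ(κ,θ), and `refine` keeps those within reach of S_i.
--
-- The smallness of the trees also comes from the measure in the extension. Add(κ,1) is
-- distributive, so one string decides, coordinate by coordinate, what almost all members of a
-- κ-sequence of relations on an ordinal below κ look like; two members must then agree.
--
-- Nothing makes the measures U_i concentrate on disjoint sets; the θ pieces of κ are there to make
-- the index recoverable from an element of κ. As to W, uniformity turns "for all large i" into "for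
-- almost all i", and distributivity of ℙ(κ,θ) decides subsets of θ and functions on θ in the ground
-- model, where W lives.

module Theory {ℓ : Level} (em : ExcludedMiddle (suc ℓ)) (ext : Extensionality (suc ℓ) (suc ℓ)) where

 -- Classical logic, well-orders and recursion with choice

 module Classical where

  -- Excluded middle gives every large proposition a small equivalent. Forcing statements, which
  -- live in `Set (suc ℓ)`, can then index the elements of sets and names.
  record Sq (P : Set (suc ℓ)) : Set ℓ where
    constructor box
    field
      token : True (em {P})

  sq : {P : Set (suc ℓ)} → P → Sq P
  sq p = box (fromWitness p)

  unsq : {P : Set (suc ℓ)} → Sq P → P
  unsq (box t) = toWitness t

  em↓ : {P : Set ℓ} → Dec P
  em↓ {P} with em {Lift (suc ℓ) P}
  ... | yes (lift p) = yes p
  ... | no ¬p = no (¬p ∘ lift)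

  byContradiction : {P : Set (suc ℓ)} → ¬ ¬ P → P
  byContradiction {P} ¬¬p with em {P}
  ... | yes p = p
  ... | no ¬p = ⊥-elim (¬¬p ¬p)

  byContradiction↓ : {P : Set ℓ} → ¬ ¬ P → P
  byContradiction↓ {P} ¬¬p with em↓ {P}
  ... | yes p = p
  ... | no ¬p = ⊥-elim (¬¬p ¬p)

  bool : Set (suc ℓ) → Bool
  bool P with em {P}
  ... | yes _ = true
  ... | no _ = false

  bool-true : {P : Set (suc ℓ)} → P → bool P ≡ true
  bool-true {P} p with em {P}
  ... | yes _ = refl
  ... | no ¬p = ⊥-elim (¬p p)

  true-bool : {P : Set (suc ℓ)} → bool P ≡ true → P
  true-bool {P} e with em {P}
  true-bool e | yes p = p
  true-bool () | no _

  bool-false : {P : Set (suc ℓ)} → ¬ P → bool P ≡ false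
  bool-false {P} ¬p with em {P}
  ... | yes p = ⊥-elim (¬p p)
  ... | no _ = refl

  bool-cong : {P Q : Set (suc ℓ)} → (P → Q) → (Q → P) → bool P ≡ bool Q
  bool-cong {P} {Q} f g with em {Q}
  ... | yes q = bool-true (g q)
  ... | no ¬q = bool-false (¬q ∘ f)

  bool-≡ : {a b : Bool} → (a ≡ true → b ≡ true) → (b ≡ true → a ≡ true) → a ≡ b
  bool-≡ {false} {false} _ _ = refl
  bool-≡ {false} {true} _ g = g refl
  bool-≡ {true} {false} f _ = sym (f refl)
  bool-≡ {true} {true} _ _ = refl

  false≢true : ∀ {a} {A : Set a} {b : Bool} → b ≡ false → b ≡ true → A
  false≢true refl ()

  ext↓ : Extensionality ℓ ℓ
  ext↓ = lower-extensionality (suc ℓ) (suc ℓ) ext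

  ext₀ : {A : Set ℓ} {B : A → Set} {f g : ∀ a → B a} → (∀ a → f a ≡ g a) → f ≡ g
  ext₀ = lower-extensionality (suc ℓ) (suc ℓ) ext

  record WellOrder : Set (suc ℓ) where
    infix 4 _<_ _≤_
    field
      K : Set ℓ
      _<_ : K → K → Set ℓ
      <-irrelevant : ∀ {j k} (p q : j < k) → p ≡ q
      <-trans : ∀ {i j k} → i < j → j < k → i < k
      compare : ∀ j k → j < k ⊎ j ≡ k ⊎ k < j
      wellFounded : WellFounded _<_

    _≤_ : K → K → Set ℓ
    j ≤ k = ¬ k < j

    wf-induction : ∀ {a} (P : K → Set a) → (∀ k → (∀ j → j < k → P j) → P k) → ∀ k → P k
    wf-induction P step k = go k (wellFounded k)
      where
      go : ∀ k → Acc _<_ k → P k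
      go k (acc rs) = step k λ j j<k → go j (rs j<k)

    <-irrefl : ∀ {k} → ¬ k < k
    <-irrefl {k} = wf-induction (λ k → ¬ k < k) (λ k ih p → ih k p p) k

    ≤-refl : ∀ {k} → k ≤ k
    ≤-refl = <-irrefl

    ≡⇒≤ : ∀ {j k} → j ≡ k → j ≤ k
    ≡⇒≤ refl = <-irrefl

    <⇒≤ : ∀ {j k} → j < k → j ≤ k
    <⇒≤ p q = <-irrefl (<-trans p q)

    ≤-split : ∀ {j k} → j ≤ k → j < k ⊎ j ≡ k
    ≤-split {j} {k} j≤k with compare j k
    ... | inj₁ p = inj₁ p
    ... | inj₂ (inj₁ e) = inj₂ e
    ... | inj₂ (inj₂ q) = ⊥-elim (j≤k q)

    <-or-≥ : ∀ j k → j < k ⊎ k ≤ j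
    <-or-≥ j k with compare j k
    ... | inj₁ p = inj₁ p
    ... | inj₂ (inj₁ refl) = inj₂ <-irrefl
    ... | inj₂ (inj₂ q) = inj₂ (<⇒≤ q)

    <-≤-trans : ∀ {i j k} → i < j → j ≤ k → i < k
    <-≤-trans p q with ≤-split q
    ... | inj₁ r = <-trans p r
    ... | inj₂ refl = p

    ≤-<-trans : ∀ {i j k} → i ≤ j → j < k → i < k
    ≤-<-trans p q with ≤-split p
    ... | inj₁ r = <-trans r q
    ... | inj₂ refl = q

    ≤-trans : ∀ {i j k} → i ≤ j → j ≤ k → i ≤ k
    ≤-trans p q r = q (<-≤-trans r p)

    ≤-antisym : ∀ {j k} → j ≤ k → k ≤ j → j ≡ k
    ≤-antisym p q with ≤-split p
    ... | inj₁ r = ⊥-elim (q r)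
    ... | inj₂ e = e

    least′ : (P : K → Set (suc ℓ)) → Σ K P → Σ K λ k → P k × ∀ j → P j → k ≤ j
    least′ P (k , p) = wf-induction (λ k → P k → Σ K λ k → P k × ∀ j → P j → k ≤ j) step k p
      where
      step : ∀ k → (∀ j → j < k → P j → Σ K λ k → P k × ∀ j → P j → k ≤ j) →
             P k → Σ K λ k → P k × ∀ j → P j → k ≤ j
      step k ih p with em {Σ K λ j → j < k × P j}
      ... | yes (j , j<k , pj) = ih j j<k pj
      ... | no none = k , p , λ j pj j<k → none (j , j<k , pj)

    abstract
      least : (P : K → Set (suc ℓ)) → Σ K P → Σ K λ k → P k × ∀ j → P j → k ≤ j
      least = least′

    Prefix : Set ℓ → K → Set ℓ
    Prefix A k = ∀ j → j < k → A

    prefix-≡ : {A : Set ℓ} {k : K} {f g : Prefix A k} → (∀ j p → f j p ≡ g j p) → f ≡ g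
    prefix-≡ h = ext↓ λ j → ext↓ λ p → h j p

    -- The witness that `em` returns for a given prefix is a fixed one, so choosing a value is a
    -- function of the prefix and well-founded recursion applies. `step` has to supply a witness
    -- only where the earlier values are correct.
    build′ : (A : Set ℓ) (Φ : ∀ k → Prefix A k → A → Set (suc ℓ)) →
            (∀ k (g : Prefix A k) →
               (∀ j (p : j < k) → Φ j (λ i q → g i (<-trans q p)) (g j p)) → Σ A (Φ k g)) →
            Σ (K → A) λ f → ∀ k → Φ k (λ j _ → f j) (f k)
    build′ A Φ step = f , correct
      where
      pick : ∀ k → Prefix A k → A ⊎ ⊤
      pick k g with em {Lift (suc ℓ) (Σ A λ a → Sq (Φ k g a))}
      ... | yes (lift (a , _)) = inj₁ a
      ... | no _ = inj₂ tt
      module _ (default : A) where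
        choose : ∀ k → Prefix A k → A
        choose k g = [ (λ a → a) , (λ _ → default) ]′ (pick k g)
        val : ∀ k → Acc _<_ k → A
        val k (acc rs) = choose k λ j p → val j (rs p)
        val-irr : ∀ k (a b : Acc _<_ k) → val k a ≡ val k b
        val-irr k (acc rs) (acc rs′) =
          cong (choose k) (prefix-≡ λ j p → val-irr j (rs p) (rs′ p))
        fun : K → A
        fun k = val k (wellFounded k)
        unfold : ∀ k → fun k ≡ choose k (λ j _ → fun j)
        unfold k = trans (val-irr k (wellFounded k) (acc λ {j} _ → wellFounded j)) refl
        chosen : ∀ k g → Σ A (Φ k g) → Φ k g (choose k g)
        chosen k g h with em {Lift (suc ℓ) (Σ A λ a → Sq (Φ k g a))}
        ... | yes (lift (a , s)) = unsq s
        ... | no n = ⊥-elim (n (lift (proj₁ h , sq (proj₂ h))))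
        good : ∀ k → Φ k (λ j _ → fun j) (fun k)
        good = wf-induction _ λ k ih →
          subst (Φ k (λ j _ → fun j)) (sym (unfold k)) (chosen k _ (step k _ ih))
      result : Dec (Lift (suc ℓ) K) → Σ (K → A) λ f → ∀ k → Φ k (λ j _ → f j) (f k)
      result (no n) = (λ k → ⊥-elim (n (lift k))) , λ k → ⊥-elim (n (lift k))
      result (yes (lift k)) = fun a₀ , good a₀
        where
        -- A value for the prefixes without a witness: at the least element the prefix is empty, so
        -- `step` applies unconditionally.
        a₀ : A
        a₀ = let (k₀ , _ , min) = least (λ _ → Lift (suc ℓ) ⊤) (k , lift tt)
                 none : ∀ j → ¬ j < k₀
                 none j = min j (lift tt)
             in proj₁ (step k₀ (λ j p → ⊥-elim (none j p)) (λ j p → ⊥-elim (none j p)))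
      f : K → A
      f = proj₁ (result em)
      correct : ∀ k → Φ k (λ j _ → f j) (f k)
      correct = proj₂ (result em)

    abstract
      build : (A : Set ℓ) (Φ : ∀ k → Prefix A k → A → Set (suc ℓ)) →
              (∀ k (g : Prefix A k) →
                 (∀ j (p : j < k) → Φ j (λ i q → g i (<-trans q p)) (g j p)) → Σ A (Φ k g)) →
              Σ (K → A) λ f → ∀ k → Φ k (λ j _ → f j) (f k)
      build = build′

  -- A well-order of the type of an uncountable regular cardinal: ω is a
  -- limit element of K.
  record RegularOrder : Set (suc ℓ) where
    field
      wellOrder : WellOrder
    open WellOrder wellOrder public
    field
      bound : ∀ k (f : Prefix K k) → Σ K λ b → ∀ j p → f j p < b
      ω 0ᵏ : K
      0<ω : 0ᵏ < ω
      ω-limit : ∀ k → k < ω → Σ K λ j → k < j × j < ω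

    next : ∀ k → Σ K λ j → k < j
    next k = let (b , h) = bound ω (λ _ _ → k) in b , h 0ᵏ 0<ω

    NoMaximum : K → Set ℓ
    NoMaximum k = ∀ i → i < k → Σ K λ j → i < j × j < k

    upper : ∀ j k → Σ K λ b → j < b × k < b
    upper j k with <-or-≥ j k
    ... | inj₁ p = let (b , q) = next k in b , <-trans p q , q
    ... | inj₂ p = let (b , q) = next j in b , q , ≤-<-trans p q

 open Classical

 -- Iterative sets, functions and ordinals

 module Sets where

  -- The relations ≈ and ∈ compute on the constructor of V, which blocks the
  -- inference of their arguments; the records make them inferable.
  infix 4 _≣_ _∊_

  record _≣_ (x y : V ℓ) : Set ℓ where
    constructor eq
    field
      un≣ : x ≈ y
  open _≣_ public

  record _∊_ (x y : V ℓ) : Set ℓ where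
    constructor mem
    field
      un∊ : x ∈ y
  open _∊_ public

  ≣-refl : ∀ {x} → x ≣ x
  ≣-refl {x} = eq (≈-refl x)

  ≣-sym : ∀ {x y} → x ≣ y → y ≣ x
  ≣-sym {x} {y} (eq e) = eq (≈-sym x y e)

  ≣-trans : ∀ {x y z} → x ≣ y → y ≣ z → x ≣ z
  ≣-trans {x} {y} {z} (eq e) (eq e′) = eq (≈-trans x y z e e′)

  ∊-≣ʳ : ∀ {x y z} → y ≣ z → x ∊ y → x ∊ z
  ∊-≣ʳ {x} {y} {z} (eq e) (mem m) = mem (∈-respʳ x y z e m)

  ∊-≣ˡ : ∀ {x y z} → x ≣ y → x ∊ z → y ∊ z
  ∊-≣ˡ {x} {y} {sup A f} (eq e) (mem (a , e′)) = mem (a , ≈-trans y x (f a) (≈-sym x y e) e′)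

  ∊-sup : ∀ {A : Set ℓ} {f : A → V ℓ} a → f a ∊ sup A f
  ∊-sup {f = f} a = mem (a , ≈-refl (f a))

  sup-∊ : ∀ {A : Set ℓ} {f : A → V ℓ} {x} → x ∊ sup A f → Σ A λ a → x ≣ f a
  sup-∊ (mem (a , e)) = a , eq e

  extensionality : ∀ {x y} → (∀ z → z ∊ x → z ∊ y) → (∀ z → z ∊ y → z ∊ x) → x ≣ y
  extensionality {x} {y} f g =
    eq (⊆-antisym x y (λ z m → lift (un∊ (f z (mem (lower m))))) (λ z m → lift (un∊ (g z (mem (lower m))))))

  private
    two : (V ℓ) → (V ℓ) → Lift ℓ Bool → V ℓ
    two x y (lift false) = x
    two x y (lift true) = y

  pair opair : V ℓ → V ℓ → V ℓ
  pair x y = sup (Lift ℓ Bool) (two x y)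
  opair x y = pair (pair x x) (pair x y)

  ∊-pairˡ : ∀ {x y} → x ∊ pair x y
  ∊-pairˡ = ∊-sup (lift false)

  ∊-pairʳ : ∀ {x y} → y ∊ pair x y
  ∊-pairʳ = ∊-sup (lift true)

  pair-∊ : ∀ {w x y} → w ∊ pair x y → w ≣ x ⊎ w ≣ y
  pair-∊ m with sup-∊ m
  ... | lift false , e = inj₁ e
  ... | lift true , e = inj₂ e

  pair-cong : ∀ {x y x′ y′} → x ≣ x′ → y ≣ y′ → pair x y ≣ pair x′ y′
  pair-cong {x} {y} {x′} {y′} e f = extensionality
    (λ z m → [ (λ h → ∊-≣ˡ (≣-sym (≣-trans h e)) ∊-pairˡ) , (λ h → ∊-≣ˡ (≣-sym (≣-trans h f)) ∊-pairʳ) ]′ (pair-∊ m))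
    (λ z m → [ (λ h → ∊-≣ˡ (≣-sym (≣-trans h (≣-sym e))) ∊-pairˡ) , (λ h → ∊-≣ˡ (≣-sym (≣-trans h (≣-sym f))) ∊-pairʳ) ]′ (pair-∊ m))

  opair-cong : ∀ {x y x′ y′} → x ≣ x′ → y ≣ y′ → opair x y ≣ opair x′ y′
  opair-cong e f = pair-cong (pair-cong e e) (pair-cong e f)

  opair-injective : ∀ {x y x′ y′} → opair x y ≣ opair x′ y′ → x ≣ x′ × y ≣ y′
  opair-injective {x} {y} {x′} {y′} e = x≣x′ , y≣y′
    where
    single : ∀ {w z} → w ∊ pair z z → w ≣ z
    single m = [ (λ h → h) , (λ h → h) ]′ (pair-∊ m)
    x≣x′ : x ≣ x′
    x≣x′ with pair-∊ (∊-≣ʳ e ∊-pairˡ)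
    ... | inj₁ h = single (∊-≣ʳ h ∊-pairˡ)
    ... | inj₂ h = ≣-sym (single (∊-≣ʳ (≣-sym h) ∊-pairˡ))
    half : ∀ {x y x′ y′} → opair x y ≣ opair x′ y′ → y ≣ x′ ⊎ y ≣ y′
    half e with pair-∊ (∊-≣ʳ e ∊-pairʳ)
    ... | inj₁ h = inj₁ (single (∊-≣ʳ h ∊-pairʳ))
    ... | inj₂ h = pair-∊ (∊-≣ʳ h ∊-pairʳ)
    y≣y′ : y ≣ y′
    y≣y′ with half e | half (≣-sym e)
    ... | inj₂ h | _ = h
    ... | inj₁ _ | inj₂ h = ≣-sym h
    ... | inj₁ h | inj₁ h′ = ≣-trans h (≣-trans (≣-sym x≣x′) (≣-sym h′))

  IsPair⇒≣ : ∀ {z x y} → (V⊨ IsPair z x y) → z ≣ pair x y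
  IsPair⇒≣ h = extensionality
    (λ w m → [ (λ e → ∊-≣ˡ (≣-sym (eq (lower e))) ∊-pairˡ) , (λ e → ∊-≣ˡ (≣-sym (eq (lower e))) ∊-pairʳ) ]′
               (proj₁ (h w) (lift (un∊ m))))
    (λ w m → mem (lower (proj₂ (h w) ([ (λ e → inj₁ (lift (un≣ e))) , (λ e → inj₂ (lift (un≣ e))) ]′ (pair-∊ m)))))

  ≣⇒IsPair : ∀ {z x y} → z ≣ pair x y → V⊨ IsPair z x y
  ≣⇒IsPair e w =
      (λ m → [ (λ h → inj₁ (lift (un≣ h))) , (λ h → inj₂ (lift (un≣ h))) ]′ (pair-∊ (∊-≣ʳ e (mem (lower m)))))
    , (λ h → lift (un∊ (∊-≣ʳ (≣-sym e)
        ([ (λ h → ∊-≣ˡ (≣-sym (eq (lower h))) ∊-pairˡ) , (λ h → ∊-≣ˡ (≣-sym (eq (lower h))) ∊-pairʳ) ]′ h))))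

  IsOrdPair⇒≣ : ∀ {z x y} → (V⊨ IsOrdPair z x y) → z ≣ opair x y
  IsOrdPair⇒≣ (a , b , ha , hb , hz) = ≣-trans (IsPair⇒≣ hz) (pair-cong (IsPair⇒≣ ha) (IsPair⇒≣ hb))

  ≣⇒IsOrdPair : ∀ {z x y} → z ≣ opair x y → V⊨ IsOrdPair z x y
  ≣⇒IsOrdPair {z} {x} {y} e = pair x x , pair x y , ≣⇒IsPair ≣-refl , ≣⇒IsPair ≣-refl , ≣⇒IsPair e

  Maps⇒∊ : ∀ {f x y} → (V⊨ Maps f x y) → opair x y ∊ f
  Maps⇒∊ (z , m , h) = ∊-≣ˡ (IsOrdPair⇒≣ h) (mem (lower m))

  ∊⇒Maps : ∀ {f x y} → opair x y ∊ f → V⊨ Maps f x y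
  ∊⇒Maps {f} {x} {y} m = opair x y , lift (un∊ m) , ≣⇒IsOrdPair ≣-refl

  record Graph (f A B : V ℓ) : Set (suc ℓ) where
    field
      total : ∀ {x} → x ∊ A → Σ (V ℓ) λ y → y ∊ B × opair x y ∊ f
      relation : ∀ {z} → z ∊ f → Σ (V ℓ) λ x → Σ (V ℓ) λ y → x ∊ A × y ∊ B × z ≣ opair x y
      functional : ∀ {x y y′} → opair x y ∊ f → opair x y′ ∊ f → y ≣ y′

  Graph⇒IsFunction : ∀ {f A B} → Graph f A B → V⊨ IsFunction f A B
  Graph⇒IsFunction g =
      (λ z m → let (x , y , mx , my , e) = relation (mem (lower m)) in
         x , lift (un∊ mx) , y , lift (un∊ my) , ≣⇒IsOrdPair e)
    , (λ x m → let (y , my , mf) = total (mem (lower m)) in y , lift (un∊ my) , ∊⇒Maps mf)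
    , (λ x y y′ h h′ → lift (un≣ (functional (Maps⇒∊ h) (Maps⇒∊ h′))))
    where open Graph g

  IsFunction⇒Graph : ∀ {f A B} → (V⊨ IsFunction f A B) → Graph f A B
  IsFunction⇒Graph (r , t , u) = record
    { total = λ m → let (y , my , h) = t _ (lift (un∊ m)) in y , mem (lower my) , Maps⇒∊ h
    ; relation = λ m → let (x , mx , y , my , h) = r _ (lift (un∊ m)) in
        x , y , mem (lower mx) , mem (lower my) , IsOrdPair⇒≣ h
    ; functional = λ m m′ → eq (lower (u _ _ _ (∊⇒Maps m) (∊⇒Maps m′)))
    }

  -- A set whose elements are transitive sets, and which is itself transitive,
  -- is represented by the small type K of chosen representatives of its elements.
  module Ordinal (κ : V ℓ) (ordinal : V⊨ IsOrdinal κ) where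

    private
      Index : V ℓ → Set ℓ
      Index (sup A f) = A
      element : ∀ x → Index x → V ℓ
      element (sup A f) = f
      member : ∀ x (a : Index x) → element x a ∊ x
      member (sup A f) = ∊-sup
      index : ∀ x {y} → y ∊ x → Σ (Index x) λ a → y ≣ element x a
      index (sup A f) = sup-∊

      class : Index κ → Index κ → Bool
      class a b = bool (Lift (suc ℓ) (element κ a ≣ element κ b))

      class-cong : ∀ {a b} → element κ a ≣ element κ b → class a ≡ class b
      class-cong e = ext₀ λ c → bool-cong (λ h → lift (≣-trans (≣-sym e) (lower h))) (λ h → lift (≣-trans e (lower h)))

      -- The choice looks only at the class, as a function to `Bool`, so by extensionality equal
      -- elements get the same representative. `default` is returned only for an empty class.
      pick : Index κ → (Index κ → Bool) → Index κ
      pick default c with em↓ {Σ (Index κ) λ b → T (c b)}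
      ... | yes (b , _) = b
      ... | no _ = default

      T-true : ∀ {b} → b ≡ true → T b
      T-true refl = tt
      true-T : ∀ {b} → T b → b ≡ true
      true-T {true} _ = refl

      pick-spec : ∀ a → element κ a ≣ element κ (pick a (class a))
      pick-spec a with em↓ {Σ (Index κ) λ b → T (class a b)}
      ... | yes (b , t) = lower (true-bool (true-T t))
      ... | no n = ⊥-elim (n (a , T-true (bool-true (lift ≣-refl))))

      pick-irr : ∀ a a′ c → (Σ (Index κ) λ b → T (c b)) → pick a c ≡ pick a′ c
      pick-irr a a′ c h with em↓ {Σ (Index κ) λ b → T (c b)}
      ... | yes _ = refl
      ... | no n = ⊥-elim (n h)

      rep : Index κ → Index κ
      rep a = pick a (class a)

      rep-cong : ∀ {a b} → element κ a ≣ element κ b → rep a ≡ rep b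
      rep-cong {a} {b} e = trans (cong (pick a) (class-cong e))
        (pick-irr a b (class b) (b , T-true (bool-true (lift ≣-refl))))

    -- Here and in `_<_` the proof is irrelevant: elements of κ that are equal as sets become
    -- propositionally equal, and any two proofs of an inequality are equal by `refl`.
    record K : Set ℓ where
      constructor rep-of
      field
        position : Index κ
        .canonical : rep position ≡ position

    abstract
      val : K → V ℓ
      val k = element κ (K.position k)

    abstract
      val∊κ : ∀ k → val k ∊ κ
      val∊κ k = member κ (K.position k)

    abstract
      val-injective : ∀ {j k} → val j ≣ val k → j ≡ k
      val-injective {rep-of a p} {rep-of b q} e with
        trans (sym (recompute em↓ p)) (trans (rep-cong e) (recompute em↓ q))
      ... | refl = refl

    abstract
      represent : ∀ {x} → x ∊ κ → Σ K λ k → x ≣ val k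
      represent m =
        let (a , e) = index κ m
            r = pick-spec a
        in rep-of (rep a) (sym (rep-cong r)) , ≣-trans e r

    infix 4 _<_
    record _<_ (j k : K) : Set ℓ where
      constructor less
      field
        .holds : val j ∊ val k

    <⇒∊ : ∀ {j k} → j < k → val j ∊ val k
    <⇒∊ (less m) = recompute em↓ m

    ∊⇒< : ∀ {j k} → val j ∊ val k → j < k
    ∊⇒< m = less m

    below : ∀ {x} k → x ∊ val k → Σ K λ j → j < k × x ≣ val j
    below k m =
      let m′ = mem (lower (proj₁ ordinal _ (lift (un∊ (val∊κ k))) _ (lift (un∊ m))))
          (j , e) = represent m′
      in j , ∊⇒< (∊-≣ˡ e m) , e

    <-trans : ∀ {i j k} → i < j → j < k → i < k
    <-trans {i} {j} {k} p q = ∊⇒< (mem (lower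
      (proj₂ ordinal _ (lift (un∊ (val∊κ k))) _ (lift (un∊ (<⇒∊ q))) _ (lift (un∊ (<⇒∊ p))))))

    wellFounded : WellFounded _<_
    wellFounded k = go (val k) k ≣-refl
      where
      go : ∀ x k → val k ≣ x → Acc _<_ k
      go (sup A f) k e = acc λ {j} j<k →
        let (a , e′) = sup-∊ (∊-≣ʳ e (<⇒∊ j<k)) in go (f a) j e′

    compare : ∀ j k → j < k ⊎ j ≡ k ⊎ k < j
    compare j = go j (wellFounded j)
      where
      go : ∀ j → Acc _<_ j → ∀ k → j < k ⊎ j ≡ k ⊎ k < j
      go j (acc rs) k = go′ k (wellFounded k)
        where
        go′ : ∀ k → Acc _<_ k → j < k ⊎ j ≡ k ⊎ k < j
        go′ k (acc rs′) with em↓ {Σ K λ i → i < j × (k < i ⊎ k ≡ i)}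
                           | em↓ {Σ K λ i → i < k × (j < i ⊎ j ≡ i)}
        ... | yes (i , i<j , inj₁ k<i) | _ = inj₂ (inj₂ (<-trans k<i i<j))
        ... | yes (i , i<j , inj₂ refl) | _ = inj₂ (inj₂ i<j)
        ... | no _ | yes (i , i<k , inj₁ j<i) = inj₁ (<-trans j<i i<k)
        ... | no _ | yes (i , i<k , inj₂ refl) = inj₁ i<k
        ... | no n | no n′ = inj₂ (inj₁ (val-injective (extensionality sub sub′)))
          where
          sub : ∀ z → z ∊ val j → z ∊ val k
          sub z m with below j m
          ... | i , i<j , e with go i (rs i<j) k
          ... | inj₁ i<k = ∊-≣ˡ (≣-sym e) (<⇒∊ i<k)
          ... | inj₂ (inj₁ refl) = ⊥-elim (n (i , i<j , inj₂ refl))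
          ... | inj₂ (inj₂ k<i) = ⊥-elim (n (i , i<j , inj₁ k<i))
          sub′ : ∀ z → z ∊ val k → z ∊ val j
          sub′ z m with below k m
          ... | i , i<k , e with go′ i (rs′ i<k)
          ... | inj₁ j<i = ⊥-elim (n′ (i , i<k , inj₁ j<i))
          ... | inj₂ (inj₁ refl) = ⊥-elim (n′ (i , i<k , inj₂ refl))
          ... | inj₂ (inj₂ i<j) = ∊-≣ˡ (≣-sym e) (<⇒∊ i<j)

    wellOrder : WellOrder
    wellOrder = record
      { K = K ; _<_ = _<_ ; <-irrelevant = λ _ _ → refl ; <-trans = <-trans
      ; compare = compare ; wellFounded = wellFounded }

    open WellOrder wellOrder public using (Prefix)

    module Regular (regular : V⊨ IsRegular κ) where

      private
        graph : ∀ k → Prefix K k → V ℓ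
        graph k f = sup (Σ K λ j → j < k) λ { (j , p) → opair (val j) (val (f j p)) }

        graph-Graph : ∀ k f → Graph (graph k f) (val k) κ
        graph-Graph k f = record
          { total = λ m → let (j , p , e) = below k m in
              val (f j p) , val∊κ (f j p) , ∊-≣ˡ (opair-cong (≣-sym e) ≣-refl) (∊-sup (j , p))
          ; relation = λ m → let ((j , p) , e) = sup-∊ m in val j , val (f j p) , <⇒∊ p , val∊κ (f j p) , e
          ; functional = λ m m′ →
              let ((j , p) , e) = sup-∊ m
                  ((j′ , p′) , e′) = sup-∊ m′
                  (ex , ey) = opair-injective e
                  (ex′ , ey′) = opair-injective e′
              in ≣-trans ey (≣-trans (same (val-injective (≣-trans (≣-sym ex) ex′)) p p′) (≣-sym ey′))
          }
          where
          same : ∀ {j j′} → j ≡ j′ → (p : j < k) (p′ : j′ < k) → val (f j p) ≣ val (f j′ p′)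
          same refl p p′ = ≣-refl

      bound : ∀ k (f : Prefix K k) → Σ K λ b → ∀ j p → f j p < b
      bound k f =
        let (β , mβ , h) = proj₂ regular (val k) (lift (un∊ (val∊κ k))) (graph k f) (Graph⇒IsFunction (graph-Graph k f))
            (b , e) = represent (mem (lower mβ))
        in b , λ j p → ∊⇒< (∊-≣ʳ e (mem (lower (h (val j) (val (f j p)) (∊⇒Maps (∊-sup (j , p)))))))

      -- Regularity applied to a constant function on a nonempty initial segment. Here κ may be ω,
      -- as the lemma also serves for θ.
      limit : ∀ k → Σ K λ j → k < j
      limit k = proj₁ b , proj₂ b _ (proj₂ (proj₂ nonempty))
        where
        nonempty : Σ K λ l → Σ K λ k → k < l
        nonempty with em↓ {Σ K λ l → Σ K λ k → k < l}
        ... | yes h = h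
        ... | no n = ⊥-elim (no-omega (proj₂ (proj₁ regular)))
          where
          -- If κ had only one element, it could not contain a limit ordinal.
          no-omega : (∃ λ w → (V⊨ IsOmega w) × (V⊨ w ⊆̇ κ)) → ⊥
          no-omega (w , ((_ , (z , mz) , lim) , _) , w⊆κ) =
            let (y , my , mzy) = lim z mz
                (k , ek) = represent (mem (lower (w⊆κ z mz)))
                (l , el) = represent (mem (lower (w⊆κ y my)))
            in n (l , k , ∊⇒< (∊-≣ˡ ek (∊-≣ʳ el (mem (lower mzy)))))
        b = bound (proj₁ nonempty) (λ _ _ → k)

 open Sets

 -- The cardinals κ and θ as types

 module Cardinal where

  record RegularCardinal : Set (suc ℓ) where
    constructor regularCardinal
    field
      κ : V ℓ
      regular : V⊨ IsRegular κ
      w : V ℓ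
      omega : V⊨ IsOmega w
      w∈κ : V⊨ w ∈̇ κ

  module Uncountable (𝕜 : RegularCardinal) where

    open RegularCardinal 𝕜

    open Ordinal κ (proj₁ (proj₁ (proj₁ regular))) public
      renaming (_<_ to _<ᵏ_; <-trans to <ᵏ-trans) hiding (wellFounded; compare; Prefix)
    open Regular regular public

    private
      represented : Σ K λ k → w ≣ val k
      represented = represent (mem (lower w∈κ))
      ωᵏ : K
      ωᵏ = proj₁ represented
      w≣ω : w ≣ val ωᵏ
      w≣ω = proj₂ represented
      -- Only being below ω matters; the element need not be the least one.
      zero : Σ K λ k → k <ᵏ ωᵏ
      zero = case proj₁ (proj₂ (proj₁ omega)) of λ { (z , m) →
             case below ωᵏ (∊-≣ʳ w≣ω (mem (lower m))) of λ { (k , p , _) → k , p } }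
      limits : ∀ k → k <ᵏ ωᵏ → Σ K λ j → k <ᵏ j × j <ᵏ ωᵏ
      limits k p = case proj₂ (proj₂ (proj₁ omega)) (val k) (lift (un∊ (∊-≣ʳ (≣-sym w≣ω) (<⇒∊ p)))) of λ { (y , my , m) →
        case below ωᵏ (∊-≣ʳ w≣ω (mem (lower my))) of λ { (j , q , e) → j , ∊⇒< (∊-≣ʳ e (mem (lower m))) , q } }

    R : RegularOrder
    R = record { wellOrder = wellOrder ; bound = bound ; ω = ωᵏ ; 0ᵏ = proj₁ zero ; 0<ω = proj₂ zero ; ω-limit = limits }

    record Index : Set (suc ℓ) where
      constructor indexSet
      field
        θ : V ℓ
        θᵏ : K
        θ≣ : θ ≣ val θᵏ
        θ-limit : RegularOrder.NoMaximum R θᵏ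
        cardinal : V⊨ IsCardinal θ
        W : V ℓ
        uniform : V⊨ IsUniformUltrafilter W θ

 open Cardinal

 -- Closed trees with few nodes and their dense copies of `Q`

 module Trees where

  module OverOrder (R : RegularOrder) where

    open RegularOrder R

    -- `rank` need not be the height in the tree, and `closed` asks for some lower bound rather than
    -- a greatest one; the heights of conditions and the lengths of strings therefore serve
    -- directly.
    record Tree : Set (suc ℓ) where
      infix 4 _≼_
      field
        Node : Set ℓ
        _≼_ : Node → Node → Set ℓ
        ≼-refl : ∀ {t} → t ≼ t
        ≼-trans : ∀ {s t u} → s ≼ t → t ≼ u → s ≼ u
        root : Node
        ≼-root : ∀ t → t ≼ root
        rank : Node → K
        rank-mono : ∀ {s t} → s ≼ t → rank t ≤ rank s
        rank-strict : ∀ {s t} → s ≼ t → rank s ≡ rank t → s ≡ t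
        linear : ∀ {r s t} → r ≼ s → r ≼ t → s ≼ t ⊎ t ≼ s
        closed : ∀ k (c : Prefix Node k) → (∀ i j p q → i < j → c j q ≼ c i p) →
                 Σ Node λ r → ∀ j p → r ≼ c j p

      Compatible : Node → Node → Set ℓ
      Compatible s t = Σ Node λ r → r ≼ s × r ≼ t

      field
        tall : ∀ s k → Σ Node λ t → t ≼ s × k < rank t
        split : ∀ s → Σ Node λ t → Σ Node λ u → t ≼ s × u ≼ s × ¬ Compatible t u

      abstract
        -- Adds the case of an empty sequence, whose bound from `closed` need not lie below `s`.
        closed-below : ∀ s k (c : Prefix Node k) → (∀ j p → c j p ≼ s) → (∀ i j p q → i < j → c j q ≼ c i p) →
                       Σ Node λ r → r ≼ s × ∀ j p → r ≼ c j p
        closed-below s k c below decreasing with em↓ {Σ K λ j → j < k}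
        ... | yes (j , p) = let (r , h) = closed k c decreasing in r , ≼-trans (h j p) (below j p) , h
        ... | no none = s , ≼-refl , λ j p → ⊥-elim (none (j , p))

      abstract
        -- A decreasing sequence is built by recursion over all of `K`, entering `D j` at step `j`;
        -- the steps from `k` on only take lower bounds.
        distributive : ∀ k (D : K → Node → Set (suc ℓ)) → (∀ j {t u} → u ≼ t → D j t → D j u) →
                       ∀ s → (∀ j → j < k → ∀ t → t ≼ s → Σ Node λ u → u ≼ t × D j u) →
                       Σ Node λ q → q ≼ s × ∀ j → j < k → D j q
        distributive k D down s dense =
          let (q , q≼s , h) = closed-below s k (λ j _ → f j) (λ j _ → proj₁ (good j))
                                (λ i j _ _ p → proj₁ (proj₂ (good j)) i p)
          in q , q≼s , λ j p → down j (h j p) (proj₂ (proj₂ (good j)) p)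
          where
          Φ : ∀ j → Prefix Node j → Node → Set (suc ℓ)
          Φ j g t = t ≼ s × (∀ i p → t ≼ g i p) × (j < k → D j t)
          step : ∀ j (g : Prefix Node j) → (∀ i p → Φ i (λ h q → g h (<-trans q p)) (g i p)) → Σ Node (Φ j g)
          step j g ih with closed-below s j g (λ i p → proj₁ (ih i p))
                             (λ h i p q h<i → subst (λ p → g i q ≼ g h p) (<-irrelevant _ p) (proj₁ (proj₂ (ih i q)) h h<i))
                         | em↓ {j < k}
          ... | r , r≼s , h | no j≮k = r , r≼s , h , λ p → ⊥-elim (j≮k p)
          ... | r , r≼s , h | yes j<k with dense j j<k r r≼s
          ... | u , u≼r , d = u , ≼-trans u≼r r≼s , (λ i p → ≼-trans u≼r (h i p)) , λ _ → d
          built : Σ (K → Node) λ f → ∀ j → Φ j (λ i _ → f i) (f j)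
          built = build Node Φ step
          f : K → Node
          f = proj₁ built
          good : ∀ j → Φ j (λ i _ → f i) (f j)
          good = proj₂ built

    -- The nodes of the tree of nonempty sequences of length below κ over κ:
    -- (σ , k) is the restriction of σ to k + 1.
    Q : Set ℓ
    Q = (K → K) × K

    infix 4 _⊑_
    _⊑_ : Q → Q → Set ℓ
    (σ , k) ⊑ (τ , j) = j ≤ k × ∀ i → i ≤ j → σ i ≡ τ i

    record DenseCopy (𝕋 : Tree) : Set (suc ℓ) where
      open Tree 𝕋
      field
        E : Q → Node
        E-mono : ∀ {x y} → x ⊑ y → E x ≼ E y
        E-reflect : ∀ {x y} → E x ≼ E y → x ⊑ y
        E-dense : ∀ t → Σ Q λ x → E x ≼ t

    -- "Fewer than κ nodes of rank below `k`", in the form in which it is used: a κ-sequence of them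
    -- repeats.
    FewNodes : Tree → Set ℓ
    FewNodes 𝕋 = ∀ k (f : K → Node) → (∀ j → rank (f j) < k) → Σ K λ i → Σ K λ j → i < j × f i ≡ f j
      where open Tree 𝕋

    module _ (𝕋 : Tree) (small : FewNodes 𝕋) where

      open Tree 𝕋

      Decreasing : ∀ k → Prefix Node k → Set ℓ
      Decreasing k c = ∀ i j p q → i < j → c j q ≼ c i p

      -- The last inequality makes the ranks on level `k` of the copy of `Q` exceed `k`, which is
      -- what makes the copy dense.
      FarBelow : ∀ k → Prefix Node k → Node → Set ℓ
      FarBelow k c t = (∀ j p → t ≼ c j p × rank (c j p) < rank t) × k < rank t

      farBelow-down : ∀ {k c t u} → u ≼ t → FarBelow k c t → FarBelow k c u
      farBelow-down u≼t (h , p) =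
        (λ j q → ≼-trans u≼t (proj₁ (h j q)) , <-≤-trans (proj₂ (h j q)) (rank-mono u≼t)) , <-≤-trans p (rank-mono u≼t)

      abstract
        farBelow-below : ∀ k c s → (∀ j p → s ≼ c j p) → Σ Node λ t → t ≼ s × FarBelow k c t
        farBelow-below k c s h =
          case bound k (λ j p → rank (c j p)) of λ { (b , bd) →
          case upper k b of λ { (m , k<m , b<m) →
          case tall s m of λ { (t , t≼s , m<t) →
            t , t≼s , (λ j p → ≼-trans t≼s (h j p) , <-trans (bd j p) (<-trans b<m m<t)) , <-trans k<m m<t } } }

      -- The nodes on level `k` of the copy of `Q` under the branch `c`: a maximal antichain among
      -- the nodes far below `c`. It must have size exactly κ, to be enumerated by `K`, so `split`
      -- alone does not provide it.
      record Antichain (k : K) (c : Prefix Node k) : Set ℓ where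
        field
          A : K → Node
          far : ∀ j → FarBelow k c (A j)
          disjoint : ∀ {i j} → Compatible (A i) (A j) → i ≡ j
          meets : ∀ t → FarBelow k c t → Σ K λ j → Compatible (A j) t

      module _ (k : K) (c : Prefix Node k) (decreasing : Decreasing k c) where

        private
          start : Σ Node (FarBelow k c)
          start = case closed k c decreasing of λ { (s , h) →
                  case farBelow-below k c s h of λ { (t , _ , far) → t , far } }

          OnPath : ∀ j → Prefix Node j → Node → Set (suc ℓ)
          OnPath j g t = Lift (suc ℓ) (t ≼ proj₁ start × j < rank t × ∀ i p → t ≼ g i p)

          abstract
            -- A path of length κ. The parts of the tree that leave it at different heights supply κ
            -- many members of the antichain.
            path : Σ (K → Node) λ d → ∀ j → OnPath j (λ i _ → d i) (d j)
            path = build Node OnPath λ j g ih →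
              case closed-below (proj₁ start) j g (λ i p → proj₁ (lower (ih i p)))
                     (λ i i′ p q i<i′ → subst (λ p → g i′ q ≼ g i p) (<-irrelevant _ p) (proj₂ (proj₂ (lower (ih i′ q))) i i<i′)) of λ
              { (r , r≼ , h) → case tall r j of λ
              { (t , t≼r , j<t) → t , lift (≼-trans t≼r r≼ , j<t , λ i p → ≼-trans t≼r (h i p)) } }

          d : K → Node
          d = proj₁ path
          d-rank : ∀ j → j < rank (d j)
          d-rank j = proj₁ (proj₂ (lower (proj₂ path j)))
          d-decreasing : ∀ {i j} → i ≤ j → d j ≼ d i
          d-decreasing {i} {j} p with ≤-split p
          ... | inj₁ q = proj₂ (proj₂ (lower (proj₂ path j))) i q
          ... | inj₂ refl = ≼-refl
          d-far : ∀ j → FarBelow k c (d j)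
          d-far j = farBelow-down (proj₁ (lower (proj₂ path j))) (proj₂ start)

          Off : Node → Set ℓ
          Off t = Σ K λ j → ¬ Compatible (d j) t

          path-below : ∀ {t} j → Compatible (d j) t → rank t < j → d j ≼ t
          path-below j (r , r≼d , r≼t) p with linear r≼d r≼t
          ... | inj₁ h = h
          ... | inj₂ h = ⊥-elim (rank-mono h (<-trans p (d-rank j)))

          abstract
            -- If both incompatible extensions of `t` were compatible with the whole path, a path
            -- node of large rank would lie below both.
            off-dense : ∀ t → Σ Node λ u → u ≼ t × Off u
            off-dense t with split t
            ... | t₁ , t₂ , p₁ , p₂ , incompatible with em↓ {Off t₁} | em↓ {Off t₂}
            ... | yes o | _ = t₁ , p₁ , o
            ... | no _ | yes o = t₂ , p₂ , o
            ... | no n₁ | no n₂ =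
              case upper (rank t₁) (rank t₂) of λ { (j , q₁ , q₂) →
                ⊥-elim (incompatible (d j , path-below j (on j n₁) q₁ , path-below j (on j n₂) q₂)) }
              where
              on : ∀ {t} j → ¬ Off t → Compatible (d j) t
              on j n = byContradiction↓ λ h → n (j , h)

          Far : Node → Set ℓ
          Far t = FarBelow k c t × Off t

          -- The topmost nodes that are far below `c` and off the path. By linearity they form an
          -- antichain.
          Root : Node → Set ℓ
          Root t = Far t × ∀ u → t ≼ u → Far u → u ≡ t

          abstract
            root-above : ∀ t → Far t → Σ Node λ r → t ≼ r × Root r
            root-above t far with least (λ k → Lift (suc ℓ) (Σ Node λ u → t ≼ u × Far u × rank u ≡ k)) (rank t , lift (t , ≼-refl , far , refl))
            ... | _ , lift (r , t≼r , far-r , refl) , min = r , t≼r , far-r , λ u r≼u far-u →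
              sym (rank-strict r≼u (≤-antisym (min (rank u) (lift (u , ≼-trans t≼r r≼u , far-u , refl))) (rank-mono r≼u)))

          root-unique : ∀ {t u} → Root t → Root u → Compatible t u → t ≡ u
          root-unique (ft , rt) (fu , ru) (r , r≼t , r≼u) with linear r≼t r≼u
          ... | inj₁ t≼u = sym (rt _ t≼u fu)
          ... | inj₂ u≼t = ru _ u≼t ft

          -- An off node below `d j` lies under some root `r`. Were `d j` below `r`, then `r` would
          -- be compatible with the whole path; so `r` is below `d j`, and its rank exceeds `j`.
          roots-unbounded : ∀ j → Σ Node λ r → Root r × j < rank r
          roots-unbounded j with off-dense (d j)
          ... | u , u≼d , off-u with root-above u (farBelow-down u≼d (d-far j) , off-u)
          ... | r , u≼r , root-r with linear u≼d u≼r
          ... | inj₂ r≼d = r , root-r , <-≤-trans (d-rank j) (rank-mono r≼d)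
          ... | inj₁ d≼r = ⊥-elim (on (proj₂ (proj₁ root-r)))
            where
            on : ¬ Off r
            on (i , h) with <-or-≥ i j
            ... | inj₁ p = h (d j , d-decreasing (<⇒≤ p) , d≼r)
            ... | inj₂ p = h (d i , ≼-refl , ≼-trans (d-decreasing p) d≼r)

          -- Each step lists a root of least rank among those not yet listed; in an arbitrary order
          -- an enumeration by `K` could miss some.
          Nth : ∀ j → Prefix Node j → Node → Set (suc ℓ)
          Nth j g t = Lift (suc ℓ) (Root t × (∀ i p → g i p ≢ t) × ∀ u → Root u → (∀ i p → g i p ≢ u) → rank t ≤ rank u)

          New : ∀ j → Prefix Node j → K → Set (suc ℓ)
          New j g k = Lift (suc ℓ) (Σ Node λ t → Root t × (∀ i p → g i p ≢ t) × rank t ≡ k)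

          minimal : ∀ j g → (Σ K λ k → New j g k × ∀ j′ → New j g j′ → k ≤ j′) → Σ Node (Nth j g)
          minimal j g (_ , lift (t , root-t , fresh-t , refl) , min) =
              t , lift (root-t , fresh-t , λ u root-u fresh-u → min (rank u) (lift (u , root-u , fresh-u , refl)))

          new-root : ∀ j g → Σ K (New j g)
          new-root j g =
            case bound j (λ i p → rank (g i p)) of λ { (b , bd) →
             case roots-unbounded b of λ { (r , root-r , b<r) →
               rank r , lift (r , root-r , (λ i p e → <⇒≤ (bd i p) (subst (λ r → b < rank r) (sym e) b<r)) , refl) } }

          abstract
            nth : Σ (K → Node) λ A → ∀ j → Nth j (λ i _ → A i) (A j)
            nth = build Node Nth λ j g _ → minimal j g (least (New j g) (new-root j g))

          A : K → Node
          A = proj₁ nth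
          A-root : ∀ j → Root (A j)
          A-root j = proj₁ (lower (proj₂ nth j))
          A-fresh : ∀ {i j} → i < j → A i ≢ A j
          A-fresh {i} {j} p = proj₁ (proj₂ (lower (proj₂ nth j))) i p

          -- A root missed by the enumeration would bound the ranks of all roots
          -- enumerated.
          A-onto : ∀ r → Root r → Σ K λ j → A j ≡ r
          A-onto r root-r with em↓ {Σ K λ j → A j ≡ r}
          ... | yes h = h
          ... | no n =
            case next (rank r) of λ { (b , r<b) →
            case small b A (λ j → ≤-<-trans (proj₂ (proj₂ (lower (proj₂ nth j))) r root-r (λ i _ e → n (i , e))) r<b) of λ
            { (i , j , i<j , e) → ⊥-elim (A-fresh i<j e) } }

        abstract
          antichain : Antichain k c
          antichain = record
            { A = A
            ; far = λ j → proj₁ (proj₁ (A-root j))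
            ; disjoint = λ {i} {j} h → inj (compare i j) (root-unique (A-root i) (A-root j) h)
            ; meets = λ t far →
                case off-dense t of λ { (u , u≼t , off) →
                case root-above u (farBelow-down u≼t far , off) of λ { (r , u≼r , root-r) →
                case A-onto r root-r of λ { (j , e) → j , u , subst (u ≼_) (sym e) u≼r , u≼t } } }
            }
            where
            inj : ∀ {i j} → i < j ⊎ i ≡ j ⊎ j < i → A i ≡ A j → i ≡ j
            inj (inj₁ p) e = ⊥-elim (A-fresh p e)
            inj (inj₂ (inj₁ e)) _ = e
            inj (inj₂ (inj₂ p)) e = ⊥-elim (A-fresh p (sym e))

      private
        -- Being a function of the prefix alone, it can drive a recursion, and branches that agree
        -- below `k` choose from the same antichain. The branches `e σ` are decreasing, so they
        -- never meet the default `root`.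
        children : ∀ k → Prefix Node k → K → Node
        children k c j with em↓ {Decreasing k c}
        ... | yes h = Antichain.A (antichain k c h) j
        ... | no _ = root

        children-antichain : ∀ k c → Decreasing k c → Σ (Antichain k c) λ a → ∀ j → Antichain.A a j ≡ children k c j
        children-antichain k c h with em↓ {Decreasing k c}
        ... | yes h′ = antichain k c h′ , λ _ → refl
        ... | no n = ⊥-elim (n h)

        abstract
          copy : ∀ (σ : K → K) → Σ (K → Node) λ f → ∀ k → Lift (suc ℓ) (f k ≡ children k (λ j _ → f j) (σ k))
          copy σ = build Node (λ k g t → Lift (suc ℓ) (t ≡ children k g (σ k))) λ k g _ → children k g (σ k) , lift refl

        e : (K → K) → K → Node
        e σ = proj₁ (copy σ)

        e-eq : ∀ (σ : K → K) k → e σ k ≡ children k (λ j _ → e σ j) (σ k)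
        e-eq σ k = lower (proj₂ (copy σ) k)

        -- Serves the proof of density, where a branch is built together with the sequence that it
        -- follows.
        e-unique : ∀ (σ : K → K) (f : K → Node) → (∀ k → f k ≡ children k (λ j _ → f j) (σ k)) → ∀ k → f k ≡ e σ k
        e-unique σ f h = wf-induction _ λ k ih →
          trans (h k) (trans (cong (λ g → children k g (σ k)) (prefix-≡ ih)) (sym (e-eq σ k)))

        far-step : ∀ (f : K → Node) k σk → Decreasing k (λ j _ → f j) → f k ≡ children k (λ j _ → f j) σk → FarBelow k (λ j _ → f j) (f k)
        far-step f k σk dec eqn =
          let (a , h) = children-antichain k (λ j _ → f j) dec
          in subst (FarBelow k (λ j _ → f j)) (trans (h σk) (sym eqn)) (Antichain.far a σk)

        e-far : ∀ (σ : K → K) k → FarBelow k (λ j _ → e σ j) (e σ k)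
        e-far σ = wf-induction _ λ k ih →
          far-step (e σ) k (σ k) (λ i j p q i<j → proj₁ (proj₁ (ih j q) i i<j)) (e-eq σ k)

        e-decreasing : ∀ (σ : K → K) k → Decreasing k (λ j _ → e σ j)
        e-decreasing σ k i j _ _ i<j = proj₁ (proj₁ (e-far σ j) i i<j)

        e-mono : ∀ (σ : K → K) {i j} → i ≤ j → e σ j ≼ e σ i
        e-mono σ {i} {j} p with ≤-split p
        ... | inj₁ q = proj₁ (proj₁ (e-far σ j) i q)
        ... | inj₂ refl = ≼-refl

        e-local : ∀ {σ τ : K → K} k → (∀ i → i ≤ k → σ i ≡ τ i) → e σ k ≡ e τ k
        e-local {σ} {τ} = wf-induction (λ k → (∀ i → i ≤ k → σ i ≡ τ i) → e σ k ≡ e τ k) λ k ih h →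
          trans (e-eq σ k) (trans (cong₂ (children k) (prefix-≡ λ j p → ih j p λ i q → h i (<⇒≤ (≤-<-trans q p))) (h k ≤-refl)) (sym (e-eq τ k)))

        -- Compatibility at level `k` passes to the earlier levels, so by induction the branches
        -- agree below `k`; their nodes on level `k` then come from one antichain.
        e-disjoint : ∀ {σ τ : K → K} k → Compatible (e σ k) (e τ k) → ∀ i → i ≤ k → σ i ≡ τ i
        e-disjoint {σ} {τ} = wf-induction (λ k → Compatible (e σ k) (e τ k) → ∀ i → i ≤ k → σ i ≡ τ i) step
          where
          step : ∀ k → (∀ j → j < k → Compatible (e σ j) (e τ j) → ∀ i → i ≤ j → σ i ≡ τ i) →
                 Compatible (e σ k) (e τ k) → ∀ i → i ≤ k → σ i ≡ τ i
          step k ih (r , r≼σ , r≼τ) i i≤k with ≤-split i≤k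
          ... | inj₁ i<k = earlier i i<k
            where
            earlier : ∀ i → i < k → σ i ≡ τ i
            earlier i i<k = ih i i<k (r , ≼-trans r≼σ (e-mono σ (<⇒≤ i<k)) , ≼-trans r≼τ (e-mono τ (<⇒≤ i<k))) i ≤-refl
          ... | inj₂ refl = Antichain.disjoint a (r , subst (r ≼_) (trans (e-eq σ k) (trans (cong (λ g → children k g (σ k)) same) (sym (h (σ k))))) r≼σ
                                                   , subst (r ≼_) (trans (e-eq τ k) (sym (h (τ k)))) r≼τ)
            where
            same : (λ (j : K) (_ : j < k) → e σ j) ≡ (λ j _ → e τ j)
            same = prefix-≡ λ j p → e-local j λ i q →
              ih j p (r , ≼-trans r≼σ (e-mono σ (<⇒≤ p)) , ≼-trans r≼τ (e-mono τ (<⇒≤ p))) i q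
            ah = children-antichain k (λ j _ → e τ j) (e-decreasing τ k)
            a = proj₁ ah
            h = proj₂ ah

        e-dense : ∀ t → Σ Q λ x → e (proj₁ x) (proj₂ x) ≼ t
        -- The node on level `rank t` has rank above `rank t`, by the last clause of `FarBelow`;
        -- being compatible with `t`, it lies below `t`.
        e-dense t = (σ , rank t) , result
          where
          -- r is a lower bound of t and of the nodes v of the branch σ so far.
          Φ : ∀ k → Prefix (Node × K × Node) k → Node × K × Node → Set (suc ℓ)
          Φ k g (r , s , v) = Lift (suc ℓ)
            ((r ≼ t × r ≼ v × ∀ j p → r ≼ proj₁ (g j p)) × v ≡ children k (λ j p → proj₂ (proj₂ (g j p))) s
             × FarBelow k (λ j p → proj₂ (proj₂ (g j p))) v)
          step : ∀ k (g : Prefix (Node × K × Node) k) → (∀ j p → Φ j (λ i q → g i (<-trans q p)) (g j p)) → Σ (Node × K × Node) (Φ k g)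
          step k g ih =
            case closed-below t k (λ j p → proj₁ (g j p)) (λ j p → proj₁ (proj₁ (lower (ih j p)))) dec of λ { (r , r≼t , r≼) →
            case farBelow-below k (λ j p → proj₂ (proj₂ (g j p))) r
                  (λ j p → ≼-trans (r≼ j p) (proj₁ (proj₂ (proj₁ (lower (ih j p)))))) of λ { (u , u≼r , far) →
            case children-antichain k _ decᵛ of λ { (a , h) →
            case Antichain.meets a u far of λ { (s , w , w≼a , w≼u) →
            (w , s , Antichain.A a s) , lift
               ((≼-trans w≼u (≼-trans u≼r r≼t) , w≼a , λ j p → ≼-trans w≼u (≼-trans u≼r (r≼ j p))) , h s , Antichain.far a s) } } } }
            where
            dec : Decreasing k (λ j p → proj₁ (g j p))
            dec i j p q i<j = subst (λ p → proj₁ (g j q) ≼ proj₁ (g i p)) (<-irrelevant _ p)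
              (proj₂ (proj₂ (proj₁ (lower (ih j q)))) i i<j)
            decᵛ : Decreasing k (λ j p → proj₂ (proj₂ (g j p)))
            decᵛ i j p q i<j = subst (λ p → proj₂ (proj₂ (g j q)) ≼ proj₂ (proj₂ (g i p))) (<-irrelevant _ p)
              (proj₁ (proj₁ (proj₂ (proj₂ (lower (ih j q)))) i i<j))
          abstract
            built : Σ (K → Node × K × Node) λ f → ∀ k → Φ k (λ j _ → f j) (f k)
            built = build (Node × K × Node) Φ step
          σ : K → K
          σ k = proj₁ (proj₂ (proj₁ built k))
          v : K → Node
          v k = proj₂ (proj₂ (proj₁ built k))
          v≡e : ∀ k → v k ≡ e σ k
          v≡e = e-unique σ v λ k → proj₁ (proj₂ (lower (proj₂ built k)))
          Tall : Node → Set ℓ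
          Tall u = rank t < rank u
          result : e σ (rank t) ≼ t
          result = case lower (proj₂ built (rank t)) of λ { ((r≼t , r≼v , _) , _ , _ , high) →
            [ (λ h → h) , (λ h → ⊥-elim (rank-mono h (subst Tall (v≡e (rank t)) high))) ]′
            (linear {proj₁ (proj₁ built (rank t))} {e σ (rank t)} {t} (subst (proj₁ (proj₁ built (rank t)) ≼_) (v≡e (rank t)) r≼v) r≼t) }

      denseCopy : DenseCopy 𝕋
      denseCopy = record
        { E = λ x → e (proj₁ x) (proj₂ x)
        ; E-mono = λ { {σ , k} {τ , j} (j≤k , h) → subst (e σ k ≼_) (e-local j h) (e-mono σ j≤k) }
        ; E-reflect = reflect
        ; E-dense = e-dense
        }
        where
        reflect : ∀ {x y} → e (proj₁ x) (proj₂ x) ≼ e (proj₁ y) (proj₂ y) → x ⊑ y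
        reflect {σ , k} {τ , j} h with <-or-≥ k j
        ... | inj₂ j≤k = j≤k , e-disjoint j (e σ k , e-mono σ j≤k , h)
        -- Impossible: `e σ k` equals `e τ k`, whose rank is less than that of `e τ j`, so it cannot
        -- lie below `e τ j`.
        ... | inj₁ k<j =
          let same = e-local k (e-disjoint k (e σ k , ≼-refl , ≼-trans h (e-mono τ (<⇒≤ k<j))))
          in ⊥-elim (rank-mono h (subst (λ u → rank u < rank (e τ j)) (sym same) (proj₂ (proj₁ (e-far τ j) k k<j))))

 open Trees

 -- The forcing relation and names for functions

 module Forcing where

  module OverPoset (P : Poset (suc ℓ) ℓ (suc ℓ)) where

    open Poset P public using (_≤_) renaming (Carrier to Cond; refl to ≤-refl; trans to ≤-trans)

    Dense : Cond → (Cond → Set (suc ℓ)) → Set (suc ℓ)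
    Dense = DenseBelow P

    dense-mono : ∀ {p q Φ} → q ≤ p → Dense p Φ → Dense q Φ
    dense-mono q≤p h r r≤q = h r (≤-trans r≤q q≤p)

    dense-bind : ∀ {p Φ Ψ} → Dense p Φ → (∀ q → q ≤ p → Φ q → Dense q Ψ) → Dense p Ψ
    dense-bind h f q q≤p =
      let (r , r≤q , φ) = h q q≤p
          (s , s≤r , ψ) = f r (≤-trans r≤q q≤p) φ r ≤-refl
      in s , ≤-trans s≤r r≤q , ψ

    dense-map : ∀ {p Φ Ψ} → Dense p Φ → (∀ q → q ≤ p → Φ q → Ψ q) → Dense p Ψ
    dense-map h f q q≤p = let (r , r≤q , φ) = h q q≤p in r , r≤q , f r (≤-trans r≤q q≤p) φ

    always : ∀ {p Φ} → (∀ q → q ≤ p → Φ q) → Dense p Φ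
    always f q q≤p = q , ≤-refl , f q q≤p

    below-mono : ∀ {p q r} → q ≤ p → Below P p r → Below P q r
    below-mono q≤p AddTop.[ h ] = AddTop.[ ≤-trans q≤p h ]
    below-mono q≤p (_ AddTop.≤⊤⁺) = [ _ ] AddTop.≤⊤⁺

    infix 4 _⊩_≗_ _⊩_∊_

    record _⊩_≗_ (p : Cond) (x y : Name P) : Set (suc ℓ) where
      constructor eqᶠ
      field
        un≗ : Forces≈ P p x y
    open _⊩_≗_ public

    record _⊩_∊_ (p : Cond) (x y : Name P) : Set (suc ℓ) where
      constructor memᶠ
      field
        un∊ᶠ : Forces∈ P p x y
    open _⊩_∊_ public

    private
      ≈-mono : ∀ {p q} x y → q ≤ p → Forces≈ P p x y → Forces≈ P q x y
      ≈-mono (sup A x r) (sup B y s) q≤p (f , g) =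
        (λ a q′ h → f a q′ (≤-trans h q≤p)) , (λ b q′ h → g b q′ (≤-trans h q≤p))

      ≈-local : ∀ {p} x y → Dense p (λ q → Forces≈ P q x y) → Forces≈ P p x y
      ≈-local (sup A x r) (sup B y s) h =
          (λ a q q≤p q≤r → dense-bind (dense-mono q≤p h) λ q′ q′≤q e → proj₁ e a q′ ≤-refl (below-mono q′≤q q≤r))
        , (λ b q q≤p q≤s → dense-bind (dense-mono q≤p h) λ q′ q′≤q e → proj₂ e b q′ ≤-refl (below-mono q′≤q q≤s))

      ≈ᶠ-refl : ∀ p x → Forces≈ P p x x
      ≈ᶠ-refl p (sup A x r) =
          (λ a q _ h q′ q′≤q → q′ , ≤-refl , a , below-mono q′≤q h , ≈ᶠ-refl q′ (x a))
        , (λ a q _ h q′ q′≤q → q′ , ≤-refl , a , below-mono q′≤q h , ≈ᶠ-refl q′ (x a))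

      ≈ᶠ-sym : ∀ p x y → Forces≈ P p x y → Forces≈ P p y x
      ≈ᶠ-sym p (sup A x r) (sup B y s) (f , g) =
          (λ b q h h′ → dense-map (g b q h h′) λ { q′ _ (a , k , e) → a , k , ≈ᶠ-sym q′ (x a) (y b) e })
        , (λ a q h h′ → dense-map (f a q h h′) λ { q′ _ (b , k , e) → b , k , ≈ᶠ-sym q′ (x a) (y b) e })

      ≈ᶠ-trans : ∀ p x y z → Forces≈ P p x y → Forces≈ P p y z → Forces≈ P p x z
      ≈ᶠ-trans p (sup A x r) (sup B y s) (sup C z t) (f , g) (f′ , g′) =
          (λ a q h h′ → dense-bind (f a q h h′) λ { q′ k (b , l , e) →
             dense-map (f′ b q′ (≤-trans k h) l) λ { q″ k′ (c , l′ , e′) →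
               c , l′ , ≈ᶠ-trans q″ (x a) (y b) (z c) (≈-mono (x a) (y b) k′ e) e′ } })
        , (λ c q h h′ → dense-bind (g′ c q h h′) λ { q′ k (b , l , e) →
             dense-map (g b q′ (≤-trans k h) l) λ { q″ k′ (a , l′ , e′) →
               a , l′ , ≈ᶠ-trans q″ (x a) (y b) (z c) e′ (≈-mono (y b) (z c) k′ e) } })

    ≗-mono : ∀ {p q x y} → q ≤ p → p ⊩ x ≗ y → q ⊩ x ≗ y
    ≗-mono {x = x} {y} h (eqᶠ e) = eqᶠ (≈-mono x y h e)

    ≗-local : ∀ {p x y} → Dense p (λ q → q ⊩ x ≗ y) → p ⊩ x ≗ y
    ≗-local {x = x} {y} h = eqᶠ (≈-local x y (dense-map h λ _ _ → un≗))

    ≗-refl : ∀ {p x} → p ⊩ x ≗ x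
    ≗-refl {p} {x} = eqᶠ (≈ᶠ-refl p x)

    ≗-sym : ∀ {p x y} → p ⊩ x ≗ y → p ⊩ y ≗ x
    ≗-sym {p} {x} {y} (eqᶠ e) = eqᶠ (≈ᶠ-sym p x y e)

    ≗-trans : ∀ {p x y z} → p ⊩ x ≗ y → p ⊩ y ≗ z → p ⊩ x ≗ z
    ≗-trans {p} {x} {y} {z} (eqᶠ e) (eqᶠ f) = eqᶠ (≈ᶠ-trans p x y z e f)

    elements : ∀ {p x B y s} → p ⊩ x ∊ sup B y s → Dense p λ q → Σ B λ b → Below P q (s b) × q ⊩ x ≗ y b
    elements (memᶠ m) = dense-map m λ { _ _ (b , h , e) → b , h , eqᶠ e }

    fromElements : ∀ {p x B y s} → Dense p (λ q → Σ B λ b → Below P q (s b) × q ⊩ x ≗ y b) → p ⊩ x ∊ sup B y s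
    fromElements h = memᶠ (dense-map h λ { _ _ (b , k , e) → b , k , un≗ e })

    ∊-mono : ∀ {p q x y} → q ≤ p → p ⊩ x ∊ y → q ⊩ x ∊ y
    ∊-mono {y = sup B y s} h (memᶠ m) = memᶠ (dense-mono h m)

    ∊-local : ∀ {p x y} → Dense p (λ q → q ⊩ x ∊ y) → p ⊩ x ∊ y
    ∊-local {y = sup B y s} h = fromElements (dense-bind h λ _ _ → elements)

    ∊-≗ˡ : ∀ {p x x′ y} → p ⊩ x ≗ x′ → p ⊩ x ∊ y → p ⊩ x′ ∊ y
    ∊-≗ˡ {y = sup B y s} e m = fromElements (dense-map (elements m)
      λ { q q≤p (b , h , e′) → b , h , ≗-trans (≗-sym (≗-mono q≤p e)) e′ })

    ∊-≗ʳ : ∀ {p x y z} → p ⊩ y ≗ z → p ⊩ x ∊ y → p ⊩ x ∊ z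
    ∊-≗ʳ {y = sup B y s} {sup C z t} (eqᶠ (f , _)) m =
      fromElements (dense-bind (elements m) λ { q q≤p (b , h , e) →
        dense-map (f b q q≤p h) λ { r r≤q (c , k , e′) → c , k , ≗-trans (≗-mono r≤q e) (eqᶠ e′) } })

    ∊-element : ∀ {p B y s} (b : B) → Below P p (s b) → p ⊩ y b ∊ sup B y s
    ∊-element b h = fromElements (always λ q q≤p → b , below-mono q≤p h , ≗-refl)

    ≗-extensional : ∀ {p} x y → (∀ w q → q ≤ p → q ⊩ w ∊ x → q ⊩ w ∊ y) →
                    (∀ w q → q ≤ p → q ⊩ w ∊ y → q ⊩ w ∊ x) → p ⊩ x ≗ y
    ≗-extensional (sup A x r) (sup B y s) f g = eqᶠ
      ( (λ a q q≤p h → dense-map (elements (f (x a) q q≤p (∊-element a h))) λ { _ _ (b , k , e) → b , k , un≗ e })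
      , (λ b q q≤p h → dense-map (elements (g (y b) q q≤p (∊-element b h))) λ { _ _ (a , k , e) → a , k , un≗ (≗-sym e) }))

    forces-mono : ∀ {p q} φ → q ≤ p → Forces P p φ → Forces P q φ
    forces-mono (x ∈̇ y) h m = un∊ᶠ (∊-mono h (memᶠ {x = x} {y} m))
    forces-mono (x ≐ y) h e = ≈-mono x y h e
    forces-mono (φ ∧̇ ψ) h (f , g) = forces-mono φ h f , forces-mono ψ h g
    forces-mono (φ ∨̇ ψ) h f = dense-mono h f
    forces-mono (φ ⇒̇ ψ) h f r r≤q = f r (≤-trans r≤q h)
    forces-mono (∀̇ φ) h f x = forces-mono (φ x) h (f x)
    forces-mono (∃̇ φ) h f = dense-mono h f

    -- Density is built into the clauses for `∨̇` and `∃̇`, and the other clauses inherit it from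
    -- their parts.
    forces-local : ∀ {p} φ → Dense p (λ q → Forces P q φ) → Forces P p φ
    forces-local (x ∈̇ y) h = un∊ᶠ (∊-local {x = x} {y} (dense-map h λ _ _ → memᶠ))
    forces-local (x ≐ y) h = ≈-local x y h
    forces-local {p} ⊥̇ h = proj₂ (proj₂ (h p ≤-refl))
    forces-local (φ ∧̇ ψ) h =
      forces-local φ (dense-map h λ _ _ → proj₁) , forces-local ψ (dense-map h λ _ _ → proj₂)
    forces-local (φ ∨̇ ψ) h = dense-bind h λ _ _ f → f
    forces-local (φ ⇒̇ ψ) h q q≤p f = forces-local ψ (dense-map (dense-mono q≤p h)
      λ r r≤q g → g r ≤-refl (forces-mono φ r≤q f))
    forces-local (∀̇ φ) h x = forces-local (φ x) (dense-map h λ _ _ f → f x)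
    forces-local (∃̇ φ) h = dense-bind h λ _ _ f → f

    private
      two : Name P → Name P → Lift ℓ Bool → Name P
      two x y (lift false) = x
      two x y (lift true) = y

    pairᶠ opairᶠ : Name P → Name P → Name P
    pairᶠ x y = sup (Lift ℓ Bool) (two x y) (λ _ → ⊤⁺)
    opairᶠ x y = pairᶠ (pairᶠ x x) (pairᶠ x y)

    ∊-pairᶠˡ : ∀ {p x y} → p ⊩ x ∊ pairᶠ x y
    ∊-pairᶠˡ = ∊-element (lift false) (_ AddTop.≤⊤⁺)

    ∊-pairᶠʳ : ∀ {p x y} → p ⊩ y ∊ pairᶠ x y
    ∊-pairᶠʳ = ∊-element (lift true) (_ AddTop.≤⊤⁺)

    pairᶠ-∊ : ∀ {p w x y} → p ⊩ w ∊ pairᶠ x y → Dense p λ q → q ⊩ w ≗ x ⊎ q ⊩ w ≗ y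
    pairᶠ-∊ m = dense-map (elements m) λ { _ _ (lift false , _ , e) → inj₁ e ; _ _ (lift true , _ , e) → inj₂ e }

    ∊-pairᶠ : ∀ {p w x y} → Dense p (λ q → q ⊩ w ≗ x ⊎ q ⊩ w ≗ y) → p ⊩ w ∊ pairᶠ x y
    ∊-pairᶠ h = ∊-local (dense-map h λ { _ _ (inj₁ e) → ∊-≗ˡ (≗-sym e) ∊-pairᶠˡ ; _ _ (inj₂ e) → ∊-≗ˡ (≗-sym e) ∊-pairᶠʳ })

    pairᶠ-cong : ∀ {p x y x′ y′} → p ⊩ x ≗ x′ → p ⊩ y ≗ y′ → p ⊩ pairᶠ x y ≗ pairᶠ x′ y′
    pairᶠ-cong e f = ≗-extensional _ _
      (λ w q q≤p m → ∊-pairᶠ (dense-map (pairᶠ-∊ m) λ r r≤q →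
        [ (λ h → inj₁ (≗-trans h (≗-mono (≤-trans r≤q q≤p) e))) , (λ h → inj₂ (≗-trans h (≗-mono (≤-trans r≤q q≤p) f))) ]′))
      (λ w q q≤p m → ∊-pairᶠ (dense-map (pairᶠ-∊ m) λ r r≤q →
        [ (λ h → inj₁ (≗-trans h (≗-sym (≗-mono (≤-trans r≤q q≤p) e)))) , (λ h → inj₂ (≗-trans h (≗-sym (≗-mono (≤-trans r≤q q≤p) f)))) ]′))

    opairᶠ-cong : ∀ {p x y x′ y′} → p ⊩ x ≗ x′ → p ⊩ y ≗ y′ → p ⊩ opairᶠ x y ≗ opairᶠ x′ y′
    opairᶠ-cong e f = pairᶠ-cong (pairᶠ-cong e e) (pairᶠ-cong e f)

    opairᶠ-injective : ∀ {p x y x′ y′} → p ⊩ opairᶠ x y ≗ opairᶠ x′ y′ → p ⊩ x ≗ x′ × p ⊩ y ≗ y′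
    opairᶠ-injective {p} {x} {y} {x′} {y′} e = fst e , ≗-local
      (dense-bind (half e) λ q q≤p → [ (λ h → dense-map (half (≗-sym (≗-mono q≤p e))) λ r r≤q →
         [ (λ h′ → ≗-trans (≗-mono r≤q h) (≗-trans (≗-sym (≗-mono (≤-trans r≤q q≤p) (fst e))) (≗-sym h′))) , ≗-sym ]′)
       , (λ h → always λ r r≤q → ≗-mono r≤q h) ]′)
      where
      single : ∀ {p w z} → p ⊩ w ∊ pairᶠ z z → p ⊩ w ≗ z
      single m = ≗-local (dense-map (pairᶠ-∊ m) λ _ _ → [ (λ h → h) , (λ h → h) ]′)
      fst : ∀ {p x y x′ y′} → p ⊩ opairᶠ x y ≗ opairᶠ x′ y′ → p ⊩ x ≗ x′
      fst e = ≗-local (dense-map (pairᶠ-∊ (∊-≗ʳ e ∊-pairᶠˡ)) λ _ _ →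
        [ (λ h → single (∊-≗ʳ h ∊-pairᶠˡ)) , (λ h → ≗-sym (single (∊-≗ʳ (≗-sym h) ∊-pairᶠˡ))) ]′)
      half : ∀ {p x y x′ y′} → p ⊩ opairᶠ x y ≗ opairᶠ x′ y′ → Dense p λ q → q ⊩ y ≗ x′ ⊎ q ⊩ y ≗ y′
      half e = dense-bind (pairᶠ-∊ (∊-≗ʳ e ∊-pairᶠʳ)) λ _ _ →
        [ (λ h → always λ r r≤ → inj₁ (≗-mono r≤ (single (∊-≗ʳ h ∊-pairᶠʳ)))) , (λ h → pairᶠ-∊ (∊-≗ʳ h ∊-pairᶠʳ)) ]′

    IsPair⇒≗ : ∀ {p z x y} → Forces P p (IsPair z x y) → p ⊩ z ≗ pairᶠ x y
    IsPair⇒≗ h = ≗-extensional _ _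
      (λ w q q≤p m → ∊-pairᶠ (dense-map (proj₁ (h w) q q≤p (un∊ᶠ m)) λ _ _ → [ (λ e → inj₁ (eqᶠ e)) , (λ e → inj₂ (eqᶠ e)) ]′))
      (λ w q q≤p m → memᶠ (proj₂ (h w) q q≤p (dense-map (pairᶠ-∊ m) λ _ _ → [ (λ e → inj₁ (un≗ e)) , (λ e → inj₂ (un≗ e)) ]′)))

    ≗⇒IsPair : ∀ {p z x y} → p ⊩ z ≗ pairᶠ x y → Forces P p (IsPair z x y)
    ≗⇒IsPair e w =
        (λ q q≤p m → dense-map (pairᶠ-∊ (∊-≗ʳ (≗-mono q≤p e) (memᶠ m))) λ _ _ → [ (λ e → inj₁ (un≗ e)) , (λ e → inj₂ (un≗ e)) ]′)
      , (λ q q≤p h → un∊ᶠ (∊-≗ʳ (≗-sym (≗-mono q≤p e)) (∊-pairᶠ (dense-map h λ _ _ → [ (λ e → inj₁ (eqᶠ e)) , (λ e → inj₂ (eqᶠ e)) ]′))))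

    IsOrdPair⇒≗ : ∀ {p z x y} → Forces P p (IsOrdPair z x y) → p ⊩ z ≗ opairᶠ x y
    IsOrdPair⇒≗ h = ≗-local (dense-bind h λ { q _ (a , h′) → dense-map h′ λ { r _ (b , ha , hb , hz) →
      ≗-trans (IsPair⇒≗ hz) (pairᶠ-cong (IsPair⇒≗ ha) (IsPair⇒≗ hb)) } })

    ≗⇒IsOrdPair : ∀ {p z x y} → p ⊩ z ≗ opairᶠ x y → Forces P p (IsOrdPair z x y)
    ≗⇒IsOrdPair {x = x} {y} e = always λ q q≤p → pairᶠ x x , always λ r r≤q → pairᶠ x y
      , ≗⇒IsPair ≗-refl , ≗⇒IsPair ≗-refl , ≗⇒IsPair (≗-mono (≤-trans r≤q q≤p) e)

    Maps⇒∊ᶠ : ∀ {p f x y} → Forces P p (Maps f x y) → p ⊩ opairᶠ x y ∊ f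
    Maps⇒∊ᶠ h = ∊-local (dense-map h λ { _ _ (z , m , e) → ∊-≗ˡ (IsOrdPair⇒≗ e) (memᶠ m) })

    ∊⇒Mapsᶠ : ∀ {p f x y} → p ⊩ opairᶠ x y ∊ f → Forces P p (Maps f x y)
    ∊⇒Mapsᶠ {x = x} {y} m = always λ q q≤p → opairᶠ x y , un∊ᶠ (∊-mono q≤p m) , ≗⇒IsOrdPair ≗-refl

    check-≗ : ∀ {p} x y → x ≣ y → p ⊩ check x ≗ check y
    check-≗ x y (eq e) = eqᶠ (go x y e)
      where
      go : ∀ {p} x y → x ≈ y → Forces≈ P p (check x) (check y)
      go (sup A f) (sup B g) (h , h′) =
          (λ a q _ _ q′ _ → q′ , ≤-refl , proj₁ (h a) , (_ AddTop.≤⊤⁺) , go (f a) (g (proj₁ (h a))) (proj₂ (h a)))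
        , (λ b q _ _ q′ _ → q′ , ≤-refl , proj₁ (h′ b) , (_ AddTop.≤⊤⁺) , go (f (proj₁ (h′ b))) (g b) (proj₂ (h′ b)))

    ≗-check : ∀ {p} x y → p ⊩ check x ≗ check y → x ≣ y
    ≗-check x y (eqᶠ e) = eq (go x y e)
      where
      go : ∀ {p} x y → Forces≈ P p (check x) (check y) → x ≈ y
      go {p} (sup A f) (sup B g) (h , h′) =
          (λ a → case h a p ≤-refl (_ AddTop.≤⊤⁺) p ≤-refl of λ { (_ , _ , b , _ , e) → b , go (f a) (g b) e })
        , (λ b → case h′ b p ≤-refl (_ AddTop.≤⊤⁺) p ≤-refl of λ { (_ , _ , a , _ , e) → a , go (f a) (g b) e })

    check-∊ : ∀ {p x} y → x ∊ y → p ⊩ check x ∊ check y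
    check-∊ {x = x} (sup B g) m = let (b , e) = sup-∊ m in
      ∊-≗ˡ (check-≗ (g b) x (≣-sym e)) (∊-element b (_ AddTop.≤⊤⁺))

    ∊-check : ∀ {p z} y → p ⊩ z ∊ check y → Dense p λ q → Σ (V ℓ) λ x → x ∊ y × q ⊩ z ≗ check x
    ∊-check (sup B g) m = dense-map (elements m) λ { _ _ (b , _ , e) → g b , ∊-sup b , e }

    check-∊-check : ∀ {p} x y → p ⊩ check x ∊ check y → x ∊ y
    check-∊-check {p} x y m with ∊-check y m p ≤-refl
    ... | q , _ , x′ , m′ , e = ∊-≣ˡ (≣-sym (≗-check x x′ e)) m′

    record Functionᶠ (p : Cond) (f A B : Name P) : Set (suc ℓ) where
      field
        total : ∀ {q x} → q ≤ p → q ⊩ x ∊ A → Dense q λ r → Σ (Name P) λ y → r ⊩ y ∊ B × r ⊩ opairᶠ x y ∊ f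
        relation : ∀ {q z} → q ≤ p → q ⊩ z ∊ f → Dense q λ r → Σ (Name P) λ x → Σ (Name P) λ y →
                   r ⊩ x ∊ A × r ⊩ y ∊ B × r ⊩ z ≗ opairᶠ x y
        functional : ∀ {q x y y′} → q ≤ p → q ⊩ opairᶠ x y ∊ f → q ⊩ opairᶠ x y′ ∊ f → q ⊩ y ≗ y′

    functionᶠ : ∀ {p f A B} → Functionᶠ p f A B → Forces P p (IsFunction f A B)
    functionᶠ g =
        (λ z q q≤p m → dense-map (relation q≤p (memᶠ m)) λ { r r≤q (x , y , mx , my , e) →
           x , un∊ᶠ mx , always λ s s≤r → y , un∊ᶠ (∊-mono s≤r my) , ≗⇒IsOrdPair (≗-mono s≤r e) })
      , (λ x q q≤p m → dense-map (total q≤p (memᶠ m)) λ { r r≤q (y , my , mf) → y , un∊ᶠ my , ∊⇒Mapsᶠ mf })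
      , (λ x y y′ q q≤p h r r≤q h′ → un≗ (functional (≤-trans r≤q q≤p) (∊-mono r≤q (Maps⇒∊ᶠ h)) (Maps⇒∊ᶠ h′)))
      where open Functionᶠ g

    isFunctionᶠ : ∀ {p f A B} → Forces P p (IsFunction f A B) → Functionᶠ p f A B
    isFunctionᶠ (r , t , u) = record
      { total = λ q≤p m → dense-map (t _ _ q≤p (un∊ᶠ m)) λ { _ _ (y , my , h) → y , memᶠ my , Maps⇒∊ᶠ h }
      ; relation = λ q≤p m → dense-bind (r _ _ q≤p (un∊ᶠ m)) λ { _ _ (x , mx , h) → dense-map h λ { _ s≤ (y , my , h′) →
          x , y , ∊-mono s≤ (memᶠ mx) , memᶠ my , IsOrdPair⇒≗ h′ } }
      ; functional = λ q≤p m m′ → eqᶠ (u _ _ _ _ q≤p (∊⇒Mapsᶠ m) _ ≤-refl (∊⇒Mapsᶠ m′))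
      }

    module Comprehension {D : Set ℓ} (⟪_⟫ : D → Cond) (dense : ∀ p → Σ D λ d → ⟪ d ⟫ ≤ p) where

      -- Conditions form a large type but names have small index types, so the labels range over a
      -- small dense `D`; for monotone `B` this loses nothing.
      comprehension : (I : Set ℓ) → (I → Name P) → (I → Cond → Set (suc ℓ)) → Name P
      comprehension I l B = sup (Σ (I × D) λ { (i , d) → Sq (B i ⟪ d ⟫) }) (λ { ((i , _) , _) → l i }) (λ { ((_ , d) , _) → [ ⟪ d ⟫ ] })

      module _ {I : Set ℓ} {l : I → Name P} {B : I → Cond → Set (suc ℓ)}
               (mono : ∀ i {p q} → q ≤ p → B i p → B i q) where

        ∊-comprehension : ∀ {p x} → Dense p (λ q → Σ I λ i → q ⊩ x ≗ l i × B i q) → p ⊩ x ∊ comprehension I l B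
        ∊-comprehension h = ∊-local λ q q≤p → case h q q≤p of λ { (r , r≤q , i , e , b) →
          case dense r of λ { (d , d≤r) → ⟪ d ⟫ , ≤-trans d≤r r≤q ,
            ∊-≗ˡ (≗-sym (≗-mono d≤r e)) (∊-element ((i , d) , sq (mono i d≤r b)) AddTop.[ ≤-refl ]) } }

        comprehension-∊ : ∀ {p x} → p ⊩ x ∊ comprehension I l B → Dense p λ q → Σ I λ i → q ⊩ x ≗ l i × B i q
        comprehension-∊ m = dense-map (elements m) λ { _ _ (((i , d) , b) , AddTop.[ h ] , e) → i , e , mono i h (unsq b) }

      -- Every element of `A` is, densely, one of the canonical names `l i`, and `Â` tells which of
      -- these belong. With domain and range in this form, functions and bijections are verified on
      -- indices.
      record Presents (p : Cond) (A : Name P) {I : Set ℓ} (l : I → Name P) (Â : I → Cond → Set (suc ℓ)) : Set (suc ℓ) where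
        field
          split : ∀ {q x} → q ≤ p → q ⊩ x ∊ A → Dense q λ r → Σ I λ i → r ⊩ x ≗ l i × Â i r
          member : ∀ {q} i → q ≤ p → Â i q → q ⊩ l i ∊ A

      presents-comprehension : ∀ {p I l B} → (∀ i {p q} → q ≤ p → B i p → B i q) → Presents p (comprehension I l B) l B
      presents-comprehension {B = B} mono = record
        { split = λ _ → comprehension-∊ mono
        ; member = λ i _ b → ∊-comprehension mono (always λ r r≤q → i , ≗-refl , mono i r≤q b) }

      module Graphs {I J : Set ℓ} {l : I → Name P} {m : J → Name P}
                    (l-injective : ∀ {p i i′} → p ⊩ l i ≗ l i′ → i ≡ i′) (m-injective : ∀ {p j j′} → p ⊩ m j ≗ m j′ → j ≡ j′)
                    (B : I → J → Cond → Set (suc ℓ)) (mono : ∀ i j {p q} → q ≤ p → B i j p → B i j q) where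

        graph : Name P
        graph = comprehension (I × J) (λ { (i , j) → opairᶠ (l i) (m j) }) (λ { (i , j) → B i j })

        ∊-graph : ∀ {p i j} → B i j p → p ⊩ opairᶠ (l i) (m j) ∊ graph
        ∊-graph {i = i} {j} b = ∊-comprehension (λ { (i , j) → mono i j }) (always λ r r≤q → (i , j) , ≗-refl , mono i j r≤q b)

        graph-∊ : ∀ {p x y} → p ⊩ opairᶠ x y ∊ graph → Dense p λ q → Σ I λ i → Σ J λ j → q ⊩ x ≗ l i × q ⊩ y ≗ m j × B i j q
        graph-∊ h = dense-map (comprehension-∊ (λ { (i , j) → mono i j }) h)
          λ { _ _ ((i , j) , e , b) → let (ex , ey) = opairᶠ-injective e in i , j , ex , ey , b }

        module _ {p : Cond} {X Y : Name P} {X̂ : I → Cond → Set (suc ℓ)} {Ŷ : J → Cond → Set (suc ℓ)}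
                 (X-presents : Presents p X l X̂) (Y-presents : Presents p Y m Ŷ)
                 (typed : ∀ {q i j} → q ≤ p → B i j q → X̂ i q × Ŷ j q)
                 (total : ∀ {q} i → q ≤ p → X̂ i q → Dense q λ r → Σ J λ j → B i j r)
                 (functional : ∀ {q i j j′} → q ≤ p → B i j q → B i j′ q → j ≡ j′) where

          graph-function : Forces P p (IsFunction graph X Y)
          graph-function = functionᶠ record
            { total = λ q≤p m → dense-bind (Presents.split X-presents q≤p m) λ { r r≤q (i , e , x̂) →
                dense-map (total i (≤-trans r≤q q≤p) x̂) λ { s s≤r (j , b) →
                  let s≤p = ≤-trans s≤r (≤-trans r≤q q≤p) in
                  _ , Presents.member Y-presents j s≤p (proj₂ (typed s≤p b))
                    , ∊-≗ˡ (opairᶠ-cong (≗-sym (≗-mono s≤r e)) ≗-refl) (∊-graph b) } }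
            ; relation = λ q≤p m → dense-map (comprehension-∊ (λ { (i , j) → mono i j }) m) λ { r r≤q ((i , j) , e , b) →
                let r≤p = ≤-trans r≤q q≤p in
                l i , _ , Presents.member X-presents i r≤p (proj₁ (typed r≤p b)) , Presents.member Y-presents j r≤p (proj₂ (typed r≤p b)) , e }
            ; functional = λ q≤p h h′ → ≗-local (dense-bind (graph-∊ h) λ { r r≤q (i , j , ex , ey , b) →
                dense-map (graph-∊ (∊-mono r≤q h′)) λ { s s≤r (i′ , j′ , ex′ , ey′ , b′) →
                  case l-injective (≗-trans (≗-sym (≗-mono s≤r ex)) ex′) of λ { refl →
                  case functional (≤-trans s≤r (≤-trans r≤q q≤p)) (mono i j s≤r b) b′ of λ { refl →
                    ≗-trans (≗-mono s≤r ey) (≗-sym ey′) } } } })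
            }

          module _ (onto : ∀ {q} j → q ≤ p → Ŷ j q → Dense q λ r → Σ I λ i → B i j r)
                   (injective : ∀ {q i i′ j} → q ≤ p → B i j q → B i′ j q → i ≡ i′) where

            graph-bijection : Forces P p (IsBijection graph X Y)
            graph-bijection = graph-function
              , (λ y q q≤p my → dense-bind (Presents.split Y-presents q≤p (memᶠ my)) λ { r r≤q (j , e , ŷ) →
                   dense-map (onto j (≤-trans r≤q q≤p) ŷ) λ { s s≤r (i , b) →
                     let s≤p = ≤-trans s≤r (≤-trans r≤q q≤p) in
                     l i , un∊ᶠ (Presents.member X-presents i s≤p (proj₁ (typed s≤p b)))
                         , ∊⇒Mapsᶠ (∊-≗ˡ (opairᶠ-cong ≗-refl (≗-sym (≗-mono s≤r e))) (∊-graph b)) } })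
              , (λ x x′ y q q≤p h q′ q′≤q h′ → un≗ (≗-local (dense-bind (graph-∊ (∊-mono q′≤q (Maps⇒∊ᶠ h))) λ { r r≤q′ (i , j , ex , ey , b) →
                   dense-map (graph-∊ (∊-mono r≤q′ (Maps⇒∊ᶠ h′))) λ { s s≤r (i′ , j′ , ex′ , ey′ , b′) →
                     case m-injective (≗-trans (≗-sym (≗-mono s≤r ey)) ey′) of λ { refl →
                     case injective (≤-trans s≤r (≤-trans r≤q′ (≤-trans q′≤q q≤p))) (mono i j s≤r b) b′ of λ { refl →
                       ≗-trans (≗-mono s≤r ex) (≗-sym ex′) } } } })))

 open Forcing

 -- Add(κ,1) as a tree of binary strings

 module Strings where

  module OverOrderˢ (R : RegularOrder) where

    open RegularOrder R

    open OverOrder R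

    -- A function from an initial segment to 2, continued by `false` to all of `K` so that the type
    -- of the bits does not depend on the length.
    record String : Set ℓ where
      constructor string
      field
        length : K
        bits : K → Bool
        .padded : ∀ k → length ≤ k → bits k ≡ false
    open String public

    infix 4 _≼ˢ_
    _≼ˢ_ : String → String → Set ℓ
    t ≼ˢ s = length s ≤ length t × ∀ k → k < length s → bits t k ≡ bits s k

    ≼ˢ-refl : ∀ {s} → s ≼ˢ s
    ≼ˢ-refl = ≤-refl , λ _ _ → refl

    ≼ˢ-trans : ∀ {s t u} → s ≼ˢ t → t ≼ˢ u → s ≼ˢ u
    ≼ˢ-trans (p , f) (q , g) = ≤-trans q p , λ k r → trans (f k (<-≤-trans r q)) (g k r)

    bits-padded : ∀ s k → length s ≤ k → bits s k ≡ false
    bits-padded (string _ _ padded) k p = recompute (em↓-≡) (padded k p)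
      where
      em↓-≡ : ∀ {a b : Bool} → Dec (a ≡ b)
      em↓-≡ {true} {true} = yes refl
      em↓-≡ {false} {false} = yes refl
      em↓-≡ {true} {false} = no λ ()
      em↓-≡ {false} {true} = no λ ()

    String-≡ : ∀ {s t} → length s ≡ length t → (∀ k → k < length s → bits s k ≡ bits t k) → s ≡ t
    String-≡ {s@(string l b _)} {t@(string .l b′ _)} refl e with ext₀ {f = b} {g = b′} same
      where
      same : ∀ k → b k ≡ b′ k
      same k with <-or-≥ k l
      ... | inj₁ p = e k p
      ... | inj₂ p = trans (bits-padded s k p) (sym (bits-padded t k p))
    ... | refl = refl

    truncate : K → (K → Set ℓ) → String
    truncate l A = string l (λ k → bool (Lift (suc ℓ) (k < l × A k))) λ k p → bool-false λ h → p (proj₁ (lower h))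

    truncate-true : ∀ {l} A {k} → k < l → A k → bits (truncate l A) k ≡ true
    truncate-true A p a = bool-true (lift (p , a))

    true-truncate : ∀ {l} A {k} → bits (truncate l A) k ≡ true → A k
    true-truncate A e = proj₂ (lower (true-bool e))

    Extended : String → (K → Set ℓ) → K → Set ℓ
    Extended s A k = Lift ℓ (bits s k ≡ true) ⊎ A k

    extend : ∀ s l → length s ≤ l → (A : K → Set ℓ) → (∀ k → k < length s → ¬ A k) → truncate l (Extended s A) ≼ˢ s
    extend s l p A n = p , λ k q → bool-≡
      (λ e → [ lower , (λ a → ⊥-elim (n k q a)) ]′ (true-truncate {l} (Extended s A) e))
      (λ e → truncate-true (Extended s A) (<-≤-trans q p) (inj₁ (lift e)))

    ≼ˢ-linear : ∀ {r s t} → r ≼ˢ s → r ≼ˢ t → s ≼ˢ t ⊎ t ≼ˢ s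
    ≼ˢ-linear {r} {s} {t} (p , f) (q , g) with <-or-≥ (length s) (length t)
    ... | inj₁ h = inj₂ (<⇒≤ h , λ k k<s → trans (sym (g k (<-trans k<s h))) (f k k<s))
    ... | inj₂ h = inj₁ (h , λ k k<t → trans (sym (f k (<-≤-trans k<t h))) (g k k<t))

    ≼ˢ-length : ∀ {s t} → s ≼ˢ t → length s ≡ length t → s ≡ t
    ≼ˢ-length {s} {t} (_ , f) e = String-≡ e λ k p → f k (subst (k <_) e p)

    record Branch (s : String) : Set ℓ where
      constructor branch
      field
        node : String
        .below : node ≼ˢ s
    open Branch public using (node)

    branch-below : ∀ {s} (x : Branch s) → node x ≼ˢ s
    branch-below (branch _ b) = recompute em↓ b

    branch-≡ : ∀ {s} {x y : Branch s} → node x ≡ node y → x ≡ y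
    branch-≡ {x = branch n _} {branch .n _} refl = refl

    module _ (s : String) where

      private
        below-node : (x : Branch s) (t : String) → t ≼ˢ node x → Branch s
        below-node x t h = branch t (≼ˢ-trans {t} {node x} {s} h (branch-below x))

        lower-bound : ∀ k (c : Prefix (Branch s) k) → (∀ i j p q → i < j → node (c j q) ≼ˢ node (c i p)) →
                      Σ (Branch s) λ r → ∀ j p → node r ≼ˢ node (c j p)
        lower-bound k c dec with em↓ {Σ K λ j → j < k}
        ... | no none = branch s (≼ˢ-refl {s}) , λ j p → ⊥-elim (none (j , p))
        ... | yes (j₀ , p₀) = below-node (c j₀ p₀) union (union-below j₀ p₀) , union-below
          where
          Union : K → Set ℓ
          Union i = Σ K λ j → Σ (j < k) λ p → i < length (node (c j p)) × bits (node (c j p)) i ≡ true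
          union : String
          -- Any bound of the lengths will do; beyond the members of the chain the bits are `false`.
          union = truncate (proj₁ (bound k λ j p → length (node (c j p)))) Union
          same : ∀ i i′ p q l → l < length (node (c i p)) → l < length (node (c i′ q)) → bits (node (c i p)) l ≡ bits (node (c i′ q)) l
          same i i′ p q l r r′ with compare i i′
          ... | inj₁ h = sym (proj₂ (dec i i′ p q h) l r)
          ... | inj₂ (inj₂ h) = proj₂ (dec i′ i q p h) l r′
          ... | inj₂ (inj₁ refl) with <-irrelevant p q
          ... | refl = refl
          union-below : ∀ j p → union ≼ˢ node (c j p)
          union-below j p = <⇒≤ (bd j p) , λ l l< → bool-≡
              (λ e → case true-truncate Union e of λ { (j′ , p′ , q , m) → trans (same j j′ p p′ l l< q) m })
              (λ e → truncate-true Union (<-trans l< (bd j p)) (j , p , l< , e))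
            where bd = proj₂ (bound k λ j p → length (node (c j p)))

        longer : (x : Branch s) → ∀ l → length (node x) < l → (A : K → Set ℓ) → (∀ k → k < length (node x) → ¬ A k) → Branch s
        longer x l p A n = below-node x (truncate l (Extended (node x) A)) (extend (node x) l (<⇒≤ p) A n)

      stringTree : Tree
      stringTree = record
        { Node = Branch s
        ; _≼_ = λ x y → node x ≼ˢ node y
        ; ≼-refl = λ {x} → ≼ˢ-refl {node x}
        ; ≼-trans = λ {x} {y} {z} → ≼ˢ-trans {node x} {node y} {node z}
        ; root = branch s (≼ˢ-refl {s})
        ; ≼-root = branch-below
        ; rank = λ x → length (node x)
        ; rank-mono = proj₁
        ; rank-strict = λ {x} {y} h e → branch-≡ (≼ˢ-length {node x} {node y} h e)
        ; linear = λ {r} {x} {y} → ≼ˢ-linear {node r} {node x} {node y}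
        ; closed = lower-bound
        ; tall = λ x k → case upper (length (node x)) k of λ { (l , p , q) →
            longer x l p Never (never x) , extend (node x) l (<⇒≤ p) Never (never x) , q }
        -- The two extensions differ at the first new position, `length (node x)`, where one has
        -- `false` and the other `true`.
        ; split = λ x → case next (length (node x)) of λ { (l , p) →
            longer x l p Never (never x) , longer x l p (Last x) (last x) ,
            extend (node x) l (<⇒≤ p) Never (never x) , extend (node x) l (<⇒≤ p) (Last x) (last x) ,
            λ { (u , (_ , f) , (_ , g)) → lower (false≢true {A = Lift ℓ ⊥} {b = bits (node u) (length (node x))}
                  (trans (f _ p) (bool-false λ h → unset x (proj₂ (lower h))))
                  (trans (g _ p) (truncate-true (Extended (node x) (Last x)) p (inj₂ refl)))) } }
        }
        where
        Never : K → Set ℓ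
        Never _ = Lift ℓ ⊥
        never : ∀ x k → k < length (node {s} x) → ¬ Never k
        never _ _ _ = lower
        Last : Branch s → K → Set ℓ
        Last x k = k ≡ length (node x)
        last : ∀ x k → k < length (node x) → ¬ Last x k
        last x k q e = ≡⇒≤ (sym e) q
        unset : ∀ x → ¬ Extended (node x) Never (length (node x))
        unset x (inj₁ (lift e)) = lower (false≢true {A = Lift ℓ ⊥} (bits-padded (node x) _ ≤-refl) e)

  module Cohen (𝕜 : RegularCardinal) where

    open RegularCardinal 𝕜 using (κ)
    open Uncountable 𝕜
    open RegularOrder R using (_<_; _≤_; <-or-≥; ≤-refl; <-irrefl; <-irrelevant; <-trans)
    open OverOrderˢ R

    private
      bit : Bool → V ℓ
      bit false = sup (Lift ℓ ⊥) (λ x → ⊥-elim (lower x))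
      bit true = sup (Lift ℓ ⊤) (λ _ → bit false)

      two : V ℓ
      two = sup (Lift ℓ Bool) (bit ∘ lower)

      bit∊two : ∀ b → bit b ∊ two
      bit∊two b = ∊-sup (lift b)

      empty : ∀ {x} → (V⊨ IsEmpty x) → x ≣ bit false
      empty h = extensionality (λ z m → ⊥-elim (Polymorphic.⊥-elim (h z (lift (un∊ m))))) (λ z m → ⊥-elim (lower (proj₁ (sup-∊ m))))

      isEmpty : ∀ {x} → x ≣ bit false → V⊨ IsEmpty x
      isEmpty e z m = ⊥-elim (lower (proj₁ (sup-∊ (∊-≣ʳ e (mem (lower m))))))

      IsOne : V ℓ → Formula (V ℓ)
      IsOne w = ∀̇ λ v → v ∈̇ w ⇔̇ IsEmpty v

      one : ∀ {x} → (V⊨ IsOne x) → x ≣ bit true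
      one h = extensionality
        (λ z m → ∊-≣ˡ (≣-sym (empty (proj₁ (h z) (lift (un∊ m))))) (∊-sup (lift tt)))
        (λ z m → mem (lower (proj₂ (h z) (isEmpty (proj₂ (sup-∊ m))))))

      isOne : ∀ {x} → x ≣ bit true → V⊨ IsOne x
      isOne e v = (λ m → isEmpty (proj₂ (sup-∊ (∊-≣ʳ e (mem (lower m))))))
                , (λ h → lift (un∊ (∊-≣ʳ (≣-sym e) (∊-≣ˡ (≣-sym (empty h)) (∊-sup (lift tt))))))

      IsTwo-two : V⊨ IsTwo two
      IsTwo-two w = (λ m → case sup-∊ (mem (lower m)) of λ
                       { (lift false , e) → inj₁ (isEmpty e) ; (lift true , e) → inj₂ (isOne e) })
                  , [ (λ h → lift (un∊ (∊-≣ˡ (≣-sym (empty h)) (bit∊two false)))) , (λ h → lift (un∊ (∊-≣ˡ (≣-sym (one h)) (bit∊two true)))) ]′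

      two-elements : ∀ {t x} → (V⊨ IsTwo t) → x ∊ t → Σ Bool λ b → x ≣ bit b
      two-elements h m = [ (λ e → false , empty e) , (λ o → true , one o) ]′ (proj₁ (h _) (lift (un∊ m)))

      bit-injective : ∀ {a b} → bit a ≣ bit b → a ≡ b
      bit-injective {false} {false} _ = refl
      bit-injective {true} {true} _ = refl
      bit-injective {false} {true} e = ⊥-elim (lower (proj₁ (sup-∊ (∊-≣ʳ (≣-sym e) (∊-sup (lift tt))))))
      bit-injective {true} {false} e = ⊥-elim (lower (proj₁ (sup-∊ (∊-≣ʳ e (∊-sup (lift tt))))))

    graphˢ : String → V ℓ
    graphˢ s = sup (Σ K λ k → k < length s) λ { (k , _) → opair (val k) (bit (bits s k)) }

    private
      identity : K → V ℓ
      identity l = sup (Σ K λ k → k < l) λ { (k , _) → opair (val k) (val k) }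

      identity-∊ : ∀ {l x y} → opair x y ∊ identity l → x ≣ y
      identity-∊ m = let ((k , _) , e) = sup-∊ m ; (ex , ey) = opair-injective e in ≣-trans ex (≣-sym ey)

      ∊-identity : ∀ {l x} → x ∊ val l → opair x x ∊ identity l
      ∊-identity {l} m = let (k , p , e) = below l m in ∊-≣ˡ (opair-cong (≣-sym e) (≣-sym e)) (∊-sup (k , p))

      small : ∀ l → V⊨ SizeBelow (val l) κ
      small l = val l , lift (un∊ (val∊κ l)) , identity l ,
        ( Graph⇒IsFunction record
            { total = λ m → _ , m , ∊-identity m
            ; relation = λ m → let ((k , p) , e) = sup-∊ m in val k , val k , <⇒∊ {k} {l} p , <⇒∊ {k} {l} p , e
            ; functional = λ m m′ → ≣-trans (≣-sym (identity-∊ {l} m)) (identity-∊ {l} m′) }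
        , (λ y m → y , m , ∊⇒Maps (∊-identity (mem (lower m))))
        , (λ x x′ y h h′ → lift (un≣ (≣-trans (identity-∊ {l} (Maps⇒∊ h)) (≣-sym (identity-∊ {l} (Maps⇒∊ h′)))))) )

      graphˢ-∊ : ∀ {s x y} → opair x y ∊ graphˢ s → Σ K λ k → k < length s × x ≣ val k × y ≣ bit (bits s k)
      graphˢ-∊ m = let ((k , p) , e) = sup-∊ m ; (ex , ey) = opair-injective e in k , p , ex , ey

      graphˢ-condition : ∀ s → V⊨ IsAddCondition κ (graphˢ s)
      graphˢ-condition s = val (length s) , two
        , (λ z m → lift (un∊ (let (k , _ , e) = below (length s) (mem (lower m)) in ∊-≣ˡ (≣-sym e) (val∊κ k))))
        , small (length s) , IsTwo-two
        , Graph⇒IsFunction record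
            { total = λ m → let (k , p , e) = below (length s) m in
                bit (bits s k) , bit∊two _ , ∊-≣ˡ (opair-cong (≣-sym e) ≣-refl) (∊-sup (k , p))
            ; relation = λ m → let ((k , p) , e) = sup-∊ m in val k , bit (bits s k) , <⇒∊ {k} {length s} p , bit∊two (bits s k) , e
            ; functional = λ m m′ → let (k , _ , ex , ey) = graphˢ-∊ {s} m ; (k′ , _ , ex′ , ey′) = graphˢ-∊ {s} m′ in
                ≣-trans ey (≣-trans (same (val-injective (≣-trans (≣-sym ex) ex′))) (≣-sym ey′)) }
        where
        same : ∀ {k k′} → k ≡ k′ → bit (bits s k) ≣ bit (bits s k′)
        same refl = ≣-refl

    ℂ : Poset (suc ℓ) ℓ (suc ℓ)
    ℂ = Add[ κ ,1]

    ⟪_⟫ˢ : String → Poset.Carrier ℂ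
    ⟪ s ⟫ˢ = graphˢ s , graphˢ-condition s

    ⟪⟫-mono : ∀ {s t} → t ≼ˢ s → Poset._≤_ ℂ ⟪ t ⟫ˢ ⟪ s ⟫ˢ
    ⟪⟫-mono {s} {t} (p , f) z m with sup-∊ (mem (lower m))
    ... | (k , q) , e = lift (un∊ (∊-≣ˡ (≣-trans (same (f k q)) (≣-sym e)) (∊-sup (k , RegularOrder.<-≤-trans R q p))))
      where
      same : ∀ {a b} → a ≡ b → opair (val k) (bit a) ≣ opair (val k) (bit b)
      same refl = ≣-refl

    ⟪⟫-reflect : ∀ {s t} → Poset._≤_ ℂ ⟪ t ⟫ˢ ⟪ s ⟫ˢ → t ≼ˢ s
    ⟪⟫-reflect {s} {t} h = (λ p → <-irrefl (proj₁ (at (length t) p))) , λ k p → proj₂ (at k p)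
      where
      at : ∀ k → k < length s → k < length t × bits t k ≡ bits s k
      at k p with graphˢ-∊ {t} (mem (lower (h _ (lift (un∊ (∊-sup {f = λ { (k , _) → opair (val k) (bit (bits s k)) }} (k , p)))))))
      ... | k′ , q , ex , ey with val-injective {k} {k′} ex
      ... | refl = q , sym (bit-injective ey)

    private
      record Bijection (f A B : V ℓ) : Set (suc ℓ) where
        field
          graph-of : Graph f A B
          onto : ∀ {y} → y ∊ B → Σ (V ℓ) λ x → x ∊ A × opair x y ∊ f
          injective : ∀ {x x′ y} → opair x y ∊ f → opair x′ y ∊ f → x ≣ x′

      bijection : ∀ {f A B} → (V⊨ IsBijection f A B) → Bijection f A B
      bijection (h , o , i) = record
        { graph-of = IsFunction⇒Graph h
        ; onto = λ m → let (x , mx , h) = o _ (lift (un∊ m)) in x , mem (lower mx) , Maps⇒∊ h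
        ; injective = λ m m′ → eq (lower (i _ _ _ (∊⇒Maps m) (∊⇒Maps m′))) }

      Bounded : V ℓ → K → Set (suc ℓ)
      Bounded A b = ∀ {x} → x ∊ A → Σ K λ j → x ≣ val j × j < b

      -- Regularity applied to the map sending `i < k` to the element of `A` that the bijection
      -- matches with it.
      bounded : ∀ {A f β} k → β ≣ val k → (∀ {x} → x ∊ A → x ∊ κ) → Bijection f A β → Σ K (Bounded A)
      bounded {A} {f} {β} k e A⊆κ F = proj₁ bd , λ m → case Graph.total graph-of m of λ { (y , my , h) →
          case below k (∊-≣ʳ e my) of λ { (i , p , ey) → proj₁ (preimage i p) ,
            injective (∊-≣ˡ (opair-cong ≣-refl ey) h) (proj₂ (preimage i p)) , proj₂ bd i p } }
        where
        open Bijection F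
        preimage : ∀ i → i < k → Σ K λ j → opair (val j) (val i) ∊ f
        preimage i p = case onto (∊-≣ʳ (≣-sym e) (<⇒∊ p)) of λ { (x , mx , h) →
                       case represent (A⊆κ mx) of λ { (j , ex) → j , ∊-≣ˡ (opair-cong ex ≣-refl) h } }
        bd : Σ K λ b → ∀ i p → proj₁ (preimage i p) < b
        bd = bound k (λ i p → proj₁ (preimage i p))

      cover : ∀ {a A t b} → Graph a A t → Bounded A b → (∀ {x} → x ∊ t → Σ Bool λ b → x ≣ bit b) →
              Σ String λ s → ∀ z → z ∊ a → z ∊ graphˢ s
      cover {a} {b = b} G bd two-valued = s , inside
        where
        One : K → Set ℓ
        One k = opair (val k) (bit true) ∊ a
        s : String
        s = truncate b One
        correct : ∀ {z} c k → k < b → z ≣ opair (val k) (bit c) → z ∊ a → c ≡ bits s k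
        correct true k p e m = sym (truncate-true One p (∊-≣ˡ e m))
        correct false k p e m = sym (bool-false λ { (lift (_ , h)) →
          case bit-injective {false} {true} (Graph.functional G (∊-≣ˡ e m) h) of λ () })
        entry : ∀ {z} c k → k < b → z ≣ opair (val k) (bit c) → z ∊ a → z ∊ graphˢ s
        entry c k p e m = ∊-≣ˡ (≣-sym (≣-trans e (same (correct c k p e m)))) (∊-sup (k , p))
          where
          same : ∀ {a b} → a ≡ b → opair (val k) (bit a) ≣ opair (val k) (bit b)
          same refl = ≣-refl
        inside : ∀ z → z ∊ a → z ∊ graphˢ s
        inside z m = case Graph.relation G m of λ { (x , y , mx , my , e) →
          case bd mx of λ { (k , ex , p) → case two-valued my of λ { (c , ey) →
            entry c k p (≣-trans e (opair-cong ex ey)) m } } }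

    -- The domain of a condition has size below κ and is therefore bounded; filling the gaps with
    -- `false` turns the condition into a string.
    ⟪⟫-dense : ∀ a → Σ String λ t → Poset._≤_ ℂ ⟪ t ⟫ˢ a
    ⟪⟫-dense (a , A , t , A⊆κ , (β , β∈κ , f , f-bij) , two-t , a-fun) =
      case represent (mem (lower β∈κ)) of λ { (k , e) →
      case bounded k e (λ m → mem (lower (A⊆κ _ (lift (un∊ m))))) (bijection f-bij) of λ { (b , bd) →
      case cover (IsFunction⇒Graph a-fun) bd (two-elements two-t) of λ { (s , h) →
        s , λ z m → lift (un∊ (h z (mem (lower m)))) } } }

    -- The existential quantifier in measurability yields a name only below some condition, here the
    -- string `base`.
    record MeasureName : Set (suc ℓ) where
      field
        base : String
        U : Name ℂ
        ultra : Forces ℂ ⟪ base ⟫ˢ (IsUltrafilter U (check κ))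
        nonprincipal : Forces ℂ ⟪ base ⟫ˢ (IsNonprincipal U (check κ))
        complete : Forces ℂ ⟪ base ⟫ˢ (IsComplete U (check κ) (check κ))

 open Strings

 -- The conditions of ℙ(κ,θ) and the trees S_i

 module Conditions where

  module OverRegular (R : RegularOrder) (θ : RegularOrder.K R) (θ-limit : RegularOrder.NoMaximum R θ) where

    open RegularOrder R

    open OverOrder R

    Sup : ∀ {a} → (K → Set a) → K → Set (a ⊔ ℓ)
    Sup A α = (Σ K λ β → β < α) × (∀ β → β < α → Σ K λ δ → A δ × δ < α × β < δ)

    Lim : K → Set ℓ
    Lim = Sup (λ _ → ⊤)

    Sup-map : ∀ {a b} {A : K → Set a} {B : K → Set b} {α} → (∀ δ → δ < α → A δ → B δ) → Sup A α → Sup B α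
    Sup-map f (z , h) = z , λ β p → case h β p of λ { (δ , a , q , r) → δ , f δ q a , q , r }

    Sup⇒Lim : ∀ {a} {A : K → Set a} {α} → Sup A α → Lim α
    Sup⇒Lim = Sup-map λ _ _ _ → tt

    Sup-element : ∀ {a} {A : K → Set a} {α} → Sup A α → Σ K λ δ → A δ × δ < α
    Sup-element ((β , p) , h) = case h β p of λ { (δ , a , q , _) → δ , a , q }

    lim-above : ∀ {α} → Lim α → ∀ β γ → β < α → γ < α → Σ K λ δ → β < δ × γ < δ × δ < α
    lim-above (_ , h) β γ p q with <-or-≥ β γ
    ... | inj₁ r = case h γ q of λ { (δ , _ , s , t) → δ , <-trans r t , t , s }
    ... | inj₂ r = case h β p of λ { (δ , _ , s , t) → δ , t , ≤-<-trans r t , s }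

    -- The supremum of an increasing ω-sequence.
    limit-above : ∀ k → Σ K λ α → k < α × Lim α
    limit-above k = case bound ω (λ j _ → f j) of λ { (b , h) →
        limit (least (λ b → Lift (suc ℓ) (∀ j → j < ω → f j < b)) (b , lift h)) }
      where
      Φ : ∀ j → Prefix K j → K → Set (suc ℓ)
      Φ j g a = Lift (suc ℓ) (k < a × ∀ i p → g i p < a)
      built : Σ (K → K) λ f → ∀ j → Φ j (λ i _ → f i) (f j)
      built = build K Φ λ j g _ → case bound j g of λ { (b , h) → case upper k b of λ { (a , k<a , b<a) →
        a , lift (k<a , λ i p → <-trans (h i p) b<a) } }
      f : K → K
      f = proj₁ built
      k<f : ∀ j → k < f j
      k<f j = proj₁ (lower (proj₂ built j))
      increasing : ∀ {i j} → i < j → f i < f j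
      increasing {i} {j} = proj₂ (lower (proj₂ built j)) i
      limit : (Σ K λ α → Lift (suc ℓ) (∀ j → j < ω → f j < α) × ∀ b → Lift (suc ℓ) (∀ j → j < ω → f j < b) → α ≤ b) →
              Σ K λ α → k < α × Lim α
      limit (α , lift h , min) = α , <-trans (k<f 0ᵏ) (h 0ᵏ 0<ω) , (k , <-trans (k<f 0ᵏ) (h 0ᵏ 0<ω)) , step
        where
        step : ∀ β → β < α → Σ K λ δ → ⊤ × δ < α × β < δ
        step β β<α with em↓ {Σ K λ j → j < ω × β ≤ f j}
        ... | yes (j , p , q) = case ω-limit j p of λ { (i , j<i , i<ω) → f i , tt , h i i<ω , ≤-<-trans q (increasing j<i) }
        ... | no n = ⊥-elim (min β (lift λ j p → [ (λ q → q) , (λ q → ⊥-elim (n (j , p , q))) ]′ (<-or-≥ (f j) β)) β<α)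

    -- C α i β ≡ true encodes β ∈ C_{α,i}; where C_{α,i} is not defined it is empty.
    record Valid (γ : K) (C : K → K → K → Bool) : Set ℓ where
      field
        height-limit : Lim γ
        entry : ∀ {α i β} → C α i β ≡ true → Lim α × α ≤ γ × i < θ × β < α
        start : ∀ α → Lim α → α ≤ γ → Σ K λ i → Σ K λ β → C α i β ≡ true
        monotone : ∀ {α i j β} → i ≤ j → j < θ → C α i β ≡ true → C α j β ≡ true
        unbounded : ∀ {α i β} → C α i β ≡ true → Sup (λ δ → C α i δ ≡ true) α
        closed : ∀ {α i β} → β < α → Sup (λ δ → C α i δ ≡ true) β → C α i β ≡ true
        cover : ∀ α β → Lim α → α ≤ γ → Lim β → β < α → Σ K λ i → Sup (λ δ → C α i δ ≡ true) β
        coherent : ∀ {α i β} → β < α → Sup (λ δ → C α i δ ≡ true) β →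
                   (Σ K λ δ → C β i δ ≡ true) × ∀ δ → δ < β → C β i δ ≡ C α i δ

    -- As `valid` is irrelevant, conditions with the same height and the same clubs are equal.
    record Condition : Set ℓ where
      field
        height : K
        C : K → K → K → Bool
        .valid : Valid height C

      Defined : K → Set ℓ
      Defined i = Σ K λ β → C height i β ≡ true

    open Condition using (height; C; Defined)

    isValid : (c : Condition) → Valid (height c) (C c)
    isValid record { valid = v } = recompute em↓ v

    module Of (c : Condition) = Valid (isValid c)

    Condition-≡ : ∀ {c d} → height c ≡ height d → (∀ α i β → C c α i β ≡ C d α i β) → c ≡ d
    Condition-≡ {c} {d} refl e with ext↓ (λ α → ext↓ λ i → ext₀ λ β → e α i β)
    ... | refl = refl

    infix 4 _≼_ _≼[_]_
    _≼_ : Condition → Condition → Set ℓ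
    c ≼ d = height d ≤ height c × ∀ α → α ≤ height d → ∀ i β → C c α i β ≡ C d α i β

    _≼[_]_ : Condition → K → Condition → Set ℓ
    c ≼[ i ] d = c ≼ d × Defined d i ×
      (height d ≡ height c ⊎ (height d < height c × Sup (λ δ → C c (height c) i δ ≡ true) (height d)))

    ≼-refl : ∀ {c} → c ≼ c
    ≼-refl = ≤-refl , λ _ _ _ _ → refl

    ≼-trans : ∀ {c d e} → c ≼ d → d ≼ e → c ≼ e
    ≼-trans (p , f) (q , g) = ≤-trans q p , λ α r i β → trans (f α (≤-trans r q) i β) (g α r i β)

    ≼-height : ∀ {c d} → c ≼ d → height d ≡ height c → c ≡ d
    ≼-height {c} {d} (_ , f) e = Condition-≡ (sym e) same
      where
      same : ∀ α i β → C c α i β ≡ C d α i β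
      same α i β with <-or-≥ (height d) α
      ... | inj₂ p = f α p i β
      ... | inj₁ p = bool-≡ (λ m → ⊥-elim (proj₁ (proj₂ (Of.entry c m)) (subst (_< α) e p)))
                            (λ m → ⊥-elim (proj₁ (proj₂ (Of.entry d m)) p))

    defined-up : ∀ c {i j} → i ≤ j → j < θ → Defined c i → Defined c j
    defined-up c p q (β , m) = β , Of.monotone c p q m

    defined-< : ∀ c {i} → Defined c i → i < θ
    defined-< c (_ , m) = proj₁ (proj₂ (proj₂ (Of.entry c m)))

    defined-sup : ∀ c {i} → Defined c i → Sup (λ δ → C c (height c) i δ ≡ true) (height c)
    defined-sup c (_ , m) = Of.unbounded c m

    ≼[]-refl : ∀ {c i} → Defined c i → c ≼[ i ] c
    ≼[]-refl {c} d = ≼-refl {c} , d , inj₁ refl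

    ≼[]-defined : ∀ {c d i} → c ≼[ i ] d → Defined c i
    ≼[]-defined {c} {d} (h , def , inj₁ e) with ≼-height {c} {d} h e
    ... | refl = def
    ≼[]-defined (_ , _ , inj₂ (_ , s)) = case Sup-element s of λ { (δ , m , _) → δ , m }

    ≼[]-top : ∀ {c d i} → c ≼[ i ] d → ∀ β → β < height d → C c (height c) i β ≡ C d (height d) i β
    ≼[]-top {c} {d} (h , def , inj₁ e) β _ with ≼-height {c} {d} h e
    ... | refl = refl
    ≼[]-top {c} {d} {i} ((_ , f) , _ , inj₂ (p , s)) β q =
      trans (sym (proj₂ (Of.coherent c p s) β q)) (f (height d) ≤-refl i β)

    ≼[]-trans : ∀ {c d e i} → c ≼[ i ] d → d ≼[ i ] e → c ≼[ i ] e
    ≼[]-trans {c} {d} {e} h@(c≼d , _ , _) (d≼e , def , inj₁ q) with ≼-height {d} {e} d≼e q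
    ... | refl = h
    ≼[]-trans {c} {d} {e} (c≼d , _ , inj₁ p) h@(d≼e , def , inj₂ (q , t)) with ≼-height {c} {d} c≼d p
    ... | refl = h
    ≼[]-trans {c} {d} {e} {i} h@(c≼d , _ , inj₂ (p , s)) (d≼e , def , inj₂ (q , t)) =
      ≼-trans {c} {d} {e} c≼d d≼e , def , inj₂ (<-trans q p ,
        Sup-map (λ δ δ<e m → trans (≼[]-top {c} {d} h δ (<-trans δ<e q)) m) t)

    ≼[]-up : ∀ {c d i j} → i ≤ j → j < θ → c ≼[ i ] d → c ≼[ j ] d
    ≼[]-up {c} {d} p q (h , def , inj₁ e) = h , defined-up d p q def , inj₁ e
    ≼[]-up {c} {d} p q (h , def , inj₂ (r , s)) =
      h , defined-up d p q def , inj₂ (r , Sup-map (λ _ _ m → Of.monotone c p q m) s)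

    -- The covering clause at `height d` supplies the index, and coherence makes the top club of `d`
    -- at that index defined.
    ≼⇒≼[] : ∀ {c d} → c ≼ d → Σ K λ i → i < θ × c ≼[ i ] d
    ≼⇒≼[] {c} {d} h with ≤-split (proj₁ h)
    ... | inj₂ e = case Of.start d (height d) (Of.height-limit d) ≤-refl of λ { (i , def) →
                     i , defined-< d def , h , def , inj₁ e }
    ... | inj₁ p = case Of.cover c (height c) (height d) (Of.height-limit c) ≤-refl (Of.height-limit d) p of λ { (i , s) →
                     case Of.coherent c p s of λ { ((δ , m) , _) →
                     let def = δ , trans (sym (proj₂ h (height d) ≤-refl i δ)) m in
                     i , defined-< d def , h , def , inj₂ (p , s) } }

    -- Cutting the top club of `r` at the heights of `s` and `t` gives their top clubs, so the lower
    -- height is a limit point of the other top club.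
    ≼[]-linear : ∀ {r s t i} → r ≼[ i ] s → r ≼[ i ] t → s ≼[ i ] t ⊎ t ≼[ i ] s
    ≼[]-linear {r} {s} {t} {i} rs rt = go (compare (height s) (height t))
      where
      ordered : ∀ {s t} → r ≼[ i ] s → r ≼[ i ] t → height s < height t → t ≼[ i ] s
      ordered {s} {t} rs@((_ , f) , def , inj₁ e) ((q , _) , _) p = ⊥-elim (q (subst (_< height t) e p))
      ordered {s} {t} rs@((_ , f) , def , inj₂ (_ , u)) rt@((_ , g) , _) p =
        (<⇒≤ p , λ α q j β → trans (sym (g α (≤-trans q (<⇒≤ p)) j β)) (f α q j β)) , def ,
        inj₂ (p , Sup-map (λ δ δ<s m → trans (sym (≼[]-top {r} {t} rt δ (<-trans δ<s p))) m) u)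
      go : height s < height t ⊎ height s ≡ height t ⊎ height t < height s → s ≼[ i ] t ⊎ t ≼[ i ] s
      go (inj₁ p) = inj₂ (ordered {s} {t} rs rt p)
      go (inj₂ (inj₂ p)) = inj₁ (ordered {t} {s} rt rs p)
      go (inj₂ (inj₁ e)) = inj₁ ((≡⇒≤ (sym e) , λ α q j β → trans (sym (proj₂ (proj₁ rs) α (≤-trans q (≡⇒≤ (sym e))) j β)) (proj₂ (proj₁ rt) α q j β))
                                , proj₁ (proj₂ rt) , inj₁ (sym e))

    maximum : ∀ i j → i < θ → j < θ → Σ K λ m → i ≤ m × j ≤ m × m < θ
    maximum i j p q with <-or-≥ i j
    ... | inj₁ h = j , <⇒≤ h , ≤-refl , q
    ... | inj₂ h = i , ≤-refl , h , p

    -- The i-th clubs above height q continue those of p for i < s and those of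
    -- q for s ≤ i; they contain every ordinal above height q, and so have all
    -- the limit points needed there.
    module Extension (p q : Condition) (i₀ s : K) (p-def : Defined p i₀) (i₀≤s : i₀ ≤ s) (s<θ : s < θ) (q≼p : q ≼[ s ] p) (k : K) where

      private
        γ′ : Σ K λ γ → (height q < γ × k < γ) × Lim γ
        γ′ = case upper (height q) k of λ { (b , q<b , k<b) → case limit-above b of λ { (γ , b<γ , l) →
               γ , (<-trans q<b b<γ , <-trans k<b b<γ) , l } }
        γ : K
        γ = proj₁ γ′
        q<γ : height q < γ
        q<γ = proj₁ (proj₁ (proj₂ γ′))
        γ-limit : Lim γ
        γ-limit = proj₂ (proj₂ γ′)

        base : K → Condition
        base j = [ (λ _ → p) , (λ _ → q) ]′ (<-or-≥ j s)

        base-spec : ∀ j → (base j ≡ p × j < s) ⊎ (base j ≡ q × s ≤ j)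
        base-spec j with <-or-≥ j s
        ... | inj₁ h = inj₁ (refl , h)
        ... | inj₂ h = inj₂ (refl , h)

        base-defined : ∀ {j} → i₀ ≤ j → j < θ → Defined (base j) j
        base-defined {j} i₀≤j j<θ with base-spec j
        ... | inj₁ (e , h) = subst (λ c → Defined c j) (sym e) (defined-up p i₀≤j j<θ p-def)
        ... | inj₂ (e , h) = subst (λ c → Defined c j) (sym e) (defined-up q h j<θ (≼[]-defined {q} {p} q≼p))

        q≼base : ∀ j → q ≼ base j
        q≼base j with base-spec j
        ... | inj₁ (e , _) = subst (q ≼_) (sym e) (proj₁ q≼p)
        ... | inj₂ (e , _) = subst (q ≼_) (sym e) (≼-refl {q})

        -- The ordinals above `height (base j)` up to `height q` are left out: a limit point among
        -- them would have to cohere with the clubs of `q`. Including `height (base j)` itself keeps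
        -- the set closed.
        Tail : K → K → Set ℓ
        Tail j β = C (base j) (height (base j)) j β ≡ true ⊎ (β ≡ height (base j) ⊎ height q < β)

        New : K → K → K → Set ℓ
        New α j β = (Lim α × height q < α × α ≤ γ) × (i₀ ≤ j × j < θ) × β < α × Tail j β

        tail-up-same : ∀ {c i j β} → i ≤ j → j < θ → C c (height c) i β ≡ true ⊎ (β ≡ height c ⊎ height q < β) →
                       C c (height c) j β ≡ true ⊎ (β ≡ height c ⊎ height q < β)
        tail-up-same {c} h h′ (inj₁ m) = inj₁ (Of.monotone c h h′ m)
        tail-up-same h h′ (inj₂ x) = inj₂ x

        tail-p-q : ∀ {j β} → q ≼[ j ] p → C p (height p) j β ≡ true ⊎ (β ≡ height p ⊎ height q < β) →
                   C q (height q) j β ≡ true ⊎ (β ≡ height q ⊎ height q < β)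
        tail-p-q h (inj₁ m) = inj₁ (trans (≼[]-top {q} {p} h _ (proj₂ (proj₂ (proj₂ (Of.entry p m))))) m)
        tail-p-q (_ , _ , inj₁ e) (inj₂ (inj₁ e′)) = inj₂ (inj₁ (trans e′ e))
        tail-p-q (_ , _ , inj₂ (h , t)) (inj₂ (inj₁ refl)) = inj₁ (Of.closed q h t)
        tail-p-q _ (inj₂ (inj₂ h)) = inj₂ (inj₂ h)

        -- The critical case is i < s ≤ j, where the club of `p` is replaced by that of `q`. As
        -- `q ≼[ j ] p`, the latter continues the former, and `height p` is either `height q` or one
        -- of its members.
        tail-up : ∀ {i j β} → i ≤ j → j < θ → Tail i β → Tail j β
        tail-up {i} {j} {β} i≤j j<θ t with base i | base-spec i | base j | base-spec j
        ... | _ | inj₁ (refl , _) | _ | inj₁ (refl , _) = tail-up-same {p} i≤j j<θ t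
        ... | _ | inj₂ (refl , _) | _ | inj₂ (refl , _) = tail-up-same {q} i≤j j<θ t
        ... | _ | inj₂ (_ , h) | _ | inj₁ (_ , h′) = ⊥-elim (i≤j (<-≤-trans h′ h))
        ... | _ | inj₁ (refl , _) | _ | inj₂ (refl , h) = tail-p-q (≼[]-up {q} {p} h j<θ q≼p) (tail-up-same {p} i≤j j<θ t)

        E : K → K → K → Bool
        E α j β = bool (Lift (suc ℓ) ((α ≤ height q × C q α j β ≡ true) ⊎ New α j β))

        low : ∀ {α} → α ≤ height q → ∀ j β → E α j β ≡ C q α j β
        low {α} h j β = bool-≡ (λ e → from (lower (true-bool e))) (λ e → bool-true (lift (inj₁ (h , e))))
          where
          from : ∀ {j β} → (α ≤ height q × C q α j β ≡ true) ⊎ New α j β → C q α j β ≡ true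
          from (inj₁ (_ , e)) = e
          from (inj₂ ((_ , h′ , _) , _)) = ⊥-elim (h h′)

        new : ∀ {α j β} → height q < α → E α j β ≡ true → New α j β
        new h e with lower (true-bool e)
        ... | inj₁ (h′ , _) = ⊥-elim (h′ h)
        ... | inj₂ n = n

        mk : ∀ {α j β} → New α j β → E α j β ≡ true
        mk n = bool-true (lift (inj₂ n))

        base≤q : ∀ j → height (base j) ≤ height q
        base≤q j = proj₁ (q≼base j)

        -- The members below `height q` are at most `height (base j)`, so a limit point there comes
        -- from the top club of `base j`.
        limit-point : ∀ {α j β} → height q < α → β ≤ height q → Sup (λ δ → E α j δ ≡ true) β →
                      β ≤ height (base j) × Sup (λ δ → C (base j) (height (base j)) j δ ≡ true) β
        limit-point {α} {j} {β} h h′ s = β≤ , Sup-map old s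
          where
          β≤ : β ≤ height (base j)
          β≤ p = case proj₂ s _ p of λ { (δ , m , δ<β , p<δ) → case proj₂ (proj₂ (proj₂ (new h m))) of λ
            { (inj₁ m′) → <⇒≤ p<δ (proj₂ (proj₂ (proj₂ (Of.entry (base j) m′))))
            ; (inj₂ (inj₁ e)) → ≡⇒≤ e p<δ
            ; (inj₂ (inj₂ r)) → <⇒≤ r (<-≤-trans δ<β h′) } }
          old : ∀ δ → δ < β → E α j δ ≡ true → C (base j) (height (base j)) j δ ≡ true
          old δ δ<β m = case proj₂ (proj₂ (proj₂ (new h m))) of λ
            { (inj₁ m′) → m′
            ; (inj₂ (inj₁ e)) → ⊥-elim (≡⇒≤ (sym e) (<-≤-trans δ<β β≤))
            ; (inj₂ (inj₂ r)) → ⊥-elim (<⇒≤ r (<-≤-trans δ<β h′)) }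

        indices : ∀ {α j β} → height q < α → Sup (λ δ → E α j δ ≡ true) β → i₀ ≤ j × j < θ
        indices h s = case Sup-element s of λ { (_ , m , _) → proj₁ (proj₂ (new h m)) }

        high-sup : ∀ {α j β} → Lim α → height q < α → α ≤ γ → i₀ ≤ j → j < θ → Lim β → height q < β → β ≤ α → Sup (λ δ → E α j δ ≡ true) β
        high-sup l h h′ i j lβ q<β β≤α = proj₁ lβ , λ ξ ξ<β → case lim-above lβ ξ (height q) ξ<β q<β of λ { (δ , ξ<δ , q<δ , δ<β) →
          δ , mk ((l , h , h′) , (i , j) , <-≤-trans δ<β β≤α , inj₂ (inj₂ q<δ)) , δ<β , ξ<δ }

        i₀<θ : i₀ < θ
        i₀<θ = ≤-<-trans i₀≤s s<θ

        base-s : ∀ {j} → s ≤ j → base j ≡ q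
        base-s {j} h with base-spec j
        ... | inj₁ (_ , h′) = ⊥-elim (h h′)
        ... | inj₂ (e , _) = e

        old-sup : ∀ {α j β} → Lim α → height q < α → α ≤ γ → i₀ ≤ j → j < θ → β ≤ height q →
                  Sup (λ δ → C (base j) (height (base j)) j δ ≡ true) β → Sup (λ δ → E α j δ ≡ true) β
        old-sup l h h′ i j β≤q = Sup-map λ δ δ<β m → mk ((l , h , h′) , (i , j) , <-trans (<-≤-trans δ<β β≤q) h , inj₁ m)

        s-sup : ∀ {α j β} → Lim α → height q < α → α ≤ γ → s ≤ j → j < θ → β ≤ height q →
                Sup (λ δ → C q (height q) j δ ≡ true) β → Sup (λ δ → E α j δ ≡ true) β
        s-sup {j = j} {β} l h h′ s≤j j<θ β≤q t = old-sup l h h′ (≤-trans i₀≤s s≤j) j<θ β≤q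
          (subst (λ c → Sup (λ δ → C c (height c) j δ ≡ true) β) (sym (base-s s≤j)) t)

        valid′ : Valid γ E
        valid′ = record
          { height-limit = γ-limit
          ; entry = λ {α} m → case <-or-≥ (height q) α of λ
              { (inj₁ h) → case new h m of λ { ((l , _ , α≤γ) , (_ , j<θ) , β<α , _) → l , α≤γ , j<θ , β<α }
              ; (inj₂ h) → case Of.entry q (trans (sym (low h _ _)) m) of λ { (l , α≤q , rest) →
                  l , ≤-trans α≤q (<⇒≤ q<γ) , rest } }
          ; start = λ α l α≤γ → case <-or-≥ (height q) α of λ
              { (inj₁ h) → i₀ , height (base i₀) , mk ((l , h , α≤γ) , (≤-refl , i₀<θ) , ≤-<-trans (base≤q i₀) h , inj₂ (inj₁ refl))
              ; (inj₂ h) → case Of.start q α l h of λ { (i , β , m) → i , β , trans (low h i β) m } }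
          ; monotone = λ {α} i≤j j<θ m → case <-or-≥ (height q) α of λ
              { (inj₁ h) → case new h m of λ { (lα , (i₀≤i , _) , β<α , t) → mk (lα , (≤-trans i₀≤i i≤j , j<θ) , β<α , tail-up i≤j j<θ t) }
              ; (inj₂ h) → trans (low h _ _) (Of.monotone q i≤j j<θ (trans (sym (low h _ _)) m)) }
          ; unbounded = λ {α} m → case <-or-≥ (height q) α of λ
              { (inj₁ h) → case new h m of λ { ((l , _ , α≤γ) , (i , j) , _) → high-sup l h α≤γ i j l h ≤-refl }
              ; (inj₂ h) → Sup-map (λ δ _ e → trans (low h _ δ) e) (Of.unbounded q (trans (sym (low h _ _)) m)) }
          ; closed = λ {α} {j} {β} β<α t → case <-or-≥ (height q) α of λ
              { (inj₁ h) → closed-new h β<α t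
              ; (inj₂ h) → trans (low h _ _) (Of.closed q β<α (Sup-map (λ δ _ e → trans (sym (low h _ δ)) e) t)) }
          ; cover = λ α β l α≤γ lβ β<α → case <-or-≥ (height q) α of λ
              { (inj₁ h) → cover-new l h α≤γ lβ β<α
              ; (inj₂ h) → case Of.cover q α β l h lβ β<α of λ { (i , t) → i , Sup-map (λ δ _ e → trans (low h i δ) e) t } }
          ; coherent = λ {α} {j} {β} β<α t → case <-or-≥ (height q) α of λ
              { (inj₁ h) → coherent-new h β<α t
              ; (inj₂ h) → case Of.coherent q β<α (Sup-map (λ δ _ e → trans (sym (low h _ δ)) e) t) of λ { ((δ , m) , f) →
                  let h′ = ≤-trans (<⇒≤ β<α) h in
                  (δ , trans (low h′ j δ) m) , λ δ δ<β → trans (low h′ j δ) (trans (f δ δ<β) (sym (low h j δ))) } }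
          }
          where
          limits : ∀ {α j β} → height q < α → Sup (λ δ → E α j δ ≡ true) β → Lim α × height q < α × α ≤ γ
          limits h t = case Sup-element t of λ { (_ , m , _) → proj₁ (new h m) }
          closed-new : ∀ {α j β} → height q < α → β < α → Sup (λ δ → E α j δ ≡ true) β → E α j β ≡ true
          closed-new {α} {j} {β} h β<α t with <-or-≥ (height q) β
          ... | inj₁ q<β = mk (limits h t , indices h t , β<α , inj₂ (inj₂ q<β))
          ... | inj₂ β≤q with limit-point h β≤q t
          ... | β≤b , u with ≤-split β≤b
          ... | inj₁ β<b = mk (limits h t , indices h t , β<α , inj₁ (Of.closed (base j) β<b u))
          ... | inj₂ e = mk (limits h t , indices h t , β<α , inj₂ (inj₁ e))
          cover-new : ∀ {α β} → Lim α → height q < α → α ≤ γ → Lim β → β < α → Σ K λ i → Sup (λ δ → E α i δ ≡ true) β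
          cover-new {α} {β} l h α≤γ lβ β<α with <-or-≥ (height q) β
          ... | inj₁ q<β = i₀ , high-sup l h α≤γ ≤-refl i₀<θ lβ q<β (<⇒≤ β<α)
          ... | inj₂ β≤q with ≤-split β≤q
          ... | inj₂ refl = s , s-sup l h α≤γ ≤-refl s<θ ≤-refl (defined-sup q (≼[]-defined {q} {p} q≼p))
          ... | inj₁ β<q with Of.cover q (height q) β (Of.height-limit q) ≤-refl lβ β<q
          -- The index at which `q` covers β is raised to at least `s`, from where the new clubs
          -- continue those of `q`.
          ... | i , t with maximum i s (defined-< q (case Sup-element t of λ { (δ , m , _) → δ , m })) s<θ
          ... | m , i≤m , s≤m , m<θ = m , s-sup l h α≤γ s≤m m<θ β≤q (Sup-map (λ _ _ → Of.monotone q i≤m m<θ) t)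
          coherent-new : ∀ {α j β} → height q < α → β < α → Sup (λ δ → E α j δ ≡ true) β →
                         (Σ K λ δ → E β j δ ≡ true) × ∀ δ → δ < β → E β j δ ≡ E α j δ
          coherent-new {α} {j} {β} h β<α t with <-or-≥ (height q) β | limits h t | indices h t
          ... | inj₁ q<β | l , _ , α≤γ | i₀≤j , j<θ =
            (height (base j) , mk (lβ , (i₀≤j , j<θ) , ≤-<-trans (base≤q j) q<β , inj₂ (inj₁ refl))) ,
            λ δ δ<β → bool-≡ (λ m → mk ((l , h , α≤γ) , (i₀≤j , j<θ) , <-trans δ<β β<α , proj₂ (proj₂ (proj₂ (new q<β m)))))
                             (λ m → mk (lβ , (i₀≤j , j<θ) , δ<β , proj₂ (proj₂ (proj₂ (new h m)))))
            where
            lβ : Lim β × height q < β × β ≤ γ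
            lβ = Sup⇒Lim t , q<β , ≤-trans (<⇒≤ β<α) α≤γ
          ... | inj₂ β≤q | lα | ij@(i₀≤j , j<θ) =
            (case at of λ { ((δ , m) , _) → δ , trans (below δ) m }) ,
            λ δ δ<β → trans (below δ) (trans (proj₂ at δ δ<β) (sym (old δ δ<β)))
            where
            β≤b : β ≤ height (base j)
            β≤b = proj₁ (limit-point h β≤q t)
            below : ∀ δ → E β j δ ≡ C (base j) β j δ
            below δ = trans (low β≤q j δ) (proj₂ (q≼base j) β β≤b j δ)
            old : ∀ δ → δ < β → E α j δ ≡ C (base j) (height (base j)) j δ
            old δ δ<β = bool-≡
              (λ m → case proj₂ (proj₂ (proj₂ (new h m))) of λ
                { (inj₁ m′) → m′
                ; (inj₂ (inj₁ e)) → ⊥-elim (≡⇒≤ (sym e) (<-≤-trans δ<β β≤b))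
                ; (inj₂ (inj₂ r)) → ⊥-elim (<⇒≤ r (<-≤-trans δ<β β≤q)) })
              (λ m → mk (lα , ij , <-trans δ<β β<α , inj₁ m))
            at : (Σ K λ δ → C (base j) β j δ ≡ true) × ∀ δ → δ < β → C (base j) β j δ ≡ C (base j) (height (base j)) j δ
            at with ≤-split β≤b
            ... | inj₁ β<b = Of.coherent (base j) β<b (proj₂ (limit-point h β≤q t))
            ... | inj₂ refl = base-defined i₀≤j j<θ , λ _ _ → refl

      extension : Condition
      extension = record { height = γ ; C = E ; valid = valid′ }

      extension-tall : k < height extension
      extension-tall = proj₂ (proj₁ (proj₂ γ′))

      private
        r≼q : extension ≼ q
        r≼q = <⇒≤ q<γ , λ α h i β → low h i β

      extension-≼ : extension ≼[ s ] q
      extension-≼ = r≼q , ≼[]-defined {q} {p} q≼p , inj₂ (q<γ ,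
        s-sup γ-limit q<γ ≤-refl ≤-refl s<θ ≤-refl (defined-sup q (≼[]-defined {q} {p} q≼p)))

      extension-≼₀ : extension ≼[ i₀ ] p
      extension-≼₀ = ≼-trans {extension} {q} {p} r≼q (proj₁ q≼p) , p-def , inj₂ (≤-<-trans p≤q q<γ , at (base-spec i₀))
        where
        p≤q = proj₁ (proj₁ q≼p)
        at : (base i₀ ≡ p × i₀ < s) ⊎ (base i₀ ≡ q × s ≤ i₀) → Sup (λ δ → E γ i₀ δ ≡ true) (height p)
        at (inj₁ (e , _)) = old-sup γ-limit q<γ ≤-refl ≤-refl i₀<θ p≤q
          (subst (λ c → Sup (λ δ → C c (height c) i₀ δ ≡ true) (height p)) (sym e) (defined-sup p p-def))
        at (inj₂ (e , s≤i₀)) = s-sup γ-limit q<γ ≤-refl s≤i₀ i₀<θ p≤q (q-sup (≼[]-up {q} {p} s≤i₀ i₀<θ q≼p))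
          where
          q-sup : q ≼[ i₀ ] p → Sup (λ δ → C q (height q) i₀ δ ≡ true) (height p)
          q-sup (h , d , inj₁ e) = subst (Sup _) (sym e) (defined-sup q (≼[]-defined {q} {p} (h , d , inj₁ e)))
          q-sup (_ , _ , inj₂ (_ , t)) = t

      -- For `j < s` the new club jumps from `height p` over `height q`. This produces the
      -- incompatible nodes in `split`.
      extension-omits : height p < height q → ∀ {j} → j < s → C extension (height extension) j (height q) ≢ true
      extension-omits p<q {j} j<s m with base-spec j | proj₂ (proj₂ (proj₂ (new q<γ m)))
      ... | inj₂ (_ , h) | _ = h j<s
      ... | inj₁ (e , _) | inj₁ m′ = ≤-trans (proj₁ (q≼base j)) ≤-refl (proj₂ (proj₂ (proj₂ (Of.entry (base j) m′))))
      ... | inj₁ (e , _) | inj₂ (inj₁ e′) = ≡⇒≤ (trans e′ (cong height e)) p<q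
      ... | inj₁ _ | inj₂ (inj₂ r) = <-irrefl r

    -- A lower bound in S_i when the heights have no maximum. At their supremum δ the clubs are the
    -- unions of the top clubs; they start at index `i`, since only from `i` on are the top clubs
    -- known to continue each other.
    module Limit (i k : K) (c : Prefix Condition k) (decreasing : ∀ a b p q → a < b → c b q ≼[ i ] c a p)
                 (defined : ∀ a p → Defined (c a p) i) (a₀ : K) (a₀<k : a₀ < k)
                 (no-least : ∀ a p → Σ K λ b → Σ (b < k) λ q → height (c a p) < height (c b q)) where

      private
        I : Set ℓ
        I = Σ K λ a → a < k
        at : I → Condition
        at (a , p) = c a p
        h : I → K
        h x = height (at x)

        x₀ : I
        x₀ = a₀ , a₀<k

        comparable : ∀ x y → at x ≼[ i ] at y ⊎ at y ≼[ i ] at x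
        comparable (a , p) (b , q) with compare a b
        ... | inj₁ a<b = inj₂ (decreasing a b p q a<b)
        ... | inj₂ (inj₂ b<a) = inj₁ (decreasing b a q p b<a)
        ... | inj₂ (inj₁ refl) with <-irrelevant p q
        ... | refl = inj₁ (≼[]-refl {c a p} (defined a p))

        agree : ∀ x y {α} m β → α ≤ h x → α ≤ h y → C (at x) α m β ≡ C (at y) α m β
        agree x y m β p q with comparable x y
        ... | inj₁ ((_ , f) , _) = f _ q m β
        ... | inj₂ ((_ , f) , _) = sym (f _ p m β)

        top-agree : ∀ x y {m β} → i ≤ m → m < θ → β < h x → β < h y → C (at x) (h x) m β ≡ C (at y) (h y) m β
        top-agree x y i≤m m<θ p q with comparable x y
        ... | inj₁ r = ≼[]-top {at x} {at y} (≼[]-up {at x} {at y} i≤m m<θ r) _ q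
        ... | inj₂ r = sym (≼[]-top {at y} {at x} (≼[]-up {at y} {at x} i≤m m<θ r) _ p)

        heights : Σ K λ δ → Lift (suc ℓ) (∀ x → h x < δ) × ∀ b → Lift (suc ℓ) (∀ x → h x < b) → δ ≤ b
        heights = case bound k (λ a p → height (c a p)) of λ { (b , bd) →
          least (λ δ → Lift (suc ℓ) (∀ x → h x < δ)) (b , lift λ { (a , p) → bd a p }) }
        δ : K
        δ = proj₁ heights
        h<δ : ∀ x → h x < δ
        h<δ = lower (proj₁ (proj₂ heights))

        cofinal : ∀ ξ → ξ < δ → Σ I λ x → ξ < h x
        cofinal ξ ξ<δ with em↓ {Σ I λ x → ξ ≤ h x}
        ... | yes ((a , p) , r) = case no-least a p of λ { (b , q , s) → (b , q) , ≤-<-trans r s }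
        ... | no n = ⊥-elim (proj₂ (proj₂ heights) ξ (lift λ x → [ (λ r → r) , (λ r → ⊥-elim (n (x , r))) ]′ (<-or-≥ (h x) ξ)) ξ<δ)

        Low Top : K → K → K → Set ℓ
        Low α m β = Σ I λ x → α ≤ h x × C (at x) α m β ≡ true
        Top α m β = α ≡ δ × (i ≤ m × m < θ) × Σ I λ x → C (at x) (h x) m β ≡ true

        E : K → K → K → Bool
        E α m β = bool (Lift (suc ℓ) (Low α m β ⊎ Top α m β))

        member : ∀ {α m β} → E α m β ≡ true → Low α m β ⊎ Top α m β
        member e = lower (true-bool e)

        low : ∀ x {α m} → α ≤ h x → ∀ β → E α m β ≡ C (at x) α m β
        low x {α} {m} p β = bool-≡ (from ∘ member) (λ e → bool-true (lift (inj₁ (x , p , e))))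
          where
          from : Low α m β ⊎ Top α m β → C (at x) α m β ≡ true
          from (inj₁ (y , q , e)) = trans (agree x y m β p q) e
          from (inj₂ (refl , _)) = ⊥-elim (p (h<δ x))

        mk : ∀ x {m β} → i ≤ m → m < θ → C (at x) (h x) m β ≡ true → E δ m β ≡ true
        mk x p q e = bool-true (lift (inj₂ (refl , (p , q) , x , e)))

        top : ∀ x {m} → i ≤ m → m < θ → ∀ β → β < h x → E δ m β ≡ C (at x) (h x) m β
        top x {m} p q β r = bool-≡ (from ∘ member) (mk x p q)
          where
          from : Low δ m β ⊎ Top δ m β → C (at x) (h x) m β ≡ true
          from (inj₁ (y , s , _)) = ⊥-elim (s (h<δ y))
          from (inj₂ (_ , _ , y , e)) = trans (top-agree x y p q r (proj₂ (proj₂ (proj₂ (Of.entry (at y) e))))) e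

        place : ∀ {α m β} → E α m β ≡ true → (Σ I λ x → α ≤ h x) ⊎ (α ≡ δ × i ≤ m × m < θ)
        place e with member e
        ... | inj₁ (x , p , _) = inj₁ (x , p)
        ... | inj₂ (e′ , p , _) = inj₂ (e′ , p)

        place-sup : ∀ {α m β} → Sup (λ δ → E α m δ ≡ true) β → (Σ I λ x → α ≤ h x) ⊎ (α ≡ δ × i ≤ m × m < θ)
        place-sup s = case Sup-element s of λ { (_ , e , _) → place e }

        δ-limit : Lim δ
        δ-limit = (h x₀ , h<δ x₀) , λ β p → case cofinal β p of λ { (x , q) → h x , tt , h<δ x , q }

        at-defined : ∀ x {m} → i ≤ m → m < θ → Defined (at x) m
        at-defined x p q = defined-up (at x) p q (defined (proj₁ x) (proj₂ x))

        valid′ : Valid δ E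
        valid′ = record
          { height-limit = δ-limit
          ; entry = λ e → case member e of λ
              { (inj₁ (x , p , m)) → case Of.entry (at x) m of λ { (l , _ , rest) → l , ≤-trans p (<⇒≤ (h<δ x)) , rest }
              ; (inj₂ (refl , (_ , m<θ) , x , m)) → δ-limit , ≤-refl , m<θ , <-trans (proj₂ (proj₂ (proj₂ (Of.entry (at x) m)))) (h<δ x) }
          ; start = λ α l α≤δ → case ≤-split α≤δ of λ
              { (inj₁ α<δ) → case cofinal α α<δ of λ { (x , p) → case Of.start (at x) α l (<⇒≤ p) of λ { (m , β , e) →
                  m , β , trans (low x (<⇒≤ p) β) e } }
              ; (inj₂ refl) → case defined a₀ a₀<k of λ { (β , e) → i , β , mk x₀ ≤-refl (defined-< (at x₀) (β , e)) e } }
          ; monotone = λ p q e → case member e of λ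
              { (inj₁ (x , r , m)) → trans (low x r _) (Of.monotone (at x) p q m)
              ; (inj₂ (refl , (i≤ , _) , x , m)) → mk x (≤-trans i≤ p) q (Of.monotone (at x) p q m) }
          ; unbounded = λ e → case place e of λ
              { (inj₁ (x , p)) → Sup-map (λ δ _ m → trans (low x p δ) m) (Of.unbounded (at x) (trans (sym (low x p _)) e))
              ; (inj₂ (refl , p , q)) → proj₁ δ-limit , λ ξ ξ<δ → case cofinal ξ ξ<δ of λ { (x , r) →
                  case proj₂ (defined-sup (at x) (at-defined x p q)) ξ r of λ { (ζ , m , ζ<h , ξ<ζ) →
                    ζ , mk x p q m , <-trans ζ<h (h<δ x) , ξ<ζ } } }
          ; closed = λ {α} {m} {β} β<α s → case place-sup s of λ
              { (inj₁ (x , p)) → trans (low x p _) (Of.closed (at x) β<α (Sup-map (λ δ _ m → trans (sym (low x p δ)) m) s))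
              ; (inj₂ (refl , p , q)) → case cofinal β β<α of λ { (x , r) →
                  trans (top x p q β r) (Of.closed (at x) r (Sup-map (λ ζ ζ<β m → trans (sym (top x p q ζ (<-trans ζ<β r))) m) s)) } }
          ; cover = λ α β l α≤δ lβ β<α → case ≤-split α≤δ of λ
              { (inj₁ α<δ) → case cofinal α α<δ of λ { (x , p) → case Of.cover (at x) α β l (<⇒≤ p) lβ β<α of λ { (m , s) →
                  m , Sup-map (λ ζ _ e → trans (low x (<⇒≤ p) ζ) e) s } }
              ; (inj₂ refl) → case cofinal β β<α of λ { (x , p) →
                  case Of.cover (at x) (h x) β (Of.height-limit (at x)) ≤-refl lβ p of λ { (m , s) →
                  case maximum m i (defined-< (at x) (case Sup-element s of λ { (ζ , e , _) → ζ , e })) (defined-< (at x₀) (defined a₀ a₀<k)) of λ { (m′ , m≤m′ , i≤m′ , m′<θ) →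
                    m′ , Sup-map (λ ζ _ e → mk x i≤m′ m′<θ (Of.monotone (at x) m≤m′ m′<θ e)) s } } } }
          ; coherent = λ {α} {m} {β} β<α s → case place-sup s of λ
              { (inj₁ (x , p)) → case Of.coherent (at x) β<α (Sup-map (λ δ _ m → trans (sym (low x p δ)) m) s) of λ { ((ζ , e) , f) →
                  let p′ = ≤-trans (<⇒≤ β<α) p in
                  (ζ , trans (low x p′ ζ) e) , λ ξ ξ<β → trans (low x p′ ξ) (trans (f ξ ξ<β) (sym (low x p ξ))) }
              ; (inj₂ (refl , p , q)) → case cofinal β β<α of λ { (x , r) →
                  case Of.coherent (at x) r (Sup-map (λ ζ ζ<β m → trans (sym (top x p q ζ (<-trans ζ<β r))) m) s) of λ { ((ζ , e) , f) →
                  (ζ , trans (low x (<⇒≤ r) ζ) e) , λ ξ ξ<β → trans (low x (<⇒≤ r) ξ) (trans (f ξ ξ<β) (sym (top x p q ξ (<-trans ξ<β r)))) } } }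
          }

      limit : Condition
      limit = record { height = δ ; C = E ; valid = valid′ }

      limit-≼ : ∀ a p → limit ≼[ i ] c a p
      limit-≼ a p = (<⇒≤ (h<δ x) , λ α q m β → low x q β) , defined a p , inj₂ (h<δ x ,
        Sup-map (λ ζ _ e → mk x ≤-refl (defined-< (at x) (defined a p)) e) (defined-sup (at x) (defined a p)))
        where
        x : I
        x = a , p

    record Node (p : Condition) (i : K) : Set ℓ where
      constructor node-of
      field
        condition : Condition
        .below : condition ≼[ i ] p

    open Node using (condition)

    node-below : ∀ {p i} (x : Node p i) → condition x ≼[ i ] p
    node-below (node-of _ b) = recompute em↓ b

    node-≡ : ∀ {p i} {x y : Node p i} → condition x ≡ condition y → x ≡ y
    node-≡ {x = node-of c _} {node-of .c _} refl = refl

    module _ (p : Condition) (i : K) (def : Defined p i) where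

      private
        i<θ : i < θ
        i<θ = defined-< p def

        node-defined : (x : Node p i) → Defined (condition x) i
        node-defined x = ≼[]-defined {condition x} {p} (node-below x)

        extend : (x : Node p i) (c : Condition) → c ≼[ i ] condition x → Node p i
        extend x c h = node-of c (≼[]-trans {c} {condition x} {p} h (node-below x))

        infix 4 _⊴_
        _⊴_ : Node p i → Node p i → Set ℓ
        x ⊴ y = condition x ≼[ i ] condition y

        rank : Node p i → K
        rank x = height (condition x)

        -- If some member has greatest height, all later ones equal it and it is the bound;
        -- otherwise `Limit` applies.
        lower-bound : ∀ k (c : Prefix (Node p i) k) → (∀ a b q r → a < b → c b r ⊴ c a q) → Σ (Node p i) λ r → ∀ a q → r ⊴ c a q
        lower-bound k c dec with em↓ {Σ K λ a → a < k}
        ... | no none = node-of p (≼[]-refl {p} def) , λ a q → ⊥-elim (none (a , q))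
        ... | yes (a₀ , a₀<k) with em↓ {Σ K λ a → Σ (a < k) λ q → ∀ b r → rank (c b r) ≤ rank (c a q)}
        ... | yes (a , q , max) = c a q , λ b r → go b r (compare a b)
          where
          go : ∀ b r → a < b ⊎ a ≡ b ⊎ b < a → c a q ⊴ c b r
          go b r (inj₂ (inj₂ b<a)) = dec b a r q b<a
          go b r (inj₂ (inj₁ refl)) with <-irrelevant q r
          ... | refl = ≼[]-refl {condition (c a q)} (node-defined (c a q))
          go b r (inj₁ a<b) with dec a b q r a<b
          ... | h = subst (λ d → d ≼[ i ] condition (c b r))
                      (≼-height {condition (c b r)} {condition (c a q)} (proj₁ h) (≤-antisym (proj₁ (proj₁ h)) (max b r)))
                      (≼[]-refl {condition (c b r)} (node-defined (c b r)))
        ... | no none = extend (c a₀ a₀<k) limit (limit-≼ a₀ a₀<k) , limit-≼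
          where
          no-least : ∀ a q → Σ K λ b → Σ (b < k) λ r → rank (c a q) < rank (c b r)
          no-least a q = byContradiction↓ λ n → none (a , q , λ b r h → n (b , r , h))
          open Limit i k (λ a q → condition (c a q)) dec (λ a q → node-defined (c a q)) a₀ a₀<k no-least

        tall : ∀ (x : Node p i) k → Σ (Node p i) λ y → y ⊴ x × k < rank y
        tall x k = extend x extension extension-≼₀ , extension-≼₀ , extension-tall
          where open Extension (condition x) (condition x) i i (node-defined x) ≤-refl i<θ (≼[]-refl {condition x} (node-defined x)) k

        -- Take `y` below `x` and an index `j > i`, which exists as θ is a limit. The extension
        -- built from `x` at `i` and `y` at `j` is higher than `y` but omits `height y` from its top
        -- club at `i`; by linearity the two are incompatible in S_i.
        split : ∀ (x : Node p i) → Σ (Node p i) λ y → Σ (Node p i) λ z → y ⊴ x × z ⊴ x × ¬ (Σ (Node p i) λ u → u ⊴ y × u ⊴ z)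
        split x with tall x (rank x) | θ-limit i i<θ
        ... | y , y⊴x , x<y | j , i<j , j<θ =
          y , extend x extension extension-≼₀ , y⊴x , extension-≼₀ , λ { (u , u⊴y , u⊴z) →
            case ≼[]-linear {condition u} {condition y} {extension} u⊴y u⊴z of λ
              { (inj₁ y⊴z) → proj₁ (proj₁ y⊴z) extension-tall
              ; (inj₂ (_ , _ , inj₁ e)) → ≡⇒≤ (sym e) extension-tall
              ; (inj₂ (_ , _ , inj₂ (q , s))) → extension-omits x<y i<j (Of.closed extension q s) } }
          where open Extension (condition x) (condition y) i j (node-defined x) (<⇒≤ i<j) j<θ (≼[]-up {condition y} {condition x} (<⇒≤ i<j) j<θ y⊴x) (rank y)

      nodeTree : Tree
      nodeTree = record
        { Node = Node p i
        ; _≼_ = _⊴_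
        ; ≼-refl = λ {x} → ≼[]-refl {condition x} (node-defined x)
        ; ≼-trans = λ {x} {y} {z} → ≼[]-trans {condition x} {condition y} {condition z}
        ; root = node-of p (≼[]-refl {p} def)
        ; ≼-root = node-below
        ; rank = rank
        ; rank-mono = λ h → proj₁ (proj₁ h)
        ; rank-strict = λ {x} {y} h e → node-≡ (≼-height {condition x} {condition y} (proj₁ h) (sym e))
        ; linear = λ {r} {s} {t} → ≼[]-linear {condition r} {condition s} {condition t}
        ; closed = lower-bound
        ; tall = tall
        ; split = split
        }

    -- The form in which 2^λ < κ for λ < κ is used. There are three arguments because the clubs of a
    -- condition form one such relation.
    Pigeonhole : Set ℓ
    Pigeonhole = ∀ k (F : K → K → K → K → Bool) →
      Σ K λ a → Σ K λ b → a < b × ∀ α m β → α < k → m < k → β < k → F a α m β ≡ F b α m β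

    few-conditions : Pigeonhole → ∀ k (f : K → Condition) → (∀ a → height (f a) < k) → Σ K λ a → Σ K λ b → a < b × f a ≡ f b
    few-conditions pigeonhole k f low with upper k θ
    ... | l , k<l , θ<l with pigeonhole l (λ a → C (f a))
    ... | a , b , a<b , same = a , b , a<b , Condition-≡ (≤-antisym (height≤ {f a} {f b} agree) (height≤ {f b} {f a} λ α m β → sym (agree α m β))) agree
      where
      inside : ∀ a α m β → C (f a) α m β ≡ true → α < l × m < l × β < l
      inside a α m β e with Of.entry (f a) e
      ... | _ , α≤h , m<θ , β<α =
        let α<l = ≤-<-trans α≤h (<-trans (low a) k<l) in α<l , <-trans m<θ θ<l , <-trans β<α α<l
      agree : ∀ α m β → C (f a) α m β ≡ C (f b) α m β
      agree α m β = bool-≡ (λ e → let (p , q , r) = inside a α m β e in trans (sym (same α m β p q r)) e)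
                           (λ e → let (p , q , r) = inside b α m β e in trans (same α m β p q r) e)
      height≤ : ∀ {c d} → (∀ α m β → C c α m β ≡ C d α m β) → height c ≤ height d
      height≤ {c} {d} e = case Of.start c (height c) (Of.height-limit c) ≤-refl of λ { (m , β , x) →
        proj₁ (proj₂ (Of.entry d (trans (sym (e (height c) m β)) x))) }

    -- For a large index `s` the condition `d` extends `c` in S_s; `Extension` then follows `c` at
    -- `i` and `d` at `s`.
    refine : ∀ c d i → Defined c i → d ≼ c → Σ Condition λ e → e ≼[ i ] c × e ≼ d
    refine c d i def d≼c = case ≼⇒≼[] {d} {c} d≼c of λ { (j , j<θ , h) →
      case maximum i j (defined-< c def) j<θ of λ { (s , i≤s , j≤s , s<θ) → result s i≤s s<θ (≼[]-up {d} {c} j≤s s<θ h) } }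
      where
      result : ∀ s → i ≤ s → s < θ → d ≼[ s ] c → Σ Condition λ e → e ≼[ i ] c × e ≼ d
      result s i≤s s<θ h = extension , extension-≼₀ , proj₁ extension-≼
        where open Extension c d i s def i≤s s<θ h (height c)

 open Conditions

 -- Order types, and the partition of κ into θ pieces

 module Orders where

  module OrderTypes (R : RegularOrder) where

    open RegularOrder R

    choose-below : ∀ {θ z} (Φ : K → Set ℓ) (A : K → K → Set (suc ℓ)) → z < θ → (∀ i → i < θ → Σ K λ ν → Lift (suc ℓ) (Φ ν) × A i ν) →
                   Σ (K → K) λ g → (∀ i → Φ (g i)) × ∀ i → i < θ → A i (g i)
    choose-below {θ} {z} Φ A z<θ h = (λ i → proj₁ (at i em↓)) , (λ i → lower (proj₁ (proj₂ (at i em↓)))) , λ i → proj₂ (proj₂ (at i em↓))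
      where
      at : ∀ i → Dec (i < θ) → Σ K λ ν → Lift (suc ℓ) (Φ ν) × (i < θ → A i ν)
      at i (yes p) = case h i p of λ { (ν , φ , a) → ν , φ , λ _ → a }
      at i (no n) = case h z z<θ of λ { (ν , φ , _) → ν , φ , λ p → ⊥-elim (n p) }

    -- S is a set of ordinals; orderType S k is the order type of S ∩ k.
    abstract
      types : ∀ (S : K → Bool) → Σ (K → K) λ t → ∀ k →
              Lift (suc ℓ) ((∀ j → j < k → S j ≡ true → t j < t k) × (∀ b → (∀ j → j < k → S j ≡ true → t j < b) → t k ≤ b) × t k ≤ k)
      types S = build K Φ λ k g ih → pick k g (λ j p → proj₂ (proj₂ (lower (ih j p))))
        where
        Bounds : ∀ k → Prefix K k → K → Set (suc ℓ)
        Bounds k g b = Lift (suc ℓ) (∀ j p → S j ≡ true → g j p < b)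
        Φ : ∀ k → Prefix K k → K → Set (suc ℓ)
        Φ k g t = Lift (suc ℓ) ((∀ j p → S j ≡ true → g j p < t) × (∀ b → (∀ j p → S j ≡ true → g j p < b) → t ≤ b) × t ≤ k)
        pick : ∀ k g → (∀ j p → g j p ≤ j) → Σ K (Φ k g)
        pick k g small = case least (Bounds k g) (k , bounds) of λ { (t , lift h , min) → t , lift (h , (λ b h′ → min b (lift h′)) , min k bounds) }
          where
          bounds : Bounds k g k
          bounds = lift λ j p _ → ≤-<-trans (small j p) p

    orderType : (K → Bool) → K → K
    orderType S = proj₁ (types S)

    module _ (S : K → Bool) where

      orderType-< : ∀ {j k} → j < k → S j ≡ true → orderType S j < orderType S k
      orderType-< {j} {k} = proj₁ (lower (proj₂ (types S) k)) j

      orderType-least : ∀ k b → (∀ j → j < k → S j ≡ true → orderType S j < b) → orderType S k ≤ b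
      orderType-least k = proj₁ (proj₂ (lower (proj₂ (types S) k)))

      orderType-≤ : ∀ k → orderType S k ≤ k
      orderType-≤ k = proj₂ (proj₂ (lower (proj₂ (types S) k)))

      -- If no member of `S` below `k` had order type at least η, then η would bound the order type
      -- at `k`; a member whose order type exceeds η is handled by induction.
      orderType-onto : ∀ k η → η < orderType S k → Σ K λ j → j < k × S j ≡ true × orderType S j ≡ η
      orderType-onto = wf-induction _ λ k ih η η<t → case em↓ {Σ K λ j → j < k × S j ≡ true × η ≤ orderType S j} of λ
        { (no n) → ⊥-elim (orderType-least k η (λ j p s → [ (λ q → q) , (λ q → ⊥-elim (n (j , p , s , q))) ]′ (<-or-≥ (orderType S j) η)) η<t)
        ; (yes (j , p , s , q)) → case ≤-split q of λ
            { (inj₂ e) → j , p , s , sym e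
            ; (inj₁ r) → case ih j p η r of λ { (i , i<j , s′ , e) → i , <-trans i<j p , s′ , e } } }

      orderType-injective : ∀ {j k} → S j ≡ true → S k ≡ true → orderType S j ≡ orderType S k → j ≡ k
      orderType-injective {j} {k} s s′ e with compare j k
      ... | inj₁ p = ⊥-elim (<-irrefl (subst (_< orderType S k) e (orderType-< p s)))
      ... | inj₂ (inj₁ e′) = e′
      ... | inj₂ (inj₂ p) = ⊥-elim (<-irrefl (subst (orderType S k <_) e (orderType-< p s′)))

    orderType-local : ∀ {S S′} k → (∀ j → j < k → S j ≡ S′ j) → orderType S k ≡ orderType S′ k
    orderType-local {S} {S′} = wf-induction (λ k → (∀ j → j < k → S j ≡ S′ j) → orderType S k ≡ orderType S′ k) λ k ih h → ≤-antisym
      (orderType-least S k (orderType S′ k) λ j p s → subst (_< orderType S′ k) (sym (ih j p λ i q → h i (<-trans q p))) (orderType-< S′ p (trans (sym (h j p)) s)))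
      (orderType-least S′ k (orderType S k) λ j p s → subst (_< orderType S k) (ih j p λ i q → h i (<-trans q p)) (orderType-< S p (trans (h j p) s)))

    -- κ is cut into θ pieces, the i-th being enumerated by b i; h maps each
    -- piece to its index.
    module Pieces (θ z : K) (z<θ : z < θ) where

      private
        -- Row `k` consists of the values `b i k`. It is increasing in `i` and lies above the
        -- earlier rows, which makes the pieces disjoint, and above `k`, which makes each of them
        -- unbounded.
        Φ : ∀ k → Prefix (K → K) k → (K → K) → Set (suc ℓ)
        Φ k g f = Lift (suc ℓ) ((∀ j p i i′ → i < θ → g j p i < f i′) × (∀ i i′ → i < i′ → f i < f i′) × ∀ i → k < f i)

        Ψ : K → ∀ i → Prefix K i → K → Set (suc ℓ)
        Ψ n i g a = Lift (suc ℓ) (n < a × ∀ i′ p → g i′ p < a)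

        Row : K → Set (suc ℓ)
        Row n = Σ (K → K) λ f → ∀ i → Ψ n i (λ j _ → f j) (f i)

        row : ∀ n → Row n
        row n = build K (Ψ n) λ i g _ → case bound i g of λ { (a , a-bound) → case upper a n of λ { (c , a<c , n<c) →
          c , lift (n<c , λ i′ p → <-trans (a-bound i′ p) a<c) } }

        finish : ∀ k g m n → (∀ j p → proj₁ (bound θ λ i _ → g j p i) < m) → m < n → k < n → Row n → Σ (K → K) (Φ k g)
        finish k g m n m-bound m<n k<n (f , h) = f , lift
          ( (λ j p i i′ i<θ → <-trans (proj₂ (bound θ λ i _ → g j p i) i i<θ) (<-trans (m-bound j p) (<-trans m<n (proj₁ (lower (h i′))))))
          , (λ i i′ → proj₂ (lower (h i′)) i)
          , λ i → <-trans k<n (proj₁ (lower (h i))) )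

        abstract
          rows : Σ (K → K → K) λ b → ∀ k → Φ k (λ j _ → b j) (b k)
          rows = build (K → K) Φ λ k g _ → case bound k (λ j p → proj₁ (bound θ λ i _ → g j p i)) of λ { (m , m-bound) →
            case upper m k of λ { (n , m<n , k<n) → finish k g m n m-bound m<n k<n (row n) } }

      b : K → K → K
      b i k = proj₁ rows k i

      b-above : ∀ i k → k < b i k
      b-above i k = proj₂ (proj₂ (lower (proj₂ rows k))) i

      private
        index-unique : ∀ {i i′ k k′} → i < θ → i′ < θ → b i k ≡ b i′ k′ → i ≡ i′
        index-unique {i} {i′} {k} {k′} p p′ e with compare k k′
        ... | inj₁ q = ⊥-elim (<-irrefl (subst (b i k <_) (sym e) (proj₁ (lower (proj₂ rows k′)) k q i i′ p)))
        ... | inj₂ (inj₂ q) = ⊥-elim (<-irrefl (subst (b i′ k′ <_) e (proj₁ (lower (proj₂ rows k)) k′ q i′ i p′)))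
        ... | inj₂ (inj₁ refl) with compare i i′
        ... | inj₁ q = ⊥-elim (<-irrefl (subst (b i k <_) (sym e) (proj₁ (proj₂ (lower (proj₂ rows k))) i i′ q)))
        ... | inj₂ (inj₁ e′) = e′
        ... | inj₂ (inj₂ q) = ⊥-elim (<-irrefl (subst (b i′ k <_) e (proj₁ (proj₂ (lower (proj₂ rows k))) i′ i q)))

        -- Ordinals in no piece are given the index `z`, so that `h` is total.
        piece : ∀ k → Σ K λ i → i < θ × ((Σ K λ i′ → i′ < θ × Σ K λ j → b i′ j ≡ k) → Σ K λ j → b i j ≡ k)
        piece k with em↓ {Σ K λ i → i < θ × Σ K λ j → b i j ≡ k}
        ... | yes (i , p , h) = i , p , λ _ → h
        ... | no n = z , z<θ , λ h → ⊥-elim (n h)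

      abstract
        h : K → K
        h k = proj₁ (piece k)

        h<θ : ∀ k → h k < θ
        h<θ k = proj₁ (proj₂ (piece k))

        h-b : ∀ {i} k → i < θ → h (b i k) ≡ i
        h-b {i} k p = case proj₂ (proj₂ (piece (b i k))) (i , p , k , refl) of λ { (j , e) → index-unique (h<θ (b i k)) p e }

 open Orders

 -- Subsets of κ and complete ultrafilters in a generic extension

 module Measure where

  module InExtension (𝕜 : RegularCardinal)
                     (P : Poset (suc ℓ) ℓ (suc ℓ)) {D : Set ℓ} (⟪_⟫ : D → Poset.Carrier P)
                     (dense : ∀ p → Σ D λ d → Poset._≤_ P ⟪ d ⟫ p) where

    open RegularCardinal 𝕜 using (κ)
    open Uncountable 𝕜
    open RegularOrder R using (_<_; <-irrefl) renaming (_≤_ to _≤ᵏ_; <-or-≥ to <-or-≥ᵏ; ≤-split to ≤ᵏ-split; compare to compareᵏ)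
    open OverPoset P
    open Comprehension ⟪_⟫ dense public

    ˇ : K → Name P
    ˇ k = check (val k)

    ˇ-injective : ∀ {p j k} → p ⊩ ˇ j ≗ ˇ k → j ≡ k
    ˇ-injective e = val-injective (≗-check _ _ e)

    ˇ∊κ : ∀ {p} k → p ⊩ ˇ k ∊ check κ
    ˇ∊κ k = check-∊ κ (val∊κ k)

    ˇ-mono : ∀ {p j k} → j < k → p ⊩ ˇ j ∊ ˇ k
    ˇ-mono {k = k} h = check-∊ (val k) (<⇒∊ h)

    ˇ-reflect : ∀ {p j k} → p ⊩ ˇ j ∊ ˇ k → j < k
    ˇ-reflect {j = j} {k} h = ∊⇒< (check-∊-check (val j) (val k) h)

    κ-presents : ∀ {p} → Presents p (check κ) ˇ (λ _ _ → Lift (suc ℓ) ⊤)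
    κ-presents = record
      { split = λ _ m → dense-map (∊-check κ m) λ { _ _ (x , m′ , e) →
          case represent m′ of λ { (k , e′) → k , ≗-trans e (check-≗ x (val k) e′) , lift tt } }
      ; member = λ k _ _ → ˇ∊κ k }

    ˇ-presents : ∀ {p} k → Presents p (ˇ k) ˇ (λ j _ → Lift (suc ℓ) (j < k))
    ˇ-presents k = record
      { split = λ _ m → dense-map (∊-check (val k) m) λ { _ _ (x , m′ , e) →
          case below k m′ of λ { (j , p , e′) → j , ≗-trans e (check-≗ x (val j) e′) , lift p } }
      ; member = λ j _ h → ˇ-mono (lower h) }

    Predicate : Set (suc (suc ℓ))
    Predicate = K → Cond → Set (suc ℓ)

    -- `Local` recovers `F k` from the forced membership of `k` in `subset F`, which yields `F k`
    -- only densely.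
    Mono Local : Predicate → Set (suc ℓ)
    Mono F = ∀ k {p q} → q ≤ p → F k p → F k q
    Local F = ∀ k {p} → Dense p (F k) → F k p

    subset : Predicate → Name P
    subset = comprehension K ˇ

    ∊-subset : ∀ {F p k} → Mono F → F k p → p ⊩ ˇ k ∊ subset F
    ∊-subset {k = k} mono f = ∊-comprehension mono (always λ q q≤p → k , ≗-refl , mono k q≤p f)

    subset-∊ : ∀ {F p k} → Mono F → p ⊩ ˇ k ∊ subset F → Dense p (F k)
    subset-∊ {k = i} mono m = dense-map (comprehension-∊ mono m) λ { _ _ (j , e , f) →
      case ˇ-injective {j = i} {j} e of λ { refl → f } }

    subset-⊆κ : ∀ {F p x} → Mono F → p ⊩ x ∊ subset F → p ⊩ x ∊ check κ
    subset-⊆κ mono m = ∊-local (dense-map (comprehension-∊ mono m) λ { _ _ (k , e , _) → ∊-≗ˡ (≗-sym e) (ˇ∊κ k) })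

    subset-⊆ : ∀ {F G p} → Mono F → Mono G → (∀ k q → q ≤ p → F k q → G k q) →
               ∀ {x q} → q ≤ p → q ⊩ x ∊ subset F → q ⊩ x ∊ subset G
    subset-⊆ mF mG h q≤p m = ∊-comprehension mG (dense-map (comprehension-∊ mF m)
      λ { r r≤q (k , e , f) → k , e , h k r (≤-trans r≤q q≤p) f })

    Complement : Predicate → Predicate
    Complement F k p = ∀ q → q ≤ p → ¬ F k q

    complement-mono : ∀ F → Mono (Complement F)
    complement-mono F k q≤p h r r≤q = h r (≤-trans r≤q q≤p)

    module Ultra (p₀ : Cond) (U : Name P) (ultra : Forces P p₀ (IsUltrafilter U (check κ))) where

      infix 4 _⊩_∊U
      _⊩_∊U : Cond → Predicate → Set (suc ℓ)
      p ⊩ F ∊U = p ⊩ subset F ∊ U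

      up : ∀ {p} F G → p ≤ p₀ → Mono F → Mono G → (∀ k q → q ≤ p → F k q → G k q) → p ⊩ F ∊U → p ⊩ G ∊U
      up {p} F G h mF mG f m = memᶠ (proj₁ (proj₂ (proj₂ ultra)) _ _ h (un∊ᶠ m) _ _ ≤-refl
        (λ x q q≤p m′ → un∊ᶠ (subset-⊆ mF mG f q≤p (memᶠ m′))) _ ≤-refl (λ x q q≤p m′ → un∊ᶠ (subset-⊆κ mG (memᶠ m′))))

      meet : ∀ {p} F G → p ≤ p₀ → Mono F → Mono G → p ⊩ F ∊U → p ⊩ G ∊U → p ⊩ (λ k q → F k q × G k q) ∊U
      meet {p} F G h mF mG m m′ = memᶠ (proj₁ (proj₂ (proj₂ (proj₂ ultra))) _ _ h (un∊ᶠ m) _ _ ≤-refl (un∊ᶠ m′) _ _ ≤-refl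
        λ x → (λ q q≤p n → un∊ᶠ (subset-⊆ {G = F} mB mF (λ _ _ _ → proj₁) q≤p (memᶠ n)) , un∊ᶠ (subset-⊆ {G = G} mB mG (λ _ _ _ → proj₂) q≤p (memᶠ n)))
            , (λ { q q≤p (n , n′) → un∊ᶠ (∊-comprehension mB (dense-bind (comprehension-∊ mF (memᶠ n)) λ { r r≤q (k , e , f) →
                 dense-map (comprehension-∊ mG (∊-mono r≤q (memᶠ n′))) λ { s s≤r (k′ , e′ , g) →
                   case ˇ-injective {j = k} {k′} (≗-trans (≗-sym (≗-mono s≤r e)) e′) of λ { refl → k , e′ , mF k s≤r f , g } } })) }))
        where
        mB : Mono (λ k q → F k q × G k q)
        mB k r (f , g) = mF k r f , mG k r g

      inhabited : ∀ {p F} → p ≤ p₀ → Mono F → p ⊩ F ∊U → Σ K λ k → Σ Cond λ q → q ≤ p × F k q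
      inhabited {p} h mF m = case proj₂ (proj₁ ultra _ _ h (un∊ᶠ m)) p ≤-refl of λ { (q , q≤p , x , n) →
        case comprehension-∊ mF (memᶠ n) q ≤-refl of λ { (r , r≤q , k , _ , f) → k , r , ≤-trans r≤q q≤p , f } }

      decide : ∀ {p F} → p ≤ p₀ → Mono F → Dense p λ q → q ⊩ F ∊U ⊎ q ⊩ Complement F ∊U
      decide {p} {F} h mF = dense-map (proj₂ (proj₂ (proj₂ (proj₂ ultra))) (subset F) p h (λ x q _ m → un∊ᶠ (subset-⊆κ mF (memᶠ m)))
          (subset (Complement F)) p ≤-refl difference) λ _ _ → [ (λ m → inj₁ (memᶠ m)) , (λ m → inj₂ (memᶠ m)) ]′
        where
        mC : Mono (Complement F)
        mC = complement-mono F
        difference : Forces P p (IsDiff (subset (Complement F)) (check κ) (subset F))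
        difference x =
            (λ q q≤p m → un∊ᶠ (subset-⊆κ mC (memᶠ m)) , λ r r≤q m′ →
              case comprehension-∊ mC (memᶠ m) r r≤q of λ { (s , s≤r , k , e , n) →
              case comprehension-∊ mF (∊-mono s≤r (memᶠ m′)) s ≤-refl of λ { (t , t≤s , k′ , e′ , f) →
              case ˇ-injective {j = k} {k′} (≗-trans (≗-sym (≗-mono t≤s e)) e′) of λ { refl → ⊥-elim (n t t≤s f) } } })
          , (λ { q q≤p (m , n) → un∊ᶠ (∊-comprehension mC (dense-map (Presents.split (κ-presents {q}) ≤-refl (memᶠ m)) λ { r r≤q (k , e , _) →
               k , e , λ s s≤r f → Polymorphic.⊥-elim (n s (≤-trans s≤r r≤q) (un∊ᶠ (∊-≗ˡ (≗-sym (≗-mono s≤r e)) (∊-subset {k = k} mF f)))) })) })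

      module Complete (nonprincipal : Forces P p₀ (IsNonprincipal U (check κ))) (complete : Forces P p₀ (IsComplete U (check κ) (check κ))) where

        private
          Intersection : (K → Predicate) → K → Predicate
          Intersection F l k q = ∀ i → i < l → F i k q

          intersection-mono : ∀ {F l} → (∀ i → Mono (F i)) → Mono (Intersection F l)
          intersection-mono mono k h f i p = mono i k h (f i p)

          -- The intersection axiom for a family without repetitions, which is
          -- equinumerous with its index.
          injective-meet : ∀ {p} (F : K → Predicate) l → (∀ i → Mono (F i)) → (∀ i → Local (F i)) → p ≤ p₀ →
                           (∀ {q i j} → i < l → j < l → q ⊩ subset (F i) ≗ subset (F j) → i ≡ j) →
                           (∀ i → i < l → p ⊩ F i ∊U) → p ⊩ Intersection F l ∊U
          injective-meet {p} F l mono local p≤p₀ inj h = memᶠ (complete family p p≤p₀ family⊆U p ≤-refl family-small _ p ≤-refl spec)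
            where
            J : Set ℓ
            J = Σ K λ i → i < l
            name : J → Name P
            name (i , _) = subset (F i)
            name-injective : ∀ {q} {i j : J} → q ⊩ name i ≗ name j → i ≡ j
            name-injective {i = i , r} {j , s} e with inj r s e
            ... | refl = refl
            family : Name P
            family = comprehension J name (λ _ _ → Lift (suc ℓ) ⊤)
            family-presents : Presents p family name (λ _ _ → Lift (suc ℓ) ⊤)
            family-presents = presents-comprehension λ _ _ t → t
            family⊆U : Forces P p (family ⊆̇ U)
            family⊆U x q q≤p m = un∊ᶠ (∊-local (dense-map (Presents.split family-presents q≤p (memᶠ m)) λ { r r≤q ((i , s) , e , _) →
              ∊-≗ˡ (≗-sym e) (∊-mono (≤-trans r≤q q≤p) (h i s)) }))
            Label : J → K → Cond → Set (suc ℓ)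
            Label (i , _) j _ = Lift (suc ℓ) (i ≡ j)
            open Graphs {l = name} {m = ˇ} name-injective ˇ-injective Label (λ _ _ _ e → e)
            family-small : Forces P p (SizeBelow family (check κ))
            family-small = always λ q q≤p → ˇ l , un∊ᶠ (ˇ∊κ l) , always λ r r≤q → graph , forces-mono (IsBijection graph family (ˇ l)) (≤-trans r≤q q≤p)
              (graph-bijection family-presents (ˇ-presents l)
                (λ { {i = i , s} {j} _ (lift e) → lift tt , lift (subst (_< l) e s) })
                (λ { (i , s) _ _ → always λ _ _ → i , lift refl })
                (λ { _ (lift e) (lift e′) → trans (sym e) e′ })
                (λ { j _ (lift s) → always λ _ _ → (j , s) , lift refl })
                (λ { {i = i , _} {j , _} _ (lift e) (lift e′) → index-≡ (trans e (sym e′)) }))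
              where
              index-≡ : ∀ {i j r s} → i ≡ j → _≡_ {A = J} (i , r) (j , s)
              index-≡ refl = refl
            spec : Forces P p (∀̇ λ x → x ∈̇ subset (Intersection F l) ⇔̇ x ∈̇ check κ ∧̇ (∀∈ family λ X → x ∈̇ X))
            spec x =
                (λ q q≤p m → un∊ᶠ (subset-⊆κ (intersection-mono mono) (memᶠ m)) , λ X r r≤q mX → un∊ᶠ (∊-local
                  (dense-bind (Presents.split family-presents (≤-trans r≤q q≤p) (memᶠ mX)) λ { s s≤r ((i , t) , e , _) →
                   dense-map (comprehension-∊ (intersection-mono mono) (∊-mono (≤-trans s≤r r≤q) (memᶠ m))) λ { u u≤s (k , e′ , f) →
                     ∊-≗ʳ (≗-sym (≗-mono u≤s e)) (∊-≗ˡ (≗-sym e′) (∊-subset (mono i) (f i t))) } })))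
              , (λ { q q≤p (m , n) → un∊ᶠ (∊-comprehension (intersection-mono mono)
                  (dense-map (Presents.split (κ-presents {q}) ≤-refl (memᶠ m)) λ { r r≤q (k , e , _) → k , e , λ i t →
                    local i k (subset-∊ (mono i) (∊-≗ˡ e (memᶠ (n (name (i , t)) r r≤q (un∊ᶠ
                      (Presents.member family-presents (i , t) (≤-trans r≤q q≤p) (lift tt))))))) })) })

          Except : K → Predicate
          Except i k _ = Lift (suc ℓ) (k ≢ i)

          except : ∀ {p} i → p ≤ p₀ → p ⊩ Except i ∊U
          except {p} i h = ∊-local (dense-bind (decide {F = Only} h (λ _ _ e → e)) λ q q≤p → [
              (λ m → ⊥-elim (Polymorphic.⊥-elim (nonprincipal (ˇ i) q (≤-trans q≤p h) (un∊ᶠ (ˇ∊κ i)) (subset Only) q ≤-refl (≗⇒IsPair single) q ≤-refl (un∊ᶠ m))))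
            , (λ m → always λ r r≤q → up (Complement Only) (Except i) (≤-trans r≤q (≤-trans q≤p h)) (complement-mono Only) (λ _ _ e → e)
                       (λ k s _ n → lift λ e → n s ≤-refl (lift e)) (∊-mono r≤q m)) ]′)
            where
            Only : Predicate
            Only k _ = Lift (suc ℓ) (k ≡ i)
            single : ∀ {q} → q ⊩ subset Only ≗ pairᶠ (ˇ i) (ˇ i)
            single = ≗-extensional _ _
              (λ x q _ m → ∊-pairᶠ (dense-map (comprehension-∊ (λ _ _ e → e) m) λ { _ _ (k , e , lift refl) → inj₁ e }))
              (λ x q _ m → ∊-comprehension (λ _ _ e → e) (dense-map (pairᶠ-∊ m) λ _ _ → [ (λ e → i , e , lift refl) , (λ e → i , e , lift refl) ]′))

          Above : K → Predicate
          Above l k _ = Lift (suc ℓ) (l ≤ᵏ k)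

          -- An intersection of sets `Except i`. These are already distinct, so `injective-meet`
          -- applies directly; the reduction in `intersect` relies on this lemma.
          above : ∀ {p} l → p ≤ p₀ → p ⊩ Above l ∊U
          above {p} l h = up (Intersection Except l) (Above l) h (intersection-mono {Except} (λ _ _ _ e → e)) (λ _ _ e → e)
            (λ k q _ f → lift λ k<l → lower (f k k<l) refl)
            (injective-meet Except l (λ _ _ _ e → e) (λ i k d → proj₂ (proj₂ (d _ ≤-refl))) h inj (λ i _ → except i h))
            where
            inj : ∀ {q i j} → i < l → j < l → q ⊩ subset (Except i) ≗ subset (Except j) → i ≡ j
            inj {q} {i} {j} _ _ e with em↓ {i ≡ j}
            ... | yes i≡j = i≡j
            ... | no i≢j = ⊥-elim (lower (proj₂ (proj₂ (subset-∊ {Except i} (λ _ _ e → e)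
                  (∊-≗ʳ (≗-sym e) (∊-subset {Except j} (λ _ _ e → e) (lift i≢j))) q ≤-refl))) refl)

        unbounded : ∀ {p F} l → p ≤ p₀ → Mono F → (∀ k q → q ≤ p → F k q → k < l) → ¬ p ⊩ F ∊U
        unbounded {p} {F} l h mF bd m =
          case inhabited {F = λ k q → F k q × Above l k q} h (λ k q≤p (f , a) → mF k q≤p f , a) (meet F (Above l) h mF (λ _ _ e → e) m (above l h)) of λ
            { (k , q , q≤p , f , lift l≤k) → l≤k (bd k q q≤p f) }

        -- F i is replaced by (F i ∖ l) ∪ {i} to make the family injective.
        intersect : ∀ {p} (F : K → Predicate) l {G : Predicate} → (∀ i → Mono (F i)) → (∀ i → Local (F i)) → Mono G → p ≤ p₀ →
                    (∀ k q → q ≤ p → (∀ i → i < l → F i k q) → G k q) → (∀ i → i < l → p ⊩ F i ∊U) → p ⊩ G ∊U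
        intersect {p} F l {G} mono local mG h f m =
          up (λ k q → Above l k q × Intersection F′ l k q) G h (λ k q≤p (a , b) → a , intersection-mono {F′} mono′ k q≤p b) mG
            (λ { k q q≤p (lift l≤k , g) → f k q q≤p λ i i<l → case g i i<l of λ
               { (inj₁ (lift refl)) → ⊥-elim (l≤k i<l) ; (inj₂ (x , _)) → x } })
            (meet (Above l) (Intersection F′ l) h (λ _ _ e → e) (intersection-mono {F′} mono′) (above l h) (injective-meet F′ l mono′ local′ h inj
              λ i i<l → up (λ k q → F i k q × Above l k q) (F′ i) h (λ k q≤p (a , b) → mono i k q≤p a , b) (mono′ i) (λ _ _ _ → inj₂) (meet (F i) (Above l) h (mono i) (λ _ _ e → e) (m i i<l) (above l h))))
          where
          F′ : K → Predicate
          F′ i k q = Lift (suc ℓ) (k ≡ i) ⊎ (F i k q × Lift (suc ℓ) (l ≤ᵏ k))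
          mono′ : ∀ i → Mono (F′ i)
          mono′ i k q≤p (inj₁ e) = inj₁ e
          mono′ i k q≤p (inj₂ (x , a)) = inj₂ (mono i k q≤p x , a)
          local′ : ∀ i → Local (F′ i)
          local′ i k {q} d with em↓ {k ≡ i}
          ... | yes e = inj₁ (lift e)
          ... | no n = inj₂ (local i k (dense-map d λ _ _ → [ (λ e → ⊥-elim (n (lower e))) , proj₁ ]′) ,
                             (case d q ≤-refl of λ { (_ , _ , inj₁ e) → ⊥-elim (n (lower e)) ; (_ , _ , inj₂ (_ , a)) → a }))
          inj : ∀ {q i j} → i < l → j < l → q ⊩ subset (F′ i) ≗ subset (F′ j) → i ≡ j
          inj {q} {i} {j} i<l _ e = case subset-∊ {F′ j} {k = i} (mono′ j) (∊-≗ʳ e (∊-subset {F′ i} {k = i} (mono′ i) (inj₁ (lift refl)))) q ≤-refl of λ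
            { (_ , _ , inj₁ (lift i≡j)) → i≡j ; (_ , _ , inj₂ (_ , lift l≤i)) → ⊥-elim (l≤i i<l) }

 open Measure

 -- Few bounded relations on κ, from the measure in the Cohen extension

 module Collapse where

  module CohenMeasure (𝕜 : RegularCardinal) where

    open RegularCardinal 𝕜 using (κ)
    open Uncountable 𝕜 using (R; K)
    open RegularOrder R using (_<_; compare; next)
    open OverOrder R
    open OverOrderˢ R
    open Cohen 𝕜
    open OverPoset ℂ
    open InExtension 𝕜 ℂ ⟪_⟫ˢ ⟪⟫-dense

    private
      irrelevant₃ : ∀ {α m β l} (f : ∀ {α m β} → α < l → m < l → β < l → Bool)
                    (p p′ : α < l) (q q′ : m < l) (r r′ : β < l) → f p q r ≡ f p′ q′ r′
      irrelevant₃ f p p′ q q′ r r′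
        with RegularOrder.<-irrelevant R p p′ | RegularOrder.<-irrelevant R q q′ | RegularOrder.<-irrelevant R r r′
      ... | refl | refl | refl = refl

    module WithMeasure (𝕄 : MeasureName) where

      open MeasureName 𝕄 renaming (base to s₀)
      open Ultra ⟪ s₀ ⟫ˢ U ultra public
      open Complete nonprincipal complete public

      open Tree (stringTree s₀) using (distributive)

      node≤ : ∀ (t : Branch s₀) → ⟪ node t ⟫ˢ ≤ ⟪ s₀ ⟫ˢ
      node≤ t = ⟪⟫-mono {s₀} {node t} (branch-below t)

      dense-branch : ∀ (t : Branch s₀) {Φ : Cond → Set (suc ℓ)} → (∀ {p q} → q ≤ p → Φ p → Φ q) →
                     Dense ⟪ node t ⟫ˢ Φ → Σ (Branch s₀) λ u → node u ≼ˢ node t × Φ ⟪ node u ⟫ˢ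
      dense-branch t mono h = case h ⟪ node t ⟫ˢ (≤-refl {⟪ node t ⟫ˢ}) of λ { (q , q≤t , φ) →
        case ⟪⟫-dense q of λ { (s , s≤q) →
          let s≼t = ⟪⟫-reflect {node t} {s} (≤-trans {⟪ s ⟫ˢ} {q} {⟪ node t ⟫ˢ} s≤q q≤t) in
          branch {s = s₀} s (≼ˢ-trans {s} {node t} {s₀} s≼t (branch-below t)) , s≼t , mono s≤q φ } }

      -- Densely many conditions decide the coordinates of the F a for almost
      -- all a, so not all the F a can be distinct.
      module _ (l : K) (F : K → K → K → K → Bool) where

        private
          Value : K → K → K → Bool → Predicate
          Value α m β b a _ = Lift (suc ℓ) (F a α m β ≡ b)
          Decided : K → K → K → Branch s₀ → Set (suc ℓ)
          Decided α m β t = Σ Bool λ b → ⟪ node t ⟫ˢ ⊩ Value α m β b ∊U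
          decided-mono : ∀ α m β {t u : Branch s₀} → node u ≼ˢ node t → Decided α m β t → Decided α m β u
          decided-mono α m β {t} {u} h (b , d) = b , ∊-mono (⟪⟫-mono {node t} {node u} h) d
          decide-value : ∀ α m β t → Σ (Branch s₀) λ u → node u ≼ˢ node t × Decided α m β u
          decide-value α m β t = case dense-branch t {Φ} (λ { h (inj₁ d) → inj₁ (∊-mono h d) ; h (inj₂ d) → inj₂ (∊-mono h d) })
                                        (decide {⟪ node t ⟫ˢ} {Value α m β true} (node≤ t) (λ _ _ e → e)) of λ
              { (u , u≼t , inj₁ d) → u , u≼t , true , d
              ; (u , u≼t , inj₂ d) → u , u≼t , false , up (Complement (Value α m β true)) (Value α m β false) (node≤ u)
                  (complement-mono (Value α m β true)) (λ _ _ e → e) (λ a q _ n → lift (other (λ e → n q (≤-refl {q}) (lift e)))) d }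
            where
            Φ : Cond → Set (suc ℓ)
            Φ q = q ⊩ Value α m β true ∊U ⊎ q ⊩ Complement (Value α m β true) ∊U
            other : ∀ {b} → ¬ b ≡ true → b ≡ false
            other {false} _ = refl
            other {true} n = ⊥-elim (n refl)
          abstract
            decided : Σ (Branch s₀) λ t → ∀ α → α < l → ∀ m → m < l → ∀ β → β < l → Decided α m β t
            -- Distributivity is used once for each coordinate, so that one string serves all
            -- triples.
            decided = case distributive l (λ α t → ∀ m → m < l → ∀ β → β < l → Decided α m β t)
                             (λ { α {t} {u} h d m p β q → decided-mono α m β {t} {u} h (d m p β q) }) (branch {s = s₀} s₀ (≼ˢ-refl {s₀}))
                             (λ α _ t _ → distributive l (λ m t → ∀ β → β < l → Decided α m β t)
                               (λ { m {t} {u} h d β q → decided-mono α m β {t} {u} h (d β q) }) t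
                               (λ m _ t _ → distributive l (λ β t → Decided α m β t) (λ { β {t} {u} h d → decided-mono α m β {t} {u} h d }) t
                                 (λ β _ t _ → decide-value α m β t))) of λ
              { (t , _ , h) → t , h }

          module _ (t : Branch s₀) (d : ∀ α → α < l → ∀ m → m < l → ∀ β → β < l → Decided α m β t) where

            value : ∀ {α m β} → α < l → m < l → β < l → Bool
            value {α} {m} {β} p q r = proj₁ (d α p m q β r)
            Same₁ : Predicate
            Same₁ a _ = Lift (suc ℓ) (∀ α m β (p : α < l) (q : m < l) (r : β < l) → F a α m β ≡ value p q r)
            Same₂ : K → Predicate
            Same₂ α a _ = Lift (suc ℓ) (∀ m β (p : α < l) (q : m < l) (r : β < l) → F a α m β ≡ value p q r)
            Same₃ : K → K → Predicate
            Same₃ α m a _ = Lift (suc ℓ) (∀ β (p : α < l) (q : m < l) (r : β < l) → F a α m β ≡ value p q r)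
            Same₄ : K → K → K → Predicate
            Same₄ α m β a _ = Lift (suc ℓ) (∀ (p : α < l) (q : m < l) (r : β < l) → F a α m β ≡ value p q r)
            constant : ∀ {Φ : K → Set (suc ℓ)} k {p} → Dense p (λ _ → Φ k) → Φ k
            constant k {p} h = proj₂ (proj₂ (h p (≤-refl {p})))
            irrelevant : ∀ {α m β} (p p′ : α < l) (q q′ : m < l) (r r′ : β < l) → value p q r ≡ value p′ q′ r′
            irrelevant = irrelevant₃ value
            abstract
              -- Completeness, likewise once for each coordinate.
              almost-all : ⟪ node t ⟫ˢ ⊩ Same₁ ∊U
              almost-all = intersect Same₂ l (λ _ _ _ e → e) (λ i → constant {λ k → Same₂ i k ⟪ s₀ ⟫ˢ}) (λ _ _ e → e) (node≤ t)
                (λ a q _ h → lift λ α m β x → lower (h α x) m β x) λ α x →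
                intersect (Same₃ α) l (λ _ _ _ e → e) (λ i → constant {λ k → Same₃ α i k ⟪ s₀ ⟫ˢ}) (λ _ _ e → e) (node≤ t)
                (λ a q _ h → lift λ m β x y → lower (h m y) β x y) λ m y →
                intersect (Same₄ α m) l (λ _ _ _ e → e) (λ i → constant {λ k → Same₄ α m i k ⟪ s₀ ⟫ˢ}) (λ _ _ e → e) (node≤ t)
                (λ a q _ h → lift λ β x y z → lower (h β z) x y z) λ β z →
                up (Value α m β (value x y z)) (Same₄ α m β) (node≤ t) (λ _ _ e → e) (λ _ _ e → e)
                  (λ a q _ e → lift λ x′ y′ z′ → trans (lower e) (irrelevant x x′ y y′ z z′)) (proj₂ (d α x m y β z))

            abstract
              coincide : (Σ K λ a → Σ K λ b → a < b × ∀ α m β → α < l → m < l → β < l → F a α m β ≡ F b α m β)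
              coincide = byContradiction↓ λ distinct →
                case inhabited {⟪ node t ⟫ˢ} {Same₁} (node≤ t) (λ _ _ e → e) almost-all of λ { (a , _ , _ , lift e) →
                -- If all the `F a` are distinct, `a` is the only index with the decided values, so
                -- `b` bounds a set in `U`.
                case next a of λ { (b , a<b) → unbounded {⟪ node t ⟫ˢ} {Same₁} b (node≤ t) (λ _ _ e → e)
                  (λ { a′ _ _ (lift e′) → case compare a a′ of λ
                    { (inj₁ p) → ⊥-elim (distinct (a , a′ , p , λ α m β x y z → trans (e α m β x y z) (sym (e′ α m β x y z))))
                    ; (inj₂ (inj₁ refl)) → a<b
                    ; (inj₂ (inj₂ p)) → ⊥-elim (distinct (a′ , a , p , λ α m β x y z → trans (e′ α m β x y z) (sym (e α m β x y z)))) } }) almost-all } }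

        pigeonhole : Σ K λ a → Σ K λ b → a < b × ∀ α m β → α < l → m < l → β < l → F a α m β ≡ F b α m β
        pigeonhole = coincide (proj₁ decided) (proj₂ decided)

      few-strings : ∀ l (f : K → Branch s₀) → (∀ a → length (node (f a)) < l) → Σ K λ a → Σ K λ b → a < b × f a ≡ f b
      few-strings l f short = case RegularOrder.upper R l ω of λ { (l′ , l<l′ , ω<l′) →
          case pigeonhole l′ (λ a α m β → code a m β) of λ { (a , b , a<b , same) →
            a , b , a<b , branch-≡ (equal l<l′ ω<l′ same) } }
        where
        open RegularOrder R using (ω; 0ᵏ; 0<ω; <-irrefl; ≤-antisym; <-trans)
        -- A string as a relation: the coordinate `0ᵏ` carries the bits and any other one the
        -- length, which the padded bits do not determine. The coordinate α is a dummy.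
        Code : K → K → K → Set ℓ
        Code a m β = (m ≡ 0ᵏ × bits (node (f a)) β ≡ true) ⊎ (m ≢ 0ᵏ × β < length (node (f a)))
        code : K → K → K → Bool
        code a m β = bool (Lift (suc ℓ) (Code a m β))
        bits-of : ∀ {a β} → code a 0ᵏ β ≡ true → bits (node (f a)) β ≡ true
        bits-of e = [ proj₂ , (λ h → ⊥-elim (proj₁ h refl)) ]′ (lower (true-bool e))
        length-of : ∀ {a β} → code a ω β ≡ true → β < length (node (f a))
        length-of e = [ (λ h → ⊥-elim (<-irrefl (subst (0ᵏ <_) (proj₁ h) 0<ω))) , proj₂ ]′ (lower (true-bool e))
        ω≢0 : ω ≢ 0ᵏ
        ω≢0 e = <-irrefl (subst (0ᵏ <_) e 0<ω)
        equal : ∀ {l′ a b} → l < l′ → ω < l′ → (∀ α m β → α < l′ → m < l′ → β < l′ → code a m β ≡ code b m β) → node (f a) ≡ node (f b)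
        equal {l′} {a} {b} l<l′ ω<l′ same = String-≡ (≤-antisym (λ p → <-irrefl (transfer {a} {b} same′ (short b) p)) (λ p → <-irrefl (transfer {b} {a} (sym ∘ same′) (short a) p)))
            (λ β p → let q = <-trans (<-trans p (short a)) l<l′ in bool-≡
              (λ e → bits-of {b} (trans (sym (same₀ q)) (bool-true (lift (inj₁ (refl , e))))))
              (λ e → bits-of {a} (trans (same₀ q) (bool-true (lift (inj₁ (refl , e)))))))
          where
          same₀ : ∀ {β} → β < l′ → code a 0ᵏ β ≡ code b 0ᵏ β
          same₀ {β} q = same ω 0ᵏ β ω<l′ (<-trans 0<ω ω<l′) q
          same′ : ∀ {β} → β < l′ → code a ω β ≡ code b ω β
          same′ {β} q = same ω ω β ω<l′ ω<l′ q
          transfer : ∀ {c d} → (∀ {β} → β < l′ → code c ω β ≡ code d ω β) → length (node (f d)) < l →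
                     length (node (f d)) < length (node (f c)) → length (node (f d)) < length (node (f d))
          transfer {c} {d} e s p = length-of {d} (trans (sym (e (<-trans s l<l′))) (bool-true (lift (inj₂ (ω≢0 , p)))))

 open Collapse

 -- The measures U_i: deciding sets in the trees S_i

 module Decision where

  module Deciding (𝕜 : RegularCardinal) (𝕀 : Uncountable.Index 𝕜) (𝕄 : Cohen.MeasureName 𝕜) where

    open Uncountable 𝕜 using (R; K; module Index)
    open Index 𝕀 using (θᵏ; θ-limit)
    open RegularOrder R using (_<_)
    open OverOrder R
    open OverOrderˢ R
    open Cohen 𝕜 using (ℂ; ⟪_⟫ˢ; ⟪⟫-mono; ⟪⟫-reflect; ⟪⟫-dense; module MeasureName)
    open MeasureName 𝕄 using () renaming (base to s₀)
    open OverRegular R θᵏ θ-limit public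
    open OverPoset ℂ using (∊-mono) renaming (Cond to Condᶜ; _≤_ to _≤ᶜ_; ≤-refl to ≤ᶜ-refl; ≤-trans to ≤ᶜ-trans)
    open InExtension 𝕜 ℂ ⟪_⟫ˢ ⟪⟫-dense using (Mono; Local; Complement; complement-mono) renaming (Predicate to Predicateᶜ)
    open CohenMeasure 𝕜
    open WithMeasure 𝕄
    open Condition using (height; Defined)
    open Node using (condition)

    Property : Set (suc (suc ℓ))
    Property = K → Condition → Set (suc ℓ)

    -- Both refer to the order of ℙ(κ,θ), not of S_i: the properties of interest are statements
    -- forced there.
    Hereditary Regularᵖ : Property → Set (suc ℓ)
    Hereditary G = ∀ k {c d} → d ≼ c → G k c → G k d
    Regularᵖ G = ∀ k c → (∀ d → d ≼ c → Σ Condition λ e → e ≼ d × G k e) → G k c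

    Never : Property → Property
    Never G k c = ∀ d → d ≼ c → ¬ G k d

    module AtIndex (p₀ : Condition) (i : K) (def : Defined p₀ i) where

      abstract
        copyᵀ : DenseCopy (nodeTree p₀ i def)
        copyᵀ = denseCopy (nodeTree p₀ i def) λ k f short →
          case few-conditions pigeonhole k (λ a → condition (f a)) short of λ { (a , b , a<b , e) → a , b , a<b , node-≡ e }

        copyˢ : DenseCopy (stringTree s₀)
        copyˢ = denseCopy (stringTree s₀) few-strings

      open DenseCopy copyᵀ using (E; E-mono; E-reflect; E-dense)
      open DenseCopy copyˢ using () renaming (E to A; E-mono to A-mono; E-reflect to A-reflect; E-dense to A-dense)

      private
        e : Q → Condition
        e x = condition (E x)

        a : Q → Condᶜ
        a x = ⟪ Branch.node (A x) ⟫ˢ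

        a-mono : ∀ {x y} → x ⊑ y → a x ≤ᶜ a y
        a-mono {x} {y} h = ⟪⟫-mono {Branch.node (A y)} {Branch.node (A x)} (A-mono h)

        a-reflect : ∀ {x y} → a x ≤ᶜ a y → x ⊑ y
        a-reflect {x} {y} h = A-reflect (⟪⟫-reflect {Branch.node (A y)} {Branch.node (A x)} h)

        a≤s₀ : ∀ x → a x ≤ᶜ ⟪ s₀ ⟫ˢ
        a≤s₀ x = node≤ (A x)

        ≤ᶜ-trans′ : ∀ p q r → p ≤ᶜ q → q ≤ᶜ r → p ≤ᶜ r
        ≤ᶜ-trans′ p q r = ≤ᶜ-trans {p} {q} {r}

        below-a : ∀ x q → q ≤ᶜ a x → Σ Q λ y → a y ≤ᶜ q
        below-a x q q≤a = case ⟪⟫-dense q of λ { (s , s≤q) → dense s s≤q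
          (≼ˢ-trans {s} {Branch.node (A x)} {s₀} (⟪⟫-reflect {Branch.node (A x)} {s} (≤ᶜ-trans′ ⟪ s ⟫ˢ q (a x) s≤q q≤a)) (branch-below (A x))) }
          where
          dense : ∀ s → ⟪ s ⟫ˢ ≤ᶜ q → s ≼ˢ s₀ → Σ Q λ y → a y ≤ᶜ q
          dense s s≤q h = case A-dense (branch s h) of λ { (y , A≼s) →
            y , ≤ᶜ-trans′ (a y) ⟪ s ⟫ˢ q (⟪⟫-mono {s} {Branch.node (A y)} A≼s) s≤q }

      -- The predicate of conditions in Add(κ,1) corresponding to G under the
      -- two dense embeddings of Q.
      Transfer : Property → Predicateᶜ
      Transfer G k p = ∀ x → a x ≤ᶜ p → G k (e x)

      transfer-mono : ∀ G → Mono (Transfer G)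
      transfer-mono G k {p} {q} q≤p h x a≤q = h x (≤ᶜ-trans′ (a x) q p a≤q q≤p)

      private
        e-defined : ∀ x → Defined (e x) i
        e-defined x = ≼[]-defined {e x} {p₀} (node-below (E x))

        -- `refine` followed by the density of `Q` in S_i: the copy of `Q` reaches below every
        -- extension of its members in ℙ(κ,θ).
        refine-e : ∀ x d → d ≼ e x → Σ Q λ y → y ⊑ x × e y ≼ d
        refine-e x d h = case refine (e x) d i (e-defined x) h of λ { (t , t≼x , t≼d) → found t t≼x t≼d }
          where
          found : ∀ t → t ≼[ i ] e x → t ≼ d → Σ Q λ y → y ⊑ x × e y ≼ d
          found t t≼x t≼d = case E-dense (node-of t (≼[]-trans {t} {e x} {p₀} t≼x (node-below (E x)))) of λ { (y , E≼t) →
            y , E-reflect {y} {x} (≼[]-trans {e y} {t} {e x} E≼t t≼x) , ≼-trans {e y} {t} {d} (proj₁ E≼t) t≼d }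

      -- Regularity of `G` asks about extensions in ℙ(κ,θ). Each is caught by a point of `Q`, and
      -- below the Cohen string of that point the transferred property holds densely.
      transfer-local : ∀ {G} → Hereditary G → Regularᵖ G → Local (Transfer G)
      transfer-local {G} her reg k {p} h x a≤p = reg k (e x) λ d d≼e → case refine-e x d d≼e of λ { (y , y⊑x , e≼d) →
        case h (a y) (≤ᶜ-trans′ (a y) (a x) p (a-mono y⊑x) a≤p) of λ { (q , q≤a , g) →
        case below-a y q q≤a of λ { (z , a≤q) →
          e z , ≼-trans {e z} {e y} {d} (proj₁ (E-mono {z} {y} (a-reflect {z} {y} (≤ᶜ-trans′ (a z) q (a y) a≤q q≤a)))) e≼d , g z a≤q } } }

      abstract
        -- In S_i, `c` forces the set described by `G` into U_i: this is tested at the points of `Q`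
        -- below `c`, which are dense there.
        Decides : Condition → Property → Set (suc ℓ)
        Decides c G = ∀ x → e x ≼[ i ] c → a x ⊩ Transfer G ∊U

      abstract
        decides-mono : ∀ {c d G} → d ≼[ i ] c → Decides c G → Decides d G
        decides-mono {c} {d} d≼c h x e≼d = h x (≼[]-trans {e x} {d} {c} e≼d d≼c)

      private
        a≤⇒e≼ : ∀ x y c → a y ≤ᶜ a x → e x ≼[ i ] c → e y ≼[ i ] c
        a≤⇒e≼ x y c h = ≼[]-trans {e y} {e x} {c} (E-mono {y} {x} (a-reflect {y} {x} h))

      abstract
        decides-intersection : ∀ c (G : K → Property) l {H} → (∀ j → Hereditary (G j)) → (∀ j → Regularᵖ (G j)) →
          (∀ k d → d ≼ c → (∀ j → j < l → G j k d) → H k d) → (∀ j → j < l → Decides c (G j)) → Decides c H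
        decides-intersection c G l {H} her reg f h x e≼c =
          intersect (λ j → Transfer (G j)) l (λ j → transfer-mono (G j)) (λ j → transfer-local (her j) (reg j)) (transfer-mono H) (a≤s₀ x)
            (λ k q q≤a g y a≤q → f k (e y) (proj₁ (a≤⇒e≼ x y c (≤ᶜ-trans′ (a y) q (a x) a≤q q≤a) e≼c)) λ j p → g j p y a≤q)
            λ j p → h j p x e≼c

        decides-unbounded : ∀ c {G} l → c ≼[ i ] p₀ → (∀ k d → d ≼ c → G k d → k < l) → ¬ Decides c G
        decides-unbounded c {G} l c≼p₀ bd h = case E-dense (node-of c c≼p₀) of λ { (x , e≼c) →
          unbounded {a x} {Transfer G} l (a≤s₀ x) (transfer-mono G) (λ k q q≤a g → case below-a x q q≤a of λ { (y , a≤q) →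
            bd k (e y) (proj₁ (a≤⇒e≼ x y c (≤ᶜ-trans′ (a y) q (a x) a≤q q≤a) e≼c)) (g y a≤q) }) (h x e≼c) }

      private
        Outcome : Property → Condᶜ → Set (suc ℓ)
        Outcome G q = q ⊩ Transfer G ∊U ⊎ q ⊩ Complement (Transfer G) ∊U

        outcome-mono : ∀ G {p q} → q ≤ᶜ p → Outcome G p → Outcome G q
        outcome-mono G h (inj₁ d) = inj₁ (∊-mono h d)
        outcome-mono G h (inj₂ d) = inj₂ (∊-mono h d)

        -- An extension in ℙ(κ,θ) having `G` would be caught by a point of `Q`, whose Cohen string
        -- would then have the transferred property. So complements on the Cohen side become forced
        -- negations on the other.
        never : ∀ {G} → Hereditary G → ∀ k q → Complement (Transfer G) k q → Transfer (Never G) k q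
        never her k q n y a≤q d d≼e g = case refine-e y d d≼e of λ { (z , z⊑y , e≼d) →
          n (a z) (≤ᶜ-trans′ (a z) (a y) q (a-mono z⊑y) a≤q) λ v a≤a →
            her k (≼-trans {e v} {e z} {d} (proj₁ (E-mono {v} {z} (a-reflect {v} {z} a≤a))) e≼d) g }

        a≤node : ∀ y z (u : Branch s₀) → Branch.node (A y) ≼ˢ Branch.node u → e z ≼[ i ] e y → a z ≤ᶜ ⟪ Branch.node u ⟫ˢ
        a≤node y z u A≼u h = ⟪⟫-mono {Branch.node u} {Branch.node (A z)}
          (≼ˢ-trans {Branch.node (A z)} {Branch.node (A y)} {Branch.node u} (A-mono {z} {y} (E-reflect {z} {y} h)) A≼u)

        abstract
          decided : ∀ {G} → Hereditary G → ∀ y (u : Branch s₀) → Branch.node (A y) ≼ˢ Branch.node u →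
                    Outcome G ⟪ Branch.node u ⟫ˢ → Decides (e y) G ⊎ Decides (e y) (Never G)
          decided her y u A≼u (inj₁ d) = inj₁ λ z h → ∊-mono (a≤node y z u A≼u h) d
          decided {G} her y u A≼u (inj₂ d) = inj₂ λ z h →
            up (Complement (Transfer G)) (Transfer (Never G)) (a≤s₀ z) (complement-mono (Transfer G)) (transfer-mono (Never G))
               (λ k q _ → never her k q) (∊-mono (a≤node y z u A≼u h) d)

        outcome-at : ∀ {G} x → Σ (Branch s₀) λ u → Branch.node u ≼ˢ Branch.node (A x) × Outcome G ⟪ Branch.node u ⟫ˢ
        outcome-at {G} x = dense-branch (A x) {Outcome G} (λ {p} {q} → outcome-mono G {p} {q})
          (decide {a x} {Transfer G} (a≤s₀ x) (transfer-mono G))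

        a-below : ∀ x y (u : Branch s₀) → Branch.node (A y) ≼ˢ Branch.node u → Branch.node u ≼ˢ Branch.node (A x) → a y ≤ᶜ a x
        a-below x y u p q = ⟪⟫-mono {Branch.node (A x)} {Branch.node (A y)} (≼ˢ-trans {Branch.node (A y)} {Branch.node u} {Branch.node (A x)} p q)

      decides-dense : ∀ c {G} → c ≼[ i ] p₀ → Hereditary G → Σ Condition λ d → d ≼[ i ] c × (Decides d G ⊎ Decides d (Never G))
      decides-dense c {G} c≼p₀ her = case E-dense (node-of c c≼p₀) of λ { (x , e≼c) → case outcome-at {G} x of λ { (u , u≼a , φ) →
        case A-dense u of λ { (y , A≼u) → e y , a≤⇒e≼ x y c (a-below x y u A≼u u≼a) e≼c , decided her y u A≼u φ } } }

 open Decision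

 -- The ultrafilter W on the indices below θ

 module Filter where

  module OnIndices (𝕜 : RegularCardinal) (𝕀 : Uncountable.Index 𝕜) where

    open Uncountable 𝕜
    open Index 𝕀
    open RegularOrder R using (_<_; _≤_; <-or-≥; <-trans)

    -- W measures elements of V, so a predicate on indices is turned into a set; `Sq` keeps its
    -- index type small.
    Indices : (K → Set (suc ℓ)) → V ℓ
    Indices Φ = sup (Σ K λ i → Sq (Lift (suc ℓ) (i < θᵏ) × Φ i)) λ { (i , _) → val i }

    Almost : (K → Set (suc ℓ)) → Set ℓ
    Almost Φ = Indices Φ ∊ W

    indices-∊ : ∀ {Φ x} → x ∊ Indices Φ → Σ K λ i → x ≣ val i × i < θᵏ × Φ i
    indices-∊ m = case sup-∊ m of λ { ((i , s) , e) → i , e , lower (proj₁ (unsq s)) , proj₂ (unsq s) }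

    ∊-indices : ∀ {Φ i} → i < θᵏ → Φ i → val i ∊ Indices Φ
    ∊-indices {i = i} p φ = ∊-sup (i , sq (lift p , φ))

    private
      ∊θ : ∀ {i} → i < θᵏ → val i ∊ θ
      ∊θ p = ∊-≣ʳ (≣-sym θ≣) (<⇒∊ p)

      θ∊ : ∀ {x} → x ∊ θ → Σ K λ i → x ≣ val i × i < θᵏ
      θ∊ m = case below θᵏ (∊-≣ʳ θ≣ m) of λ { (i , p , e) → i , e , p }

      indices-⊆ : ∀ {Φ} → V⊨ Indices Φ ⊆̇ θ
      indices-⊆ z m = case indices-∊ (mem (lower m)) of λ { (i , e , p , _) → lift (un∊ (∊-≣ˡ (≣-sym e) (∊θ p))) }

      superset : ∀ {x y} → x ∊ W → (∀ {z} → z ∊ x → z ∊ y) → (∀ {z} → z ∊ y → z ∊ θ) → y ∊ W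
      superset m f g = mem (lower (proj₁ (proj₂ (proj₂ (proj₁ uniform))) _ (lift (un∊ m)) _
        (λ z n → lift (un∊ (f (mem (lower n))))) (λ z n → lift (un∊ (g (mem (lower n)))))))

    abstract
      almost-mono : ∀ {Φ Ψ} → (∀ i → i < θᵏ → Φ i → Ψ i) → Almost Φ → Almost Ψ
      almost-mono f m = superset m
        (λ n → case indices-∊ n of λ { (i , e , p , φ) → ∊-≣ˡ (≣-sym e) (∊-indices p (f i p φ)) })
        (λ n → mem (lower (indices-⊆ _ (lift (un∊ n)))))

      almost-all : ∀ {Φ} → (∀ i → i < θᵏ → Φ i) → Almost Φ
      almost-all f = superset (mem (lower (proj₁ (proj₂ (proj₁ uniform)))))
        (λ n → case θ∊ n of λ { (i , e , p) → ∊-≣ˡ (≣-sym e) (∊-indices p (f i p)) })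
        (λ n → mem (lower (indices-⊆ _ (lift (un∊ n)))))

      almost-and : ∀ {Φ Ψ} → Almost Φ → Almost Ψ → Almost (λ i → Φ i × Ψ i)
      almost-and m m′ = mem (lower (proj₁ (proj₂ (proj₂ (proj₂ (proj₁ uniform)))) _ (lift (un∊ m)) _ (lift (un∊ m′)) _ λ x →
          (λ n → case indices-∊ (mem (lower n)) of λ { (i , e , p , φ , ψ) →
             lift (un∊ (∊-≣ˡ (≣-sym e) (∊-indices p φ))) , lift (un∊ (∊-≣ˡ (≣-sym e) (∊-indices p ψ))) })
        , (λ { (n , n′) → case indices-∊ (mem (lower n)) of λ { (i , e , p , φ) → case indices-∊ (mem (lower n′)) of λ { (i′ , e′ , _ , ψ) →
             case val-injective {i} {i′} (≣-trans (≣-sym e) e′) of λ { refl → lift (un∊ (∊-≣ˡ (≣-sym e) (∊-indices p (φ , ψ)))) } } } })))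

      almost-exists : ∀ {Φ} → Almost Φ → Σ K λ i → i < θᵏ × Φ i
      almost-exists m = case proj₂ (proj₁ (proj₁ uniform) _ (lift (un∊ m))) of λ { (x , n) →
        case indices-∊ (mem (lower n)) of λ { (i , _ , p , φ) → i , p , φ } }

      almost-or : ∀ Φ → Almost Φ ⊎ Almost (λ i → ¬ Φ i)
      almost-or Φ = [ (λ m → inj₁ (mem (lower m))) , (λ m → inj₂ (mem (lower m))) ]′
        (proj₂ (proj₂ (proj₂ (proj₂ (proj₁ uniform)))) (Indices Φ) indices-⊆ (Indices λ i → ¬ Φ i) λ x →
            (λ n → case indices-∊ (mem (lower n)) of λ { (i , e , p , ¬φ) →
               lift (un∊ (∊-≣ˡ (≣-sym e) (∊θ p))) , λ n′ → case indices-∊ (mem (lower n′)) of λ { (i′ , e′ , _ , φ) →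
                 case val-injective {i} {i′} (≣-trans (≣-sym e) e′) of λ { refl → ⊥-elim (¬φ φ) } } })
          , (λ { (n , ¬n) → case θ∊ (mem (lower n)) of λ { (i , e , p) → lift (un∊ (∊-≣ˡ (≣-sym e) (∊-indices p λ φ →
               Polymorphic.⊥-elim (¬n (lift (un∊ (∊-≣ˡ (≣-sym e) (∊-indices p φ)))))))) } }))

      -- A bounded set in W would be equinumerous with the cardinal θ.
      almost-above : ∀ {i} → i < θᵏ → Almost (λ j → Lift (suc ℓ) (i ≤ j))
      almost-above {i} i<θ = [ (λ m → m) , (λ m → ⊥-elim (Polymorphic.⊥-elim (proj₂ cardinal (val i) (lift (un∊ (∊θ i<θ)))
          (proj₂ uniform (val i) (lift (un∊ (superset m
            (λ n → case indices-∊ n of λ { (j , e , _ , ¬p) → ∊-≣ˡ (≣-sym e) (<⇒∊ ([ (λ q → q) , (λ q → ⊥-elim (¬p (lift q))) ]′ (<-or-≥ j i))) })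
            (λ n → case below i n of λ { (j , q , e) → ∊-≣ˡ (≣-sym e) (∊θ (<-trans q i<θ)) })))))))) ]′
        (almost-or λ j → Lift (suc ℓ) (i ≤ j))

      almost-member : ∀ {v} → v ∊ W → Almost (λ i → Lift (suc ℓ) (val i ∊ v))
      almost-member {v} m = superset m
        (λ {z} n → case θ∊ (mem (lower (proj₁ (proj₁ (proj₁ uniform) v (lift (un∊ m))) z (lift (un∊ n))))) of λ { (i , e , p) →
           ∊-≣ˡ (≣-sym e) (∊-indices p (lift (∊-≣ˡ e n))) })
        (λ n → mem (lower (indices-⊆ _ (lift (un∊ n)))))

 open Filter

 -- Limits of the measures U_i along W

 module Limiting where

  module Limits (𝕜 : RegularCardinal) (𝕀 : Uncountable.Index 𝕜) (𝕄 : Cohen.MeasureName 𝕜) where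

    open Uncountable 𝕜 using (R; K; module Index)
    open Index 𝕀 using (θᵏ; θ-limit)
    open RegularOrder R using (_<_; _≤_; <-≤-trans; ≤-<-trans; ≤-refl; ≤-trans; <⇒≤; <-or-≥; ω; 0ᵏ; 0<ω; ω-limit; ≡⇒≤; least)
    open OverOrder R
    open OnIndices 𝕜 𝕀 public
    open Deciding 𝕜 𝕀 𝕄 public
    open Condition using (height; Defined)
    open Node using (condition)

    private
      defined-somewhere : ∀ c → Σ K λ i → Defined c i
      defined-somewhere c = case Of.start c (height c) (Of.height-limit c) ≤-refl of λ { (i , β , e) → i , β , e }

    abstract
      -- The argument runs in the closed tree S_i below `c`, for an index at which the top club of
      -- `c` is defined; `refine` moves the dense sets of ℙ(κ,θ) into it.
      distributiveᴾ : ∀ l (D : K → Condition → Set (suc ℓ)) → (∀ j {c d} → d ≼ c → D j c → D j d) → ∀ c →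
                      (∀ j → j < l → ∀ d → d ≼ c → Σ Condition λ e → e ≼ d × D j e) → Σ Condition λ e → e ≼ c × ∀ j → j < l → D j e
      distributiveᴾ l D her c dense = case defined-somewhere c of λ { (i , def) →
          case Tree.distributive (nodeTree c i def) l (λ j t → D j (condition t)) (λ j {t} {u} h → her j {condition t} {condition u} (proj₁ h))
                 (Tree.root (nodeTree c i def)) (step i) of λ { (q , _ , h) → condition q , proj₁ (node-below q) , h } }
        where
        step : ∀ i j → j < l → (t : Node c i) → condition t ≼[ i ] c → Σ (Node c i) λ u → condition u ≼[ i ] condition t × D j (condition u)
        step i j p t t≼c = case dense j p (condition t) (proj₁ t≼c) of λ { (e , e≼t , d) →
          case refine (condition t) e i (≼[]-defined {condition t} {c} t≼c) e≼t of λ { (r , r≼t , r≼e) →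
            node-of r (≼[]-trans {r} {condition t} {c} r≼t t≼c) , r≼t , her j {e} {r} r≼e d } }

    module From (p₀ : Condition) (i₀ : K) (def₀ : Defined p₀ i₀) where

      -- With irrelevant proofs all elements of `Idx i` are equal, so the embeddings chosen in
      -- `AtIndex`, and with them U_i, do not depend on the proof that `i` is admissible.
      record Idx (i : K) : Set ℓ where
        constructor idx
        field
          .from : i₀ ≤ i
          .below : i < θᵏ

      idx-from : ∀ {i} → Idx i → i₀ ≤ i
      idx-from (idx p _) = recompute em↓ p

      idx-below : ∀ {i} → Idx i → i < θᵏ
      idx-below (idx _ p) = recompute em↓ p

      abstract
        def : ∀ {i} → Idx i → Defined p₀ i
        def x = defined-up p₀ (idx-from x) (idx-below x) def₀

      module Here {i : K} (x : Idx i) = AtIndex p₀ i (def x)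

      At : Condition → (K → Property) → K → Set (suc ℓ)
      At c G i = Σ (Idx i) λ x → c ≼[ i ] p₀ × Here.Decides x c (G i)

      -- The condition c forces the sets G i to belong to the measures of
      -- almost all the indices i.
      Limit : Condition → (K → Property) → Set ℓ
      Limit c G = Almost (At c G)

      Everything : Property
      Everything _ _ = Lift (suc ℓ) ⊤

      compatible-index : ∀ c → c ≼ p₀ → Σ K λ i → Idx i × c ≼[ i ] p₀
      compatible-index c h = case ≼⇒≼[] {c} {p₀} h of λ { (j , j<θ , h′) → case maximum i₀ j (defined-< p₀ def₀) j<θ of λ
        { (i , p , q , i<θ) → i , idx p i<θ , ≼[]-up {c} {p₀} q i<θ h′ } }

      private
        first : Σ K λ k → ∀ j → ¬ j < k
        first = case least (λ _ → Lift (suc ℓ) ⊤) (0ᵏ , lift tt) of λ { (k , _ , min) → k , λ j → min j (lift tt) }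

        -- A binary intersection as one of length ω: `F` stands at `0ᵏ` and `G` at all other
        -- indices.
        meet : ∀ {i} (x : Idx i) c {F G H} → Hereditary F → Regularᵖ F → Hereditary G → Regularᵖ G →
               (∀ k d → d ≼ c → F k d → G k d → H k d) → Here.Decides x c F → Here.Decides x c G → Here.Decides x c H
        meet x c {F} {G} {H} hF rF hG rG f a b = Here.decides-intersection x c (λ j → pick (em↓ {j ≡ 0ᵏ})) ω
            (λ j → her (em↓ {j ≡ 0ᵏ})) (λ j → reg (em↓ {j ≡ 0ᵏ}))
            (λ k d d≼c g → f k d d≼c (at-zero k d (em↓ {0ᵏ ≡ 0ᵏ}) (g 0ᵏ 0<ω)) (case ω-limit 0ᵏ 0<ω of λ { (j , 0<j , j<ω) → at-other k d 0<j (em↓ {j ≡ 0ᵏ}) (g j j<ω) }))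
            (λ j _ → decided (em↓ {j ≡ 0ᵏ}))
          where
          pick : ∀ {P : Set ℓ} → Dec P → Property
          pick (yes _) = F
          pick (no _) = G
          her : ∀ {P : Set ℓ} (q : Dec P) → Hereditary (pick q)
          her (yes _) = hF
          her (no _) = hG
          reg : ∀ {P : Set ℓ} (q : Dec P) → Regularᵖ (pick q)
          reg (yes _) = rF
          reg (no _) = rG
          decided : ∀ {P : Set ℓ} (q : Dec P) → Here.Decides x c (pick q)
          decided (yes _) = a
          decided (no _) = b
          at-zero : ∀ k d (q : Dec (0ᵏ ≡ 0ᵏ)) → pick q k d → F k d
          at-zero k d (yes _) h = h
          at-zero k d (no n) _ = ⊥-elim (n refl)
          at-other : ∀ k d {j} → 0ᵏ < j → (q : Dec (j ≡ 0ᵏ)) → pick q k d → G k d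
          at-other k d p (yes e) _ = ⊥-elim (≡⇒≤ e p)
          at-other k d p (no _) h = h

      abstract
        -- The extension holds in S_i for all large i, hence for almost all i, as W contains the
        -- final segments of θ.
        limit-mono : ∀ {c d G} → d ≼ c → Limit c G → Limit d G
        limit-mono {c} {d} {G} d≼c h = case ≼⇒≼[] {d} {c} d≼c of λ { (i₁ , i₁<θ , d≼[]c) →
          almost-mono {λ i → Lift (suc ℓ) (i₁ ≤ i) × At c G i} {At d G}
            (λ { i i<θ (lift p , x , c≼p₀ , g) → let d≼[i]c = ≼[]-up {d} {c} p i<θ d≼[]c in
                 x , ≼[]-trans {d} {c} {p₀} d≼[i]c c≼p₀ , Here.decides-mono x {c} {d} {G i} d≼[i]c g })
            (almost-and (almost-above i₁<θ) h) }

        limit-meet : ∀ {c F G H} → (∀ i → Hereditary (F i)) → (∀ i → Regularᵖ (F i)) → (∀ i → Hereditary (G i)) → (∀ i → Regularᵖ (G i)) →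
                     (∀ i → i < θᵏ → ∀ k d → d ≼ c → F i k d → G i k d → H i k d) → Limit c F → Limit c G → Limit c H
        limit-meet {c} {F} {G} {H} hF rF hG rG f m m′ = almost-mono {λ i → At c F i × At c G i} {At c H}
          (λ { i i<θ ((x , c≼ , a) , (_ , _ , b)) → x , c≼ , meet x c {F i} {G i} {H i} (hF i) (rF i) (hG i) (rG i) (f i i<θ) a b }) (almost-and m m′)

        limit-up : ∀ {c} {Φ : K → Set (suc ℓ)} {G H} → (∀ i → Hereditary (G i)) → (∀ i → Regularᵖ (G i)) →
                   (∀ i → i < θᵏ → Φ i → ∀ k d → d ≼ c → G i k d → H i k d) → Almost Φ → Limit c G → Limit c H
        limit-up {c} {Φ} {G} {H} hG rG f φ m = almost-mono {λ i → Φ i × At c G i} {At c H}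
          (λ { i i<θ (φᵢ , x , c≼ , a) → x , c≼ , meet x c {G i} {G i} {H i} (hG i) (rG i) (hG i) (rG i) (λ k d d≼c g _ → f i i<θ φᵢ k d d≼c g) a a })
          (almost-and φ m)

        limit-everything : ∀ {c} → c ≼ p₀ → Limit c (λ _ → Everything)
        limit-everything {c} c≼p₀ = case compatible-index c c≼p₀ of λ { (i₁ , x₁ , h) →
          almost-mono {λ i → Lift (suc ℓ) (i₁ ≤ i)} {At c (λ _ → Everything)} (λ { i i<θ (lift p) →
            let x = idx (≤-trans (idx-from x₁) p) i<θ in
            -- The intersection of an empty family, indexed below the least element of `K`.
            x , ≼[]-up {c} {p₀} p i<θ h , Here.decides-intersection x c (λ _ → Everything) (proj₁ first) {Everything}
                  (λ _ _ _ t → t) (λ _ _ _ _ → lift tt) (λ _ _ _ _ → lift tt) (λ j q → ⊥-elim (proj₂ first j q)) })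
            (almost-above (idx-below x₁)) }

        limit-cofinal : ∀ {c G} → Limit c G → ∀ l → Almost (λ i → Σ K λ k → Σ Condition λ d → Lift (suc ℓ) (l ≤ k × d ≼ c) × G i k d)
        limit-cofinal {c} {G} m l = almost-mono {At c G} {λ i → Σ K λ k → Σ Condition λ d → Lift (suc ℓ) (l ≤ k × d ≼ c) × G i k d} (λ { i i<θ (x , c≼ , a) → byContradiction λ n →
          Here.decides-unbounded x c {G i} l c≼ (λ k d d≼c g →
            [ (λ q → q) , (λ q → ⊥-elim (n (k , d , lift (q , d≼c) , g))) ]′ (<-or-≥ k l)) a }) m

      -- At index `i` the property is open and dense in S_i only, so θ many trees are involved. The
      -- recursion stays in the tree at `i₁` and takes up the later indices one by one; an extension
      -- at `i₁` is also one at every later index, so nothing gained is lost.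
      module Simultaneous (T : ∀ {i} → Idx i → Condition → Set (suc ℓ))
                          (open-T : ∀ {i} (x : Idx i) {c d} → d ≼[ i ] c → T x c → T x d)
                          (dense-T : ∀ {i} (x : Idx i) c → c ≼[ i ] p₀ → Σ Condition λ d → d ≼[ i ] c × T x d) where

        Holds : Condition → K → Set (suc ℓ)
        Holds d i = Σ (Idx i) λ x → d ≼[ i ] p₀ × T x d

        private
          module _ (c : Condition) (i₁ : K) (x₁ : Idx i₁) (c≼ : c ≼[ i₁ ] p₀) where

            raise : ∀ {i} → i₁ ≤ i → i < θᵏ → Idx i
            raise p q = idx (≤-trans (idx-from x₁) p) q

            Later : K → Node p₀ i₁ → Set (suc ℓ)
            Later i t = i₁ ≤ i → (x : Idx i) → T x (condition t)

            later-open : ∀ i {t u : Node p₀ i₁} → condition u ≼[ i₁ ] condition t → Later i t → Later i u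
            later-open i {t} {u} u≼t f p x = open-T x {condition t} {condition u} (≼[]-up {condition u} {condition t} p (idx-below x) u≼t) (f p x)

            -- `Extension` yields a node that is below `t` at the index `i₁` and below `e` at the
            -- index `i`.
            extended : ∀ i → i₁ ≤ i → (x : Idx i) → (t : Node p₀ i₁) → (e : Condition) → e ≼[ i ] condition t → T x e →
                       Σ (Node p₀ i₁) λ u → condition u ≼[ i₁ ] condition t × Later i u
            extended i i₁≤i x t e e≼t τ = node-of extension (≼[]-trans {extension} {condition t} {p₀} extension-≼₀ (node-below t)) , extension-≼₀ ,
                λ _ y → open-T x {e} {extension} extension-≼ τ
                where open Extension (condition t) e i₁ i (≼[]-defined {condition t} {p₀} (node-below t)) i₁≤i (idx-below x) e≼t (height e)

            step : ∀ i → i < θᵏ → (t : Node p₀ i₁) → Σ (Node p₀ i₁) λ u → condition u ≼[ i₁ ] condition t × Later i u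
            step i i<θ t = [ (λ i<i₁ → t , ≼[]-refl {condition t} (≼[]-defined {condition t} {p₀} (node-below t)) , λ p _ → ⊥-elim (p i<i₁))
                           , (λ p → case dense-T (raise p i<θ) (condition t) (≼[]-up {condition t} {p₀} p i<θ (node-below t)) of λ { (e , e≼t , τ) →
                               extended i p (raise p i<θ) t e e≼t τ }) ]′ (<-or-≥ i i₁)

            reached : Σ (Node p₀ i₁) λ q → condition q ≼[ i₁ ] c × ∀ i → i < θᵏ → Later i q
            reached = Tree.distributive (nodeTree p₀ i₁ (def x₁)) θᵏ Later (λ i {t} {u} → later-open i {t} {u}) (node-of c c≼) λ i p t _ → step i p t

            holds : (q : Node p₀ i₁) → (∀ i → i < θᵏ → Later i q) → ∀ i → i < θᵏ → Lift (suc ℓ) (i₁ ≤ i) → Holds (condition q) i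
            holds q f i i<θ (lift p) = raise p i<θ , ≼[]-up {condition q} {p₀} p i<θ (node-below q) , f i i<θ p (raise p i<θ)

        abstract
          simultaneously : ∀ c → c ≼ p₀ → Σ Condition λ d → d ≼ c × Almost (Holds d)
          simultaneously c c≼p₀ = case compatible-index c c≼p₀ of λ { (i₁ , x₁ , c≼) → case reached c i₁ x₁ c≼ of λ { (q , q≼c , f) →
            condition q , proj₁ q≼c , almost-mono {λ i → Lift (suc ℓ) (i₁ ≤ i)} {Holds (condition q)} (holds c i₁ x₁ c≼ q f) (almost-above (idx-below x₁)) } }

      module _ {G : K → Property} (hG : ∀ i → Hereditary (G i)) where

        private
          Either : ∀ {i} → Idx i → Condition → Set (suc ℓ)
          Either {i} x d = Here.Decides x d (G i) ⊎ Here.Decides x d (Never (G i))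

          either-mono : ∀ {i} (x : Idx i) {c d} → d ≼[ i ] c → Either x c → Either x d
          either-mono {i} x {c} {d} h (inj₁ a) = inj₁ (Here.decides-mono x {c} {d} {G i} h a)
          either-mono {i} x {c} {d} h (inj₂ a) = inj₂ (Here.decides-mono x {c} {d} {Never (G i)} h a)

          open Simultaneous Either either-mono (λ {i} x c c≼ → Here.decides-dense x c {G i} c≼ (hG i))

          cases : ∀ d → Almost (Holds d) → Limit d G ⊎ Limit d (λ i → Never (G i))
          cases d m = [ inj₁ , (λ n → inj₂ (almost-mono {λ i → (¬ At d G i) × Holds d i} {At d (λ i → Never (G i))}
            (λ { i _ (¬a , x , d≼ , inj₁ a) → ⊥-elim (¬a (x , d≼ , a)) ; i _ (_ , x , d≼ , inj₂ a) → x , d≼ , a }) (almost-and n m))) ]′ (almost-or (At d G))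

        abstract
          limit-dense : ∀ c → c ≼ p₀ → Σ Condition λ d → d ≼ c × (Limit d G ⊎ Limit d (λ i → Never (G i)))
          limit-dense c c≼p₀ = case simultaneously c c≼p₀ of λ { (d , d≼c , m) → d , d≼c , cases d m }

      module _ (m : K) (Val : K → K → Property) (her : ∀ i ν → Hereditary (Val i ν)) (reg : ∀ i ν → Regularᵖ (Val i ν))
               (total : ∀ i k d → d ≼ p₀ → Σ Condition λ e → e ≼ d × Σ K λ ν → Lift (suc ℓ) (ν < m) × Val i ν k e) where

        private
          Decided : ∀ {i} → Idx i → Condition → Set (suc ℓ)
          Decided {i} x d = Σ K λ ν → Lift (suc ℓ) (ν < m) × Here.Decides x d (Val i ν)

          decided-mono : ∀ {i} (x : Idx i) {c d} → d ≼[ i ] c → Decided x c → Decided x d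
          decided-mono {i} x {c} {d} h (ν , p , a) = ν , p , Here.decides-mono x {c} {d} {Val i ν} h a

          False : Property
          False _ _ = Lift (suc ℓ) ⊥

          module _ {i : K} (x : Idx i) where

            Either′ : K → Node p₀ i → Set (suc ℓ)
            Either′ ν t = Here.Decides x (condition t) (Val i ν) ⊎ Here.Decides x (condition t) (Never (Val i ν))

            either′-mono : ∀ ν {t u : Node p₀ i} → condition u ≼[ i ] condition t → Either′ ν t → Either′ ν u
            either′-mono ν {t} {u} h (inj₁ a) = inj₁ (Here.decides-mono x {condition t} {condition u} {Val i ν} h a)
            either′-mono ν {t} {u} h (inj₂ a) = inj₂ (Here.decides-mono x {condition t} {condition u} {Never (Val i ν)} h a)

            step : ∀ ν (t : Node p₀ i) → Σ (Node p₀ i) λ u → condition u ≼[ i ] condition t × Either′ ν u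
            step ν t = case Here.decides-dense x (condition t) {Val i ν} (node-below t) (her i ν) of λ { (d , d≼t , a) →
              node-of d (≼[]-trans {d} {condition t} {p₀} d≼t (node-below t)) , d≼t , a }

            -- By completeness not all the values can be excluded.
            value : ∀ (q : Node p₀ i) → (∀ ν → ν < m → Either′ ν q) → Decided x (condition q)
            value q h = byContradiction λ n → Here.decides-unbounded x (condition q) {False} 0ᵏ (node-below q) (λ _ _ _ f → ⊥-elim (lower f))
                  (Here.decides-intersection x (condition q) (λ ν → Never (Val i ν)) m {False}
                    (λ ν k {c} {d} d≼c f e e≼d → f e (≼-trans {e} {d} {c} e≼d d≼c))
                    (λ ν k c f d d≼c v → case f d d≼c of λ { (e , e≼d , n′) → n′ e (≼-refl {e}) (her i ν k {d} {e} e≼d v) })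
                    (λ k d d≼q f → case total i k d (≼-trans {d} {condition q} {p₀} d≼q (proj₁ (node-below q))) of λ { (e , e≼d , ν , lift p , v) → lift (f ν p e e≼d v) })
                    λ ν p → [ (λ a → ⊥-elim (n (ν , lift p , a))) , (λ a → a) ]′ (h ν p))

            dense : ∀ c → c ≼[ i ] p₀ → Σ Condition λ d → d ≼[ i ] c × Decided x d
            dense c c≼ = case Tree.distributive (nodeTree p₀ i (def x)) m Either′ (λ ν {t} {u} → either′-mono ν {t} {u}) (node-of c c≼) (λ ν _ t _ → step ν t) of λ
              { (q , q≼c , h) → condition q , q≼c , value q h }

          open Simultaneous Decided decided-mono dense

          g : Condition → K → K → K
          g d z i with em {Σ (Idx i) λ x → Decided x d}
          ... | yes (_ , ν , _) = ν
          ... | no _ = z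

          g<m : ∀ d z → z < m → ∀ i → g d z i < m
          g<m d z z<m i with em {Σ (Idx i) λ x → Decided x d}
          ... | yes (_ , _ , lift p , _) = p
          ... | no _ = z<m

          g-decides : ∀ d z {i} (x : Idx i) → Decided x d → Here.Decides x d (Val i (g d z i))
          g-decides d z {i} x a with em {Σ (Idx i) λ x → Decided x d}
          ... | yes (_ , _ , _ , b) = b
          ... | no n = ⊥-elim (n (x , a))

          values : ∀ d → Almost (Holds d) → Σ (K → K) λ f → (∀ i → f i < m) × Limit d (λ i → Val i (f i))
          -- The value at one index where it is decided, here `z`, witnesses that `m` is nonempty
          -- and serves as the default at the other indices.
          values d h = case almost-exists h of λ { (_ , _ , x , _ , z , lift z<m , _) → g d z , g<m d z z<m ,
            almost-mono {Holds d} {At d (λ i → Val i (g d z i))} (λ { i i<θ (x , d≼ , a) → x , d≼ , g-decides d z x a }) h }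

        abstract
          limit-value : ∀ c → c ≼ p₀ → Σ Condition λ d → d ≼ c × Σ (K → K) λ g → (∀ i → g i < m) × Limit d (λ i → Val i (g i))
          limit-value c c≼p₀ = case simultaneously c c≼p₀ of λ { (d , d≼c , h) → d , d≼c , values d h }

 open Limiting

 -- The ultrafilter U in the extension by ℙ(κ,θ)

 module Generic where

  Conclusion : (P : Poset (suc ℓ) ℓ (suc ℓ)) → V ℓ → V ℓ → V ℓ → Name P → Formula (Name P)
  Conclusion P κ θ W U =
      IsUniformUltrafilter U (check κ)
    ∧̇ (∀∈ (check κ) λ μ → IsInfiniteCardinal μ ⇒̇
         (IsDecomposable U (check κ) μ ⇔̇ IsDecomposable (check W) (check θ) μ))
    ∧̇ (∀̇ λ ν → IsSuccessorCardinal ν (check θ) ⇒̇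
         (∀∈ (check κ) λ μ → IsCardinal μ ⇒̇ ν ⊆̇ μ ⇒̇ ¬̇ IsDecomposable U (check κ) μ))

  -- All that is used of the poset is that, as a preorder, it is equivalent to the small type of
  -- conditions.
  record Presentation (R : RegularOrder) (θ : RegularOrder.K R) (θ-limit : RegularOrder.NoMaximum R θ) : Set (suc (suc ℓ)) where
    open OverRegular R θ θ-limit
    field
      P : Poset (suc ℓ) ℓ (suc ℓ)
      ⟪_⟫ : Condition → Poset.Carrier P
      underlying : Poset.Carrier P → Condition
      ⟪⟫-mono : ∀ {c d} → c ≼ d → Poset._≤_ P ⟪ c ⟫ ⟪ d ⟫
      ⟪⟫-reflect : ∀ {c d} → Poset._≤_ P ⟪ c ⟫ ⟪ d ⟫ → c ≼ d
      underlying-≤ : ∀ p → Poset._≤_ P ⟪ underlying p ⟫ p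
      ≤-underlying : ∀ p → Poset._≤_ P p ⟪ underlying p ⟫

  -- A record rather than a Σ-type, so that realizations over definitionally
  -- equal posets are compared without unfolding the forcing relation.
  record Realization (P : Poset (suc ℓ) ℓ (suc ℓ)) (κ θ W : V ℓ) (q : Poset.Carrier P) : Set (suc ℓ) where
    field
      r : Poset.Carrier P
      r≤q : Poset._≤_ P r q
      U : Name P
      forced : Forces P r (Conclusion P κ θ W U)

  realized : ∀ {P κ θ W} → (∀ q → Realization P κ θ W q) → V^ P ⊨ (∃̇ (Conclusion P κ θ W))
  realized h _ q _ = r , r≤q , U , forced
    where open Realization (h q)

  module Construction (𝕜 : RegularCardinal) (𝕀 : Uncountable.Index 𝕜) (𝕄 : Cohen.MeasureName 𝕜) where

    open RegularCardinal 𝕜 using (κ)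
    open Uncountable 𝕜 using (R; K; val; module Index)
    open Index 𝕀 using (θ; θᵏ; θ≣; θ-limit; W)
    open RegularOrder R using (_<_; _≤_; <-irrefl; <-≤-trans; ≤-<-trans; <-trans; ≤-refl; ≤-trans; <⇒≤; <-or-≥; ≤-split; compare; wf-induction; bound; upper; least)
    open Limits 𝕜 𝕀 𝕄
    open Condition using (height; Defined)

    module InPoset (ℙ : Presentation R θᵏ θ-limit) (p₀ : Condition) (i₀ : K) (def₀ : Defined p₀ i₀) where

      open Presentation ℙ
      open From p₀ i₀ def₀
      open OverPoset P renaming (_≤_ to _≤ᴾ_; ≤-refl to ≤ᴾ-refl; ≤-trans to ≤ᴾ-trans)
      open InExtension 𝕜 P ⟪_⟫ (λ p → underlying p , underlying-≤ p)
      open OrderTypes R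
      open Pieces θᵏ i₀ (defined-< p₀ def₀)

      underlying-mono : ∀ {p q} → q ≤ᴾ p → underlying q ≼ underlying p
      underlying-mono {p} {q} h = ⟪⟫-reflect (≤ᴾ-trans (underlying-≤ q) (≤ᴾ-trans h (≤-underlying p)))

      underlying-⟪⟫ : ∀ c → underlying ⟪ c ⟫ ≼ c
      underlying-⟪⟫ c = ⟪⟫-reflect (underlying-≤ ⟪ c ⟫)

      below-underlying : ∀ {p c} → c ≼ underlying p → ⟪ c ⟫ ≤ᴾ p
      below-underlying {p} h = ≤ᴾ-trans (⟪⟫-mono h) (underlying-≤ p)

      underlying-below : ∀ {p c} → p ≤ᴾ ⟪ c ⟫ → underlying p ≼ c
      underlying-below {p} h = ⟪⟫-reflect (≤ᴾ-trans (underlying-≤ p) h)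

      dense-conditions : ∀ {p} {Φ : Cond → Set (suc ℓ)} → (∀ d → d ≼ underlying p → Σ Condition λ e → e ≼ d × Φ ⟪ e ⟫) → Dense p Φ
      dense-conditions h q q≤p = case h (underlying q) (underlying-mono q≤p) of λ { (e , e≼ , φ) → ⟪ e ⟫ , below-underlying e≼ , φ }

      statement : (K → Formula (Name P)) → Property
      statement φ k c = Forces P ⟪ c ⟫ (φ k)

      statement-her : ∀ φ → Hereditary (statement φ)
      statement-her φ k h = forces-mono (φ k) (⟪⟫-mono h)

      statement-reg : ∀ φ → Regularᵖ (statement φ)
      statement-reg φ k c h = forces-local (φ k) (dense-conditions λ d d≼ → h d (≼-trans {d} {underlying ⟪ c ⟫} {c} d≼ (underlying-⟪⟫ c)))

      membership : Name P → K → Property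
      membership X i k = statement (λ k → ˇ k ∈̇ X) (b i k)

      membership-her : ∀ X i → Hereditary (membership X i)
      membership-her X i k {c} {d} = statement-her (λ k → ˇ k ∈̇ X) (b i k) {c} {d}

      membership-reg : ∀ X i → Regularᵖ (membership X i)
      membership-reg X i k = statement-reg (λ k → ˇ k ∈̇ X) (b i k)

      -- X is measured by almost all the measures of the indices i, transported
      -- to the i-th piece of κ.
      Large : Cond → Name P → Set ℓ
      Large p X = Limit (underlying p) (membership X)

      large-mono : ∀ {p q X} → q ≤ᴾ p → Large p X → Large q X
      large-mono {p} {q} {X} h = limit-mono {underlying p} {underlying q} {membership X} (underlying-mono h)

      always-index : Almost (λ _ → Lift (suc ℓ) ⊤)
      always-index = almost-all λ _ _ → lift tt

      large-from : ∀ {p G X} → (∀ i → Hereditary (G i)) → (∀ i → Regularᵖ (G i)) → {Φ : K → Set (suc ℓ)} → Almost Φ →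
                   (∀ i → i < θᵏ → Φ i → ∀ k d → ⟪ d ⟫ ≤ᴾ p → G i k d → ⟪ d ⟫ ⊩ ˇ (b i k) ∊ X) → Limit (underlying p) G → Large p X
      large-from {p} {G} {X} her reg {Φ} φ f = limit-up {underlying p} {Φ} {G} {membership X} her reg
        (λ i i<θ φᵢ k d d≼ g → un∊ᶠ (f i i<θ φᵢ k d (below-underlying d≼) g)) φ

      large-up : ∀ {p X Y} → (∀ k q → q ≤ᴾ p → q ⊩ ˇ k ∊ X → q ⊩ ˇ k ∊ Y) → Large p X → Large p Y
      large-up {p} {X} {Y} f = large-from {p} {membership X} {Y} (membership-her X) (membership-reg X) always-index
        (λ i _ _ k d d≤p m → f (b i k) ⟪ d ⟫ d≤p (memᶠ m))

      -- No U_i contains a bounded set, and `b-above` places `b i k` above `k`; so large sets are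
      -- unbounded in κ.
      large-element : ∀ {p X} l → Large p X → Dense p λ q → Σ K λ k → l ≤ k × q ⊩ ˇ k ∊ X
      large-element {p} {X} l h q q≤p = case almost-exists (limit-cofinal {underlying q} {membership X} (large-mono {p} {q} {X} q≤p h) l) of λ
        { (i , _ , k , d , lift (l≤k , d≼) , m) → ⟪ d ⟫ , below-underlying d≼ , b i k , ≤-trans l≤k (<⇒≤ (b-above i k)) , memᶠ m }

      -- Nice names for subsets of κ. They form a small type, and every subset of κ in the extension
      -- has one (`decode-encode`), so `U` can be defined by comprehension over them.
      Code : Set ℓ
      Code = K → Condition → Bool

      decode : Code → Name P
      decode C = sup (Σ (K × Condition) λ { (k , c) → C k c ≡ true }) (λ { ((k , _) , _) → ˇ k }) (λ { ((_ , c) , _) → [ ⟪ c ⟫ ] })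

      decode-⊆κ : ∀ {p C x} → p ⊩ x ∊ decode C → p ⊩ x ∊ check κ
      decode-⊆κ m = ∊-local (dense-map (elements m) λ { _ _ (((k , _) , _) , _ , e) → ∊-≗ˡ (≗-sym e) (ˇ∊κ k) })

      LargeCode : Code → Cond → Set (suc ℓ)
      LargeCode C p = Lift (suc ℓ) (Large p (decode C))

      largeCode-mono : ∀ C {p q} → q ≤ᴾ p → LargeCode C p → LargeCode C q
      largeCode-mono C {p} {q} h (lift l) = lift (large-mono {p} {q} {decode C} h l)

      U : Name P
      U = comprehension Code decode LargeCode

      Subset : Cond → Name P → Set (suc ℓ)
      Subset p X = ∀ {q x} → q ≤ᴾ p → q ⊩ x ∊ X → q ⊩ x ∊ check κ

      subset⇒Subset : ∀ {p X} → Forces P p (X ⊆̇ check κ) → Subset p X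
      subset⇒Subset h q≤p m = memᶠ (h _ _ q≤p (un∊ᶠ m))

      U⇒Large : ∀ {p X} → p ⊩ X ∊ U → Dense p λ q → Lift (suc ℓ) (Large q X)
      U⇒Large {X = X} m = dense-map (comprehension-∊ largeCode-mono m) λ { q _ (C , e , lift h) →
        lift (large-up {q} {decode C} {X} (λ k r r≤q m → ∊-≗ʳ (≗-sym (≗-mono r≤q e)) m) h) }

      U⇒Subset : ∀ {p X} → p ⊩ X ∊ U → Subset p X
      U⇒Subset m q≤p n = ∊-local (dense-map (comprehension-∊ largeCode-mono (∊-mono q≤p m)) λ { r r≤q (C , e , _) →
        decode-⊆κ (∊-≗ʳ e (∊-mono r≤q n)) })

      encode : Name P → Code
      encode X k c = bool (Forces P ⟪ c ⟫ (ˇ k ∈̇ X))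

      decode-encode : ∀ {p X} → Subset p X → p ⊩ X ≗ decode (encode X)
      decode-encode {p} {X} sub = ≗-extensional _ _
        (λ x q q≤p m → ∊-local (dense-bind (Presents.split (κ-presents {q}) ≤ᴾ-refl (sub q≤p m)) λ { r r≤q (k , e , _) →
           always λ s s≤r → ∊-≗ˡ (≗-sym (≗-mono s≤r e)) (∊-mono (≤-underlying s) (inside {k} {underlying s}
             (∊-mono (underlying-≤ s) (∊-≗ˡ (≗-mono s≤r e) (∊-mono (≤ᴾ-trans s≤r r≤q) m))))) }))
        (λ x q q≤p m → ∊-local (dense-map (elements m) λ { r _ (((k , c) , t) , AddTop.[ r≤c ] , e) →
           ∊-≗ˡ (≗-sym e) (∊-mono r≤c (memᶠ (true-bool t))) }))
        where
        inside : ∀ {k c} → ⟪ c ⟫ ⊩ ˇ k ∊ X → ⟪ c ⟫ ⊩ ˇ k ∊ decode (encode X)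
        inside {k} {c} m = ∊-element ((k , c) , bool-true (un∊ᶠ m)) AddTop.[ ≤ᴾ-refl ]

      Large⇒U : ∀ {p X} → Subset p X → Large p X → p ⊩ X ∊ U
      Large⇒U {p} {X} sub h = ∊-≗ˡ (≗-sym e) (∊-comprehension largeCode-mono (always λ q q≤p →
          encode X , ≗-refl , largeCode-mono (encode X) q≤p (lift (large-up {p} {X} {decode (encode X)} (λ k r r≤p m → ∊-≗ʳ (≗-mono r≤p e) m) h))))
        where
        e : p ⊩ X ≗ decode (encode X)
        e = decode-encode sub

      Base : Cond → Set (suc ℓ)
      Base p = p ≤ᴾ ⟪ p₀ ⟫

      U-ultrafilter : ∀ {p} → Base p → Forces P p (IsUltrafilter U (check κ))
      U-ultrafilter {p} base =
          (λ X q q≤p m → (λ x r r≤q n → un∊ᶠ (U⇒Subset (memᶠ m) r≤q (memᶠ n)))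
                       , dense-bind (U⇒Large (memᶠ m)) λ { r _ (lift h) → dense-map (large-element {r} {X} i₀ h) λ { s _ (k , _ , n) → ˇ k , un∊ᶠ n } })
        , un∊ᶠ (Large⇒U (λ _ m → m) (large-from {p} {λ _ → Everything} {check κ} (λ _ _ _ t → t) (λ _ _ _ _ → lift tt) always-index
            (λ i _ _ k d _ _ → ˇ∊κ (b i k)) (limit-everything (underlying-below base))))
        , (λ X q q≤p m Y r r≤q X⊆Y s s≤r Y⊆κ → un∊ᶠ (∊-local (dense-map (U⇒Large {X = X} (∊-mono (≤ᴾ-trans s≤r r≤q) (memᶠ m))) λ { t t≤s (lift h) →
            Large⇒U (λ u≤t → subset⇒Subset {X = Y} Y⊆κ (≤ᴾ-trans u≤t t≤s))
              (large-up {t} {X} {Y} (λ k u u≤t n → memᶠ (X⊆Y _ _ (≤ᴾ-trans u≤t (≤ᴾ-trans t≤s s≤r)) (un∊ᶠ n))) h) })))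
        , (λ X q q≤p m Y r r≤q n Z s s≤r inter → un∊ᶠ (∊-local (dense-bind (U⇒Large {X = X} (∊-mono (≤ᴾ-trans s≤r r≤q) (memᶠ m))) λ { t t≤s (lift h) →
            dense-map (U⇒Large {X = Y} (∊-mono (≤ᴾ-trans t≤s s≤r) (memᶠ n))) λ { u u≤t (lift h′) →
            Large⇒U (λ v≤u l → U⇒Subset (memᶠ m) (≤ᴾ-trans v≤u (≤ᴾ-trans u≤t (≤ᴾ-trans t≤s (≤ᴾ-trans s≤r r≤q))))
                (memᶠ (proj₁ (proj₁ (inter _) _ (≤ᴾ-trans v≤u (≤ᴾ-trans u≤t t≤s)) (un∊ᶠ l)))))
              (limit-meet {underlying u} {membership X} {membership Y} {membership Z} (membership-her X) (membership-reg X) (membership-her Y) (membership-reg Y)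
                (λ i _ k d d≼ a a′ → proj₂ (inter _) _ (≤ᴾ-trans (below-underlying d≼) (≤ᴾ-trans u≤t t≤s)) (a , a′))
                (large-mono {t} {u} {X} u≤t h) h′) } })))
        , (λ X q q≤p X⊆κ Y r r≤q diff → dense-conditions λ d d≼ →
            case limit-dense {membership X} (membership-her X) d (≼-trans {d} {underlying r} {p₀} d≼ (underlying-below (≤ᴾ-trans r≤q (≤ᴾ-trans q≤p base)))) of λ { (e , e≼d , h) →
            let e≤r = below-underlying (≼-trans {e} {d} {underlying r} e≼d d≼) in e , e≼d , [
              (λ h → inj₁ (un∊ᶠ (Large⇒U (λ s≤e → subset⇒Subset {X = X} X⊆κ (≤ᴾ-trans s≤e (≤ᴾ-trans e≤r r≤q)))
                 (limit-mono {e} {underlying ⟪ e ⟫} {membership X} (underlying-⟪⟫ e) h))))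
            , (λ h → inj₂ (un∊ᶠ (Large⇒U (λ s≤e n → memᶠ (proj₁ (proj₁ (diff _) _ (≤ᴾ-trans s≤e e≤r) (un∊ᶠ n))))
                 (large-from {⟪ e ⟫} {λ i → Never (membership X i)} {Y}
                   (λ i k {c} {d} d≼c f e e≼d → f e (≼-trans {e} {d} {c} e≼d d≼c))
                   (λ i k c f d d≼c v → case f d d≼c of λ { (e , e≼d , n) → n e (≼-refl {e}) (membership-her X i k {d} {e} e≼d v) })
                   always-index
                   -- What no extension puts into `X` belongs to its complement `Y`.
                   (λ i _ _ k d′ d′≤e n → memᶠ (proj₂ (diff _) _ (≤ᴾ-trans d′≤e e≤r) (un∊ᶠ (ˇ∊κ (b i k)) , λ s s≤d′ m →
                      ⊥-elim (n (underlying s) (underlying-below s≤d′) (un∊ᶠ (∊-mono (underlying-≤ s) (memᶠ {y = X} m)))))))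
                   (limit-mono {e} {underlying ⟪ e ⟫} {λ i → Never (membership X i)} (underlying-⟪⟫ e) h))))) ]′ h })

      Refuses : Cond → K → Name P → Set (suc ℓ)
      Refuses p k X = ∀ q → q ≤ᴾ p → ¬ q ⊩ ˇ k ∊ X

      Agrees : Name P → K → (K → Bool) → Cond → Set (suc ℓ)
      Agrees X ξ S p = ∀ ζ → ζ < ξ → (S ζ ≡ true → p ⊩ ˇ ζ ∊ X) × (S ζ ≡ false → Refuses p ζ X)

      agrees-mono : ∀ {X ξ S p q} → q ≤ᴾ p → Agrees X ξ S p → Agrees X ξ S q
      agrees-mono h f ζ ζ<ξ = (λ e → ∊-mono h (proj₁ (f ζ ζ<ξ) e)) , λ e r r≤q → proj₂ (f ζ ζ<ξ) e r (≤ᴾ-trans r≤q h)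

      agrees-unique : ∀ {X ξ S S′ p} ζ → ζ < ξ → Agrees X ξ S p → Agrees X ξ S′ p → S ζ ≡ S′ ζ
      agrees-unique {X} {ξ} {S} {S′} {p} ζ ζ<ξ f g = equal (S ζ) (S′ ζ)
          (proj₁ (f ζ ζ<ξ)) (λ e → proj₂ (f ζ ζ<ξ) e p ≤ᴾ-refl) (proj₁ (g ζ ζ<ξ)) (λ e → proj₂ (g ζ ζ<ξ) e p ≤ᴾ-refl)
        where
        equal : ∀ {A : Set (suc ℓ)} s s′ → (s ≡ true → A) → (s ≡ false → ¬ A) → (s′ ≡ true → A) → (s′ ≡ false → ¬ A) → s ≡ s′
        equal true true _ _ _ _ = refl
        equal false false _ _ _ _ = refl
        equal true false a _ _ n = ⊥-elim (n refl (a refl))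
        equal false true _ n b _ = ⊥-elim (n refl (b refl))

      -- By distributivity the memberships of all ζ < ξ are decided at once: bounded parts of `X`
      -- lie in the ground model.
      decide-below : ∀ X ξ p → Dense p λ q → Σ (K → Bool) λ S → Agrees X ξ S q
      decide-below X ξ p = dense-conditions λ c c≼ →
          case distributiveᴾ ξ Decided (λ j {c} {d} → decided-her j {c} {d}) c (λ ζ _ d _ → decide ζ d) of λ { (e , e≼c , h) →
            e , e≼c , (λ ζ → bool (⟪ e ⟫ ⊩ ˇ ζ ∊ X)) , λ ζ ζ<ξ → true-bool , λ t → [ (λ m → false≢true t (bool-true m)) , (λ n → n) ]′ (h ζ ζ<ξ) }
        where
        Decided : K → Condition → Set (suc ℓ)
        Decided ζ c = ⟪ c ⟫ ⊩ ˇ ζ ∊ X ⊎ Refuses ⟪ c ⟫ ζ X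
        decided-her : ∀ ζ {c d} → d ≼ c → Decided ζ c → Decided ζ d
        decided-her ζ h (inj₁ m) = inj₁ (∊-mono (⟪⟫-mono h) m)
        decided-her ζ h (inj₂ n) = inj₂ λ q q≤d → n q (≤ᴾ-trans q≤d (⟪⟫-mono h))
        decide : ∀ ζ d → Σ Condition λ e → e ≼ d × Decided ζ e
        decide ζ d with em {Σ Cond λ q → q ≤ᴾ ⟪ d ⟫ × q ⊩ ˇ ζ ∊ X}
        ... | yes (q , q≤d , m) = underlying q , underlying-below q≤d , inj₁ (∊-mono (underlying-≤ q) m)
        ... | no n = d , ≼-refl {d} , inj₂ λ q q≤d m → n (q , q≤d , m)

      module Enumeration {p : Cond} {X : Name P} (X⊆κ : Subset p X)
                         (unbounded : ∀ {q} → q ≤ᴾ p → ∀ l → Dense q λ r → Σ K λ k → l ≤ k × r ⊩ ˇ k ∊ X) where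

        private
          -- The graph of the collapse of `X` onto its order type: ξ goes to the order type of its
          -- predecessors in `X`, which the condition knows as `S`.
          record Position (ξ η : K) (q : Cond) : Set (suc ℓ) where
            constructor position
            field
              S : K → Bool
              agrees : Agrees X ξ S q
              member : q ⊩ ˇ ξ ∊ X
              value : orderType S ξ ≡ η

          position-mono : ∀ ξ η {q r} → r ≤ᴾ q → Position ξ η q → Position ξ η r
          position-mono ξ η h (position S a m e) = position S (agrees-mono {X} {ξ} {S} h a) (∊-mono h m) e

          total : ∀ {q} ξ → q ⊩ ˇ ξ ∊ X → Dense q λ r → Σ K λ η → Position ξ η r
          total {q} ξ m = dense-map (decide-below X ξ q) λ { r r≤q (S , a) → orderType S ξ , position S a (∊-mono r≤q m) refl }

          functional : ∀ {q ξ η η′} → Position ξ η q → Position ξ η′ q → η ≡ η′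
          functional {q} {ξ} (position S a _ e) (position S′ a′ _ e′) =
            trans (sym e) (trans (orderType-local ξ λ ζ ζ<ξ → agrees-unique {X} {ξ} {S} {S′} {q} ζ ζ<ξ a a′) e′)

          smaller : ∀ {q ξ ξ′ η η′} → ξ < ξ′ → Position ξ η q → Position ξ′ η′ q → η < η′
          smaller {q} {ξ} {ξ′} {η} {η′} ξ<ξ′ (position S a m e) (position S′ a′ _ e′) = subst (η <_) e′
            (subst (_< orderType S′ ξ′) (trans (orderType-local ξ λ ζ ζ<ξ → agrees-unique {X} {ξ} {S′} {S} {q} ζ ζ<ξ (λ ζ ζ<ξ → a′ ζ (<-trans ζ<ξ ξ<ξ′)) a) e)
              (orderType-< S′ ξ<ξ′ (member (S′ ξ) refl)))
            where
            member : ∀ s → S′ ξ ≡ s → S′ ξ ≡ true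
            member true t = t
            member false t = ⊥-elim (proj₂ (a′ ξ ξ<ξ′) t q ≤ᴾ-refl m)

          injective : ∀ {q ξ ξ′ η} → Position ξ η q → Position ξ′ η q → ξ ≡ ξ′
          injective {q} {ξ} {ξ′} {η} a a′ = [ (λ h → ⊥-elim (<-irrefl (smaller {q} {ξ} {ξ′} {η} {η} h a a′)))
            , [ (λ e → e) , (λ h → ⊥-elim (<-irrefl (smaller {q} {ξ′} {ξ} {η} {η} h a′ a))) ]′ ]′ (compare ξ ξ′)

          Occupied : K → Condition → Set (suc ℓ)
          Occupied η c = Σ K λ ξ → Position ξ η ⟪ c ⟫

          occupied-her : ∀ η {c d} → d ≼ c → Occupied η c → Occupied η d
          occupied-her η {c} {d} h (ξ , a) = ξ , position-mono ξ η (⟪⟫-mono {d} {c} h) a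

          -- The order types of the members of `S` below ξ exhaust the ordinals below `t`, so the
          -- one at position η is among the predecessors already known.
          exact : ∀ {η} c ξ t → Position ξ t ⟪ c ⟫ → η ≤ t → Occupied η c
          exact {η} c ξ t (position S a m e) η≤t = [
              (λ η<t → case orderType-onto S ξ η (subst (η <_) (sym e) η<t) of λ { (ξ′ , ξ′<ξ , s , e′) →
                 ξ′ , position S (λ ζ ζ<ξ′ → a ζ (<-trans ζ<ξ′ ξ′<ξ)) (proj₁ (a ξ′ ξ′<ξ) s) e′ })
            , (λ η≡t → ξ , position S a m (trans e (sym η≡t))) ]′ (≤-split η≤t)

          -- The next element of X above those at the positions below η has
          -- position at least η.
          find : ∀ η d → ⟪ d ⟫ ≤ᴾ p → (∀ η′ → η′ < η → Occupied η′ d) → Σ Condition λ e → e ≼ d × Occupied η e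
          find η d d≤p h = case bound η (λ η′ q → proj₁ (h η′ q)) of λ { (l , bd) → case unbounded d≤p l ⟪ d ⟫ ≤ᴾ-refl of λ { (r , r≤d , ξ , l≤ξ , m) →
              case total ξ m r ≤ᴾ-refl of λ { (s , s≤r , t , a) → placed l bd ξ l≤ξ s (≤ᴾ-trans s≤r r≤d) t a } } }
            where
            placed : ∀ l → (∀ η′ q → proj₁ (h η′ q) < l) → ∀ ξ → l ≤ ξ → ∀ s → s ≤ᴾ ⟪ d ⟫ → ∀ t → Position ξ t s → Σ Condition λ e → e ≼ d × Occupied η e
            placed l bd ξ l≤ξ s s≤d t a = underlying s , underlying-below s≤d ,
              exact (underlying s) ξ t (position-mono ξ t (underlying-≤ s) a) λ t<η →
                <-irrefl (smaller {s} {proj₁ (h t t<η)} {ξ} {t} {t} (<-≤-trans (bd t t<η) l≤ξ) (position-mono (proj₁ (h t t<η)) t s≤d (proj₂ (h t t<η))) a)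

          occupied : ∀ η c → ⟪ c ⟫ ≤ᴾ p → Σ Condition λ e → e ≼ c × Occupied η e
          occupied = wf-induction (λ η → ∀ c → ⟪ c ⟫ ≤ᴾ p → Σ Condition λ e → e ≼ c × Occupied η e) λ η ih c c≤p →
            case distributiveᴾ η Occupied (λ η′ {c} {d} → occupied-her η′ {c} {d}) c
                   (λ η′ η′<η d d≼c → ih η′ η′<η d (≤ᴾ-trans (⟪⟫-mono {d} {c} d≼c) c≤p)) of λ { (d , d≼c , h) →
            case find η d (≤ᴾ-trans (⟪⟫-mono {d} {c} d≼c) c≤p) h of λ { (e , e≼d , a) → e , ≼-trans {e} {d} {c} e≼d d≼c , a } }

          onto : ∀ η {q} → q ≤ᴾ p → Dense q λ r → Σ K λ ξ → Position ξ η r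
          onto η {q} q≤p = dense-conditions λ c c≼ → occupied η c (≤ᴾ-trans (below-underlying {q} {c} c≼) q≤p)

          X-presents : Presents p X ˇ (λ k q → q ⊩ ˇ k ∊ X)
          X-presents = record
            { split = λ {q} q≤p m → dense-map (Presents.split (κ-presents {q}) ≤ᴾ-refl (X⊆κ q≤p m)) λ { r r≤q (k , e , _) → k , e , ∊-≗ˡ e (∊-mono r≤q m) }
            ; member = λ _ _ m → m }

          open Graphs {l = ˇ} {m = ˇ} ˇ-injective ˇ-injective Position position-mono

        equinumerous : Forces P p (Equinumerous X (check κ))
        equinumerous = always λ q q≤p → graph , forces-mono (IsBijection graph X (check κ)) q≤p
          (graph-bijection X-presents κ-presents (λ _ a → Position.member a , lift tt) (λ ξ _ m → total ξ m) (λ {q} {ξ} {η} {η′} _ → functional {q} {ξ} {η} {η′})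
            (λ η q≤p _ → onto η q≤p) (λ {q} {ξ} {ξ′} {η} _ → injective {q} {ξ} {ξ′} {η}))

      U-uniform : ∀ {p} → Base p → Forces P p (IsUniformUltrafilter U (check κ))
      U-uniform {p} base = U-ultrafilter base , λ X q q≤p m → Enumeration.equinumerous {q} {X} (U⇒Subset (memᶠ m)) λ r≤q l →
        dense-bind (U⇒Large {X = X} (∊-mono r≤q (memᶠ m))) λ { s _ (lift h) → large-element {s} {X} l h }

      Im : Name P → Name P → Name P → Cond → Set (suc ℓ)
      Im H f x p = Dense p λ q → Σ (Name P) λ y → q ⊩ y ∊ H × q ⊩ opairᶠ x y ∊ f

      ⇒Im : ∀ {p H f x} → Forces P p (∃∈ H λ y → Maps f x y) → Im H f x p
      ⇒Im h = dense-map h λ { q _ (y , m , h′) → y , memᶠ m , Maps⇒∊ᶠ h′ }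

      Im⇒ : ∀ {p H f x} → Im H f x p → Forces P p (∃∈ H λ y → Maps f x y)
      Im⇒ h = dense-map h λ { q _ (y , m , h′) → y , un∊ᶠ m , ∊⇒Mapsᶠ h′ }

      Im-cong : ∀ {p H f x x′} → p ⊩ x ≗ x′ → Im H f x p → Im H f x′ p
      Im-cong e h = dense-map h λ { q q≤p (y , m , n) → y , m , ∊-≗ˡ (opairᶠ-cong (≗-mono q≤p e) ≗-refl) n }

      -- `A` cuts out the domain: all of κ for `U`, the ordinals below θ for W.
      Preimage : (K → Set ℓ) → Name P → Name P → Predicate
      Preimage A f H k p = Lift (suc ℓ) (A k) × Im H f (ˇ k) p

      preimage-mono : ∀ A f H → Mono (Preimage A f H)
      preimage-mono A f H k q≤p (a , h) = a , dense-mono q≤p h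

      abstract
        preimage : (K → Set ℓ) → Name P → Name P → Name P
        preimage A f H = subset (Preimage A f H)

        ∊-preimage : ∀ {p} A f H {k} → Preimage A f H k p → p ⊩ ˇ k ∊ preimage A f H
        ∊-preimage A f H = ∊-subset (preimage-mono A f H)

        fromPreimages : ∀ {p} A f H {x} → Dense p (λ q → Σ K λ k → q ⊩ x ≗ ˇ k × Preimage A f H k q) → p ⊩ x ∊ preimage A f H
        fromPreimages A f H = ∊-comprehension (preimage-mono A f H)

        preimages : ∀ {p} A f H {x} → p ⊩ x ∊ preimage A f H → Dense p λ q → Σ K λ k → q ⊩ x ≗ ˇ k × Preimage A f H k q
        preimages A f H = comprehension-∊ (preimage-mono A f H)

      preimage-Subset : ∀ {p} A f H → Subset p (preimage A f H)
      preimage-Subset A f H _ m = ∊-local (dense-map (preimages A f H m) λ { _ _ (k , e , _) → ∊-≗ˡ (≗-sym e) (ˇ∊κ k) })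

      isPreimage : ∀ {p I} A f H → Presents p I ˇ (λ k _ → Lift (suc ℓ) (A k)) → Forces P p (IsPreimage (preimage A f H) f I H)
      isPreimage A f H I-presents x =
          (λ q q≤p m → un∊ᶠ (∊-local (dense-map (preimages A f H (memᶠ m)) λ { r r≤q (k , e , a , _) →
               ∊-≗ˡ (≗-sym e) (Presents.member I-presents k (≤ᴾ-trans r≤q q≤p) a) }))
             , Im⇒ {q} {H} {f} {x} (dense-bind (preimages A f H (memᶠ m)) λ { r r≤q (k , e , _ , h) → Im-cong {r} {H} {f} {ˇ k} {x} (≗-sym e) h }))
        , (λ { q q≤p (m , h) → un∊ᶠ (fromPreimages A f H (dense-map (Presents.split I-presents q≤p (memᶠ m)) λ { r r≤q (k , e , a) →
               k , e , a , Im-cong {r} {H} {f} {x} {ˇ k} e (dense-mono r≤q (⇒Im {q} {H} {f} {x} h)) })) })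

      κ-presents′ : ∀ {p} → Presents p (check κ) ˇ (λ _ _ → Lift (suc ℓ) (Lift ℓ ⊤))
      κ-presents′ {p} = record
        { split = λ h m → dense-map (Presents.split (κ-presents {p}) h m) λ { _ _ (k , e , _) → k , e , lift (lift tt) }
        ; member = λ k _ _ → ˇ∊κ k }

      presents-≗ : ∀ {p X Y Ẑ} → p ⊩ X ≗ Y → Presents p Y ˇ Ẑ → Presents p X ˇ Ẑ
      presents-≗ e h = record
        { split = λ q≤p m → Presents.split h q≤p (∊-≗ʳ (≗-mono q≤p e) m)
        ; member = λ k q≤p a → ∊-≗ʳ (≗-sym (≗-mono q≤p e)) (Presents.member h k q≤p a) }

      θ≗ˇ : ∀ {p} → p ⊩ check θ ≗ ˇ θᵏ
      θ≗ˇ = check-≗ θ (val θᵏ) θ≣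

      θ-presents : ∀ {p} → Presents p (check θ) ˇ (λ k _ → Lift (suc ℓ) (k < θᵏ))
      θ-presents = presents-≗ θ≗ˇ (ˇ-presents θᵏ)

      module GroundFunction (A : K → Set ℓ) (g : K → K) where

        private
          Value : K → K → Cond → Set (suc ℓ)
          Value k j _ = Lift (suc ℓ) (A k × g k ≡ j)

          open Graphs {l = ˇ} {m = ˇ} ˇ-injective ˇ-injective Value (λ _ _ _ v → v)

        abstract
          ĝ : Name P
          ĝ = graph

          ĝ-function : ∀ {p m X Y} → Presents p X ˇ (λ k _ → Lift (suc ℓ) (A k)) → Presents p Y ˇ (λ j _ → Lift (suc ℓ) (j < m)) →
                       (∀ k → g k < m) → Forces P p (IsFunction ĝ X Y)
          ĝ-function {m = m} X-presents Y-presents h = graph-function X-presents Y-presents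
            (λ { {i = k} _ (lift (a , e)) → lift a , lift (subst (_< m) e (h k)) }) (λ { k _ (lift a) → always λ _ _ → g k , lift (a , refl) })
            (λ { _ (lift (_ , e)) (lift (_ , e′)) → trans (sym e) e′ })

          ĝ-value : ∀ {p k y} → p ⊩ opairᶠ (ˇ k) y ∊ ĝ → p ⊩ y ≗ ˇ (g k)
          ĝ-value {k = k} m = ≗-local (dense-map (graph-∊ m) λ { _ _ (k′ , j , e , e′ , lift (_ , refl)) →
            case ˇ-injective {j = k} {k′} e of λ { refl → e′ } })

          Im-ĝ : ∀ {p} H k → Im H ĝ (ˇ k) p → p ⊩ ˇ (g k) ∊ H
          Im-ĝ H k h = ∊-local (dense-map h λ { _ _ (y , m , n) → ∊-≗ˡ (ĝ-value n) m })

      ValueAt : Name P → K → K → Property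
      ValueAt f i ν k = statement (λ k → opairᶠ (ˇ k) (ˇ ν) ∈̇ f) (b i k)

      valueAt-her : ∀ f i ν → Hereditary (ValueAt f i ν)
      valueAt-her f i ν k {c} {d} = statement-her (λ k → opairᶠ (ˇ k) (ˇ ν) ∈̇ f) (b i k) {c} {d}

      valueAt-reg : ∀ f i ν → Regularᵖ (ValueAt f i ν)
      valueAt-reg f i ν k = statement-reg (λ k → opairᶠ (ˇ k) (ˇ ν) ∈̇ f) (b i k)

      -- For almost all i, f is almost everywhere on the i-th piece equal to g i.
      Traces : Name P → (K → K) → K → Cond → Set (suc ℓ)
      Traces f g m p = Lift (suc ℓ) ((∀ i → g i < m) × Limit (underlying p) (λ i → ValueAt f i (g i)))

      traces-mono : ∀ {f g m p q} → q ≤ᴾ p → Traces f g m p → Traces f g m q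
      traces-mono {f} {g} {m} {p} {q} h (lift (bd , l)) = lift (bd , limit-mono {underlying p} {underlying q} {λ i → ValueAt f i (g i)} (underlying-mono h) l)

      value-exists : ∀ {p m x f A} → p ⊩ x ≗ ˇ m → Functionᶠ p f A x → ∀ {q k} → q ≤ᴾ p → q ⊩ ˇ k ∊ A →
                     Dense q λ r → Σ K λ ν → Lift (suc ℓ) (ν < m) × r ⊩ opairᶠ (ˇ k) (ˇ ν) ∊ f
      value-exists {m = m} e F q≤p k∊A = dense-bind (Functionᶠ.total F q≤p k∊A) λ { r r≤q (y , y∊x , n) →
        dense-map (Presents.split (ˇ-presents {r} m) ≤ᴾ-refl (∊-≗ʳ (≗-mono (≤ᴾ-trans r≤q q≤p) e) y∊x)) λ { s s≤r (ν , e′ , lift ν<m) →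
          ν , lift ν<m , ∊-≗ˡ (opairᶠ-cong ≗-refl e′) (∊-mono s≤r n) } }

      module TraceOf {p : Cond} {m : K} {x f : Name P} (base : Base p) (e : p ⊩ x ≗ ˇ m) (F : Functionᶠ p f (check κ) x) where

        private
          c₀ : Condition
          c₀ = underlying p

          -- Relativized to extensions of `c₀`: only below `p` is `f` forced to be a function,
          -- whereas `limit-value` asks for values below all of `p₀`.
          Val : K → K → Property
          Val i ν k c = ∀ d → d ≼ c → d ≼ c₀ → ValueAt f i ν k d

          val-her : ∀ i ν → Hereditary (Val i ν)
          val-her i ν k {c} {d} d≼c h e e≼d = h e (≼-trans {e} {d} {c} e≼d d≼c)

          val-reg : ∀ i ν → Regularᵖ (Val i ν)
          val-reg i ν k c h d d≼c d≼c₀ = valueAt-reg f i ν k d λ d′ d′≼d → case h d′ (≼-trans {d′} {d} {c} d′≼d d≼c) of λ { (e , e≼d′ , v) →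
            e , e≼d′ , v e (≼-refl {e}) (≼-trans {e} {d′} {c₀} e≼d′ (≼-trans {d′} {d} {c₀} d′≼d d≼c₀)) }

          at : ∀ i k d → d ≼ c₀ → Σ Condition λ e → e ≼ d × Σ K λ ν → Lift (suc ℓ) (ν < m) × Val i ν k e
          at i k d d≼c₀ = case value-exists e F {⟪ d ⟫} {b i k} (below-underlying d≼c₀) (ˇ∊κ (b i k)) ⟪ d ⟫ ≤ᴾ-refl of λ { (r , r≤d , ν , ν<m , n) →
            underlying r , underlying-below r≤d , ν , ν<m , λ d′ d′≼ _ → un∊ᶠ (∊-mono (below-underlying d′≼) n) }

          total : ∀ i k d → d ≼ p₀ → Σ Condition λ e → e ≼ d × Σ K λ ν → Lift (suc ℓ) (ν < m) × Val i ν k e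
          total i k d _ with em {Lift (suc ℓ) (Σ Condition λ e → e ≼ d × e ≼ c₀)}
          ... | yes (lift (e , e≼d , e≼c₀)) = case at i k e e≼c₀ of λ { (e′ , e′≼e , h) → e′ , ≼-trans {e′} {e} {d} e′≼e e≼d , h }
          -- `d` is incompatible with `c₀`, so every value holds vacuously; `c₀` supplies one below
          -- `m`.
          ... | no n = case at i k c₀ (≼-refl {c₀}) of λ { (_ , _ , ν , ν<m , _) → d , ≼-refl {d} , ν , ν<m , λ e e≼d e≼c₀ → ⊥-elim (n (lift (e , e≼d , e≼c₀))) }

        traces : Dense p λ q → Σ (K → K) λ g → Traces f g m q
        traces = dense-conditions λ c c≼c₀ → case limit-value m Val val-her val-reg total c (≼-trans {c} {c₀} {p₀} c≼c₀ (underlying-below base)) of λ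
          { (d , d≼c , g , bd , h) → d , d≼c , g , lift (bd , limit-up {underlying ⟪ d ⟫} {λ _ → Lift (suc ℓ) ⊤} {λ i → Val i (g i)} {λ i → ValueAt f i (g i)}
              (λ i → val-her i (g i)) (λ i → val-reg i (g i)) (λ i _ _ k d′ d′≼ v → v d′ (≼-refl {d′})
                (≼-trans {d′} {d} {c₀} (≼-trans {d′} {underlying ⟪ d ⟫} {d} d′≼ (underlying-⟪⟫ d)) (≼-trans {d} {c} {c₀} d≼c c≼c₀))) always-index
              (limit-mono {d} {underlying ⟪ d ⟫} {λ i → Val i (g i)} (underlying-⟪⟫ d) h)) }

      preimage-large : ∀ {p f g m H} → Traces f g m p → {Φ : K → Set (suc ℓ)} → Almost Φ → (∀ i → i < θᵏ → Φ i → p ⊩ ˇ (g i) ∊ H) →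
                       p ⊩ preimage (λ _ → Lift ℓ ⊤) f H ∊ U
      preimage-large {p} {f} {g} {m} {H} (lift (_ , l)) {Φ} φ h = Large⇒U (preimage-Subset _ f H)
        (large-from {p} {λ i → ValueAt f i (g i)} {preimage (λ _ → Lift ℓ ⊤) f H} (λ i → valueAt-her f i (g i)) (λ i → valueAt-reg f i (g i)) φ
          (λ i i<θ φᵢ k d d≤p v → ∊-preimage (λ _ → Lift ℓ ⊤) f H (lift (lift tt) , always λ q q≤d →
             ˇ (g i) , ∊-mono (≤ᴾ-trans q≤d d≤p) (h i i<θ φᵢ) , ∊-mono q≤d (memᶠ v))) l)

      Indecomposes : Name P → Name P → Name P → Name P → Formula (Name P)
      Indecomposes U I x f = ∀̇ λ H → H ⊆̇ x ⇒̇ SizeBelow H x ⇒̇ (∀̇ λ Y → IsPreimage Y f I H ⇒̇ ¬̇ Y ∈̇ U)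

      W-decomposable : ∀ {p m x} → Base p → p ⊩ x ≗ ˇ m → Forces P p (IsDecomposable U (check κ) x) → Forces P p (IsDecomposable (check W) (check θ) x)
      W-decomposable {p} {m} {x} base e h = dense-bind h λ { q q≤p (f , fun , indec) →
          dense-map (TraceOf.traces {q} {m} {x} {f} (≤ᴾ-trans q≤p base) (≗-mono q≤p e) (isFunctionᶠ fun)) λ { r r≤q (g , tr) →
            GroundFunction.ĝ (_< θᵏ) g ,
            GroundFunction.ĝ-function (_< θᵏ) g θ-presents (presents-≗ (≗-mono (≤ᴾ-trans r≤q q≤p) e) (ˇ-presents m)) (proj₁ (lower tr)) ,
            contradiction f g (forces-mono (Indecomposes U (check κ) x f) r≤q indec) tr } }
        where
        contradiction : ∀ {r} f g → Forces P r (Indecomposes U (check κ) x f) → Traces f g m r →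
                        Forces P r (Indecomposes (check W) (check θ) x (GroundFunction.ĝ (_< θᵏ) g))
        contradiction f g indec tr H t t≤r H⊆x u u≤t small Y v v≤u pre z z≤v Y∈W =
          -- Below `s` the set `Y` is some `v₀` in W. For `i` in `v₀` the value `g i` is forced into
          -- `H`, so the preimage of `H` under `f` is in `U`, against `indec`.
          case ∊-check W (memᶠ Y∈W) z ≤ᴾ-refl of λ { (s , s≤z , v₀ , v₀∊W , e′) →
            let s≤v = ≤ᴾ-trans s≤z z≤v
                s≤u = ≤ᴾ-trans s≤v v≤u
                s≤r = ≤ᴾ-trans s≤u (≤ᴾ-trans u≤t t≤r) in
            indec H s s≤r (forces-mono (H ⊆̇ x) (≤ᴾ-trans s≤u u≤t) H⊆x) s ≤ᴾ-refl (forces-mono (SizeBelow H x) s≤u small)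
              (preimage (λ _ → Lift ℓ ⊤) f H) s ≤ᴾ-refl (isPreimage (λ _ → Lift ℓ ⊤) f H κ-presents′) s ≤ᴾ-refl
              (un∊ᶠ (preimage-large {s} {f} {g} {m} {H} (traces-mono {f} {g} {m} s≤r tr) (almost-member v₀∊W) λ { i i<θ (lift i∊v₀) →
                 GroundFunction.Im-ĝ (_< θᵏ) g H i (⇒Im {s} {H} {GroundFunction.ĝ (_< θᵏ) g} {ˇ i} (proj₂ (proj₁ (pre (ˇ i)) s s≤v (un∊ᶠ (∊-≗ʳ (≗-sym e′) (check-∊ v₀ i∊v₀)))))) })) }

      module Decided {p : Cond} {m : K} {x g : Name P} (e : p ⊩ x ≗ ˇ m) (G : Functionᶠ p g (check θ) x) where

        private
          Known : K → Condition → Set (suc ℓ)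
          Known i c = Σ K λ ν → Lift (suc ℓ) (ν < m) × ⟪ c ⟫ ⊩ opairᶠ (ˇ i) (ˇ ν) ∊ g

          extract : ∀ c → (∀ i → i < θᵏ → Known i c) → Σ (K → K) λ g₀ → Lift (suc ℓ) (∀ i → g₀ i < m) × ∀ i → i < θᵏ → ⟪ c ⟫ ⊩ opairᶠ (ˇ i) (ˇ (g₀ i)) ∊ g
          extract c known = case choose-below (_< m) (λ i ν → ⟪ c ⟫ ⊩ opairᶠ (ˇ i) (ˇ ν) ∊ g) (defined-< p₀ def₀) known of λ { (g₀ , bd , h) → g₀ , lift bd , h }

          known-her : ∀ i {c d} → d ≼ c → Known i c → Known i d
          known-her i {c} {d} h (ν , q , n) = ν , q , ∊-mono (⟪⟫-mono {d} {c} h) n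

          known-dense : ∀ i → i < θᵏ → ∀ d → d ≼ underlying p → Σ Condition λ u → u ≼ d × Known i u
          known-dense i i<θ d d≼ = case value-exists {p} {m} {x} {g} {check θ} e G {⟪ d ⟫} {i} (below-underlying {p} {d} d≼)
              (Presents.member (θ-presents {⟪ d ⟫}) i ≤ᴾ-refl (lift i<θ)) ⟪ d ⟫ ≤ᴾ-refl of λ { (r , r≤d , ν , q , n) →
                underlying r , underlying-below {r} {d} r≤d , ν , q , ∊-mono (underlying-≤ r) n }

        -- By distributivity all values of `g` are decided at once, so `g` agrees on θ with a ground
        -- model function `g₀`, which can be composed with `h`.
        decided : Dense p λ q → Σ (K → K) λ g₀ → Lift (suc ℓ) (∀ i → g₀ i < m) × ∀ i → i < θᵏ → q ⊩ opairᶠ (ˇ i) (ˇ (g₀ i)) ∊ g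
        decided = dense-conditions λ c c≼ →
          case distributiveᴾ θᵏ Known (λ i {c} {d} → known-her i {c} {d}) c
                 (λ i i<θ d d≼c → known-dense i i<θ d (≼-trans {d} {c} {underlying p} d≼c c≼)) of λ { (d , d≼c , known) → d , d≼c , extract d known }

      -- The set `H` lives in the extension, while the elements of `check W` are ground model sets;
      -- deciding every index makes the set of `i` with value in `H` a ground model set.
      decide-indices : ∀ (F : Predicate) → Mono F → ∀ p → Dense p λ q → ∀ i → i < θᵏ → F i q ⊎ (∀ r → r ≤ᴾ q → ¬ F i r)
      decide-indices F mono p = dense-conditions λ c c≼ → case distributiveᴾ θᵏ Known (λ i {c} {d} → known-her i {c} {d}) c (λ i _ d _ → decide i d) of λ
          { (d , d≼c , h) → d , d≼c , h }
        where
        Known : K → Condition → Set (suc ℓ)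
        Known i c = F i ⟪ c ⟫ ⊎ (∀ r → r ≤ᴾ ⟪ c ⟫ → ¬ F i r)
        known-her : ∀ i {c d} → d ≼ c → Known i c → Known i d
        known-her i {c} {d} h (inj₁ a) = inj₁ (mono i (⟪⟫-mono {d} {c} h) a)
        known-her i {c} {d} h (inj₂ n) = inj₂ λ r r≤d → n r (≤ᴾ-trans r≤d (⟪⟫-mono {d} {c} h))
        decide : ∀ i d → Σ Condition λ e → e ≼ d × Known i e
        decide i d with em {Σ Cond λ r → r ≤ᴾ ⟪ d ⟫ × F i r}
        ... | yes (r , r≤d , a) = underlying r , underlying-below r≤d , inj₁ (mono i (underlying-≤ r) a)
        ... | no n = d , ≼-refl {d} , inj₂ λ r r≤d a → n (r , r≤d , a)

      U-decomposable : ∀ {p m x} → p ⊩ x ≗ ˇ m → Forces P p (IsDecomposable (check W) (check θ) x) → Forces P p (IsDecomposable U (check κ) x)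
      U-decomposable {p} {m} {x} e H = dense-bind H λ { q q≤p (g , fun , indec) →
          dense-map (Decided.decided {q} {m} {x} {g} (≗-mono q≤p e) (isFunctionᶠ fun)) λ { r r≤q (g₀ , lift bd , known) →
            GroundFunction.ĝ (λ _ → Lift ℓ ⊤) (λ k → g₀ (h k)) ,
            GroundFunction.ĝ-function (λ _ → Lift ℓ ⊤) (λ k → g₀ (h k)) κ-presents′ (presents-≗ (≗-mono (≤ᴾ-trans r≤q q≤p) e) (ˇ-presents m)) (λ k → bd (h k)) ,
            contradiction g g₀ (forces-mono (Indecomposes (check W) (check θ) x g) r≤q indec) known } }
        where
        contradiction : ∀ {r} g g₀ → Forces P r (Indecomposes (check W) (check θ) x g) → (∀ i → i < θᵏ → r ⊩ opairᶠ (ˇ i) (ˇ (g₀ i)) ∊ g) →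
                        Forces P r (Indecomposes U (check κ) x (GroundFunction.ĝ (λ _ → Lift ℓ ⊤) (λ k → g₀ (h k))))
        contradiction {r} g g₀ indec known H t t≤r H⊆x u u≤t small Y v v≤u pre z z≤v Y∈U =
          case U⇒Large {X = Y} (memᶠ Y∈U) z ≤ᴾ-refl of λ { (s , s≤z , lift large) →
          case decide-indices F (preimage-mono (_< θᵏ) g H) s s ≤ᴾ-refl of λ { (o , o≤s , dec) →
            let o≤v = ≤ᴾ-trans o≤s (≤ᴾ-trans s≤z z≤v)
                o≤u = ≤ᴾ-trans o≤v v≤u
                o≤r = ≤ᴾ-trans o≤u (≤ᴾ-trans u≤t t≤r) in
            indec H o o≤r (forces-mono (H ⊆̇ x) (≤ᴾ-trans o≤u u≤t) H⊆x) o ≤ᴾ-refl (forces-mono (SizeBelow H x) o≤u small)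
              (preimage (_< θᵏ) g H) o ≤ᴾ-refl (isPreimage (_< θᵏ) g H θ-presents) o ≤ᴾ-refl
              (un∊ᶠ (∊-≗ˡ (≗-sym (name o dec)) (check-∊ W (almost o o≤v o≤r dec (large-mono {s} {o} {Y} o≤s large))))) } }
          where
          F : Predicate
          F = Preimage (_< θᵏ) g H
          Dec′ : Cond → Set (suc ℓ)
          Dec′ o = ∀ i → i < θᵏ → F i o ⊎ (∀ r → r ≤ᴾ o → ¬ F i r)
          name : ∀ o → Dec′ o → o ⊩ preimage (_< θᵏ) g H ≗ check (Indices (λ i → F i o))
          name o dec = ≗-extensional _ _
            (λ y q q≤o n → ∊-local (dense-map (preimages (_< θᵏ) g H n) λ { s s≤q (i , e , lift i<θ , im) →
               ∊-≗ˡ (≗-sym e) (check-∊ (Indices (λ i → F i o)) ([ ∊-indices i<θ , (λ n → ⊥-elim (n s (≤ᴾ-trans s≤q q≤o) (lift i<θ , im))) ]′ (dec i i<θ))) }))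
            (λ y q q≤o n → fromPreimages (_< θᵏ) g H (dense-map (∊-check (Indices (λ i → F i o)) n) λ { s s≤q (y′ , m′ , e) →
               case indices-∊ m′ of λ { (i , e′ , _ , a) → i , ≗-trans e (check-≗ y′ (val i) e′) , preimage-mono (_< θᵏ) g H i (≤ᴾ-trans s≤q q≤o) a } }))
          -- For almost all `i` an extension of `o` puts some `b i k` into `Y`, and therefore `g₀ i`
          -- into `H`; so `o` cannot have refused `i`.
          almost : ∀ o → o ≤ᴾ v → o ≤ᴾ r → Dec′ o → Large o Y → Almost (λ i → F i o)
          almost o o≤v o≤r dec large = almost-mono {λ i → Σ K λ k → Σ Condition λ d → Lift (suc ℓ) (i₀ ≤ k × d ≼ underlying o) × membership Y i k d} {λ i → F i o}
            (λ { i i<θ (k , d , lift (_ , d≼) , n) → [ (λ a → a)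
               , (λ never → ⊥-elim (never ⟪ d ⟫ (below-underlying d≼) (lift i<θ , always λ q q≤d → ˇ (g₀ i) ,
                    ∊-mono q≤d (subst (λ i → ⟪ d ⟫ ⊩ ˇ (g₀ i) ∊ H) (h-b k i<θ) (GroundFunction.Im-ĝ (λ _ → Lift ℓ ⊤) (λ k → g₀ (h k)) H (b i k)
                      (⇒Im {⟪ d ⟫} {H} {GroundFunction.ĝ (λ _ → Lift ℓ ⊤) (λ k → g₀ (h k))} {ˇ (b i k)} (proj₂ (proj₁ (pre (ˇ (b i k))) ⟪ d ⟫ (≤ᴾ-trans (below-underlying d≼) o≤v) n))))) ,
                    ∊-mono (≤ᴾ-trans q≤d (≤ᴾ-trans (below-underlying d≼) o≤r)) (known i i<θ)))) ]′ (dec i i<θ) })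
            (limit-cofinal {underlying o} {membership Y} large i₀)

      -- The range of the trace of f has size at most θ, and its preimage is
      -- large.
      U-indecomposable : ∀ {p m ν x} → Base p → p ⊩ x ≗ ˇ m → p ⊩ check θ ∊ ν → Forces P p (ν ⊆̇ x) → ¬ Forces P p (IsDecomposable U (check κ) x)
      U-indecomposable {p} {m} {ν} {x} base e θ∊ν ν⊆x H =
        case H p ≤ᴾ-refl of λ { (q , q≤p , f , fun , indec) →
        case TraceOf.traces {q} {m} {x} {f} (≤ᴾ-trans q≤p base) (≗-mono q≤p e) (isFunctionᶠ fun) q ≤ᴾ-refl of λ { (r , r≤q , g , tr) →
          Polymorphic.⊥-elim (impossible f g (≤ᴾ-trans r≤q q≤p) (forces-mono (Indecomposes U (check κ) x f) r≤q indec) tr) } }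
        where
        θ<m : θᵏ < m
        θ<m = ˇ-reflect {p} (∊-≗ˡ θ≗ˇ (∊-≗ʳ e (memᶠ (ν⊆x (check θ) p ≤ᴾ-refl (un∊ᶠ θ∊ν)))))
        impossible : ∀ {r} f g → r ≤ᴾ p → Forces P r (Indecomposes U (check κ) x f) → Traces f g m r → Polymorphic.⊥ {suc ℓ}
        impossible {r} f g r≤p indec tr@(lift (bd , _)) = indec range r ≤ᴾ-refl range⊆x r ≤ᴾ-refl range-small
            (preimage (λ _ → Lift ℓ ⊤) f range) r ≤ᴾ-refl (isPreimage (λ _ → Lift ℓ ⊤) f range κ-presents′) r ≤ᴾ-refl
            (un∊ᶠ (preimage-large {r} {f} {g} {m} {range} tr always-index λ i i<θ _ → ∊-subset range-mono (lift (i , i<θ , refl))))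
          where
          Range : Predicate
          Range j _ = Lift (suc ℓ) (Σ K λ i → i < θᵏ × g i ≡ j)
          range-mono : Mono Range
          range-mono _ _ a = a
          range : Name P
          range = subset Range
          x-presents : Presents r x ˇ (λ j _ → Lift (suc ℓ) (j < m))
          x-presents = presents-≗ (≗-mono r≤p e) (ˇ-presents m)
          range⊆x : Forces P r (range ⊆̇ x)
          range⊆x y q q≤r n = un∊ᶠ (∊-local (dense-map (comprehension-∊ range-mono (memᶠ n)) λ { s s≤q (j , e′ , lift (i , _ , refl)) →
            ∊-≗ˡ (≗-sym e′) (Presents.member x-presents j (≤ᴾ-trans s≤q q≤r) (lift (bd i))) }))
          -- The first occurrences of the values of `g`. Those below θ list the range without
          -- repetition, so it is in bijection with their order type, which is at most θ and hence
          -- below `m`.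
          New : K → Set (suc ℓ)
          New i = Lift (suc ℓ) (∀ i′ → i′ < i → g i′ ≢ g i)
          S : K → Bool
          S i = bool (New i)
          new-unique : ∀ {i i′} → S i ≡ true → S i′ ≡ true → g i ≡ g i′ → i ≡ i′
          new-unique {i} {i′} s s′ e = [ (λ p → ⊥-elim (lower (true-bool s′) i p e)) , [ (λ e → e) , (λ p → ⊥-elim (lower (true-bool s) i′ p (sym e))) ]′ ]′ (compare i i′)
          first : ∀ {j i} → i < θᵏ → g i ≡ j → Σ K λ i′ → i′ < θᵏ × S i′ ≡ true × g i′ ≡ j
          first {j} {i} i<θ e = case least (λ i → Lift (suc ℓ) (g i ≡ j)) (i , lift e) of λ { (i′ , lift e′ , min) →
            i′ , ≤-<-trans (min i (lift e)) i<θ , bool-true (lift λ k k<i′ e″ → min k (lift (trans e″ e′)) k<i′) , e′ }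
          Position : K → K → Cond → Set (suc ℓ)
          Position j η _ = Lift (suc ℓ) (Σ K λ i → i < θᵏ × S i ≡ true × g i ≡ j × orderType S i ≡ η)
          open Graphs {l = ˇ} {m = ˇ} ˇ-injective ˇ-injective Position (λ _ _ _ a → a)
          range-small : Forces P r (SizeBelow range x)
          range-small = always λ q q≤r → ˇ (orderType S θᵏ) ,
            un∊ᶠ (Presents.member x-presents (orderType S θᵏ) q≤r (lift (≤-<-trans (orderType-≤ S θᵏ) θ<m))) ,
            always λ s s≤q → graph , forces-mono (IsBijection graph range (ˇ (orderType S θᵏ))) (≤ᴾ-trans s≤q q≤r)
              (graph-bijection (presents-comprehension range-mono) (ˇ-presents (orderType S θᵏ))
                (λ { _ (lift (i , i<θ , s , e , e′)) → lift (i , i<θ , e) , lift (subst (_< orderType S θᵏ) e′ (orderType-< S i<θ s)) })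
                (λ { j _ (lift (i , i<θ , e)) → always λ _ _ → case first i<θ e of λ { (i′ , i′<θ , s , e′) → orderType S i′ , lift (i′ , i′<θ , s , e′ , refl) } })
                (λ { _ (lift (i , _ , s , e , o)) (lift (i′ , _ , s′ , e′ , o′)) → case new-unique s s′ (trans e (sym e′)) of λ { refl → trans (sym o) o′ } })
                (λ { η _ (lift η<) → always λ _ _ → case orderType-onto S θᵏ η η< of λ { (i , i<θ , s , o) → g i , lift (i , i<θ , s , refl , o) } })
                (λ { _ (lift (i , _ , s , e , o)) (lift (i′ , _ , s′ , e′ , o′)) → case orderType-injective S s s′ (trans o (sym o′)) of λ { refl → trans (sym e) e′ } }))

      private
        element-of-κ : ∀ {p x} (φ : Formula (Name P)) → p ⊩ x ∊ check κ → (∀ q m → q ≤ᴾ p → q ⊩ x ≗ ˇ m → Forces P q φ) → Forces P p φ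
        element-of-κ {p} φ m h = forces-local φ (dense-map (Presents.split (κ-presents {p}) ≤ᴾ-refl m) λ { q q≤p (k , e , _) → h q k q≤p e })

      abstract
        conclusion : Forces P ⟪ p₀ ⟫ (Conclusion P κ θ W U)
        conclusion = U-uniform ≤ᴾ-refl
          , (λ x q q≤p x∈κ → element-of-κ (IsInfiniteCardinal x ⇒̇ (IsDecomposable U (check κ) x ⇔̇ IsDecomposable (check W) (check θ) x)) (memᶠ x∈κ)
               λ r m r≤q e s s≤r _ →
                 (λ t t≤s → W-decomposable {t} {m} {x} (≤ᴾ-trans t≤s (≤ᴾ-trans s≤r (≤ᴾ-trans r≤q q≤p))) (≗-mono (≤ᴾ-trans t≤s s≤r) e))
               , (λ t t≤s → U-decomposable {t} {m} {x} (≗-mono (≤ᴾ-trans t≤s s≤r) e)))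
          , (λ ν q q≤p successor x r r≤q x∈κ → element-of-κ (IsCardinal x ⇒̇ ν ⊆̇ x ⇒̇ ¬̇ IsDecomposable U (check κ) x) (memᶠ x∈κ)
               λ s m s≤r e t t≤s _ u u≤t ν⊆x v v≤u decomposable →
                 let v≤s = ≤ᴾ-trans v≤u (≤ᴾ-trans u≤t t≤s)
                     v≤q = ≤ᴾ-trans v≤s (≤ᴾ-trans s≤r r≤q) in
                 ⊥-elim (U-indecomposable {v} {m} {ν} {x} (≤ᴾ-trans v≤q q≤p) (≗-mono v≤s e)
                   (∊-mono v≤q (memᶠ (proj₁ (proj₂ successor)))) (forces-mono (ν ⊆̇ x) v≤u ν⊆x) decomposable))

    realization : (ℙ : Presentation R θᵏ θ-limit) → ∀ q → Realization (Presentation.P ℙ) κ θ W q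
    -- Any index at which the top club of `p₀` is defined serves as `i₀`; it bounds the admissible
    -- indices from below and is the default index of `Pieces`.
    realization ℙ q = case Of.start p₀ (height p₀) (Of.height-limit p₀) ≤-refl of λ { (i₀ , def₀) → record
        { r = Presentation.⟪_⟫ ℙ p₀ ; r≤q = Presentation.underlying-≤ ℙ q ; U = InPoset.U ℙ p₀ i₀ def₀ ; forced = InPoset.conclusion ℙ p₀ i₀ def₀ } }
      where
      p₀ : Condition
      p₀ = Presentation.underlying ℙ q

 open Generic

 -- Set-theoretic conditions and their representation over `K`

 module Bridge where

  module Correspondence (𝕜 : RegularCardinal) (𝕀 : Uncountable.Index 𝕜) where

    open RegularCardinal 𝕜 using (κ)
    open Uncountable 𝕜
    open Index 𝕀 using (θ; θᵏ; θ≣; θ-limit)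
    open RegularOrder R using (_<_; _≤_; <-irrefl; <⇒≤; ≤-refl; ≤-trans; ≤-split; <-≤-trans; ≤-<-trans; least; ≡⇒≤; <-or-≥; ≤-antisym)
    open OverRegular R θᵏ θ-limit
    open Condition using (height; C; Defined)

    entry : V ℓ → V ℓ → V ℓ → V ℓ
    entry x y z = opair (opair x y) z

    entry-cong : ∀ {x y z x′ y′ z′} → x ≣ x′ → y ≣ y′ → z ≣ z′ → entry x y z ≣ entry x′ y′ z′
    entry-cong e f g = opair-cong (opair-cong e f) g

    entry-injective : ∀ {x y z x′ y′ z′} → entry x y z ≣ entry x′ y′ z′ → x ≣ x′ × y ≣ y′ × z ≣ z′
    entry-injective e = case opair-injective e of λ { (e₁ , ez) → case opair-injective e₁ of λ { (ex , ey) → ex , ey , ez } }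

    IsEntry⇒ : ∀ {e x y z} → (V⊨ IsEntry e x y z) → e ≣ entry x y z
    IsEntry⇒ (u , h , h′) = ≣-trans (IsOrdPair⇒≣ h′) (opair-cong (IsOrdPair⇒≣ h) ≣-refl)

    ⇒IsEntry : ∀ {e x y z} → e ≣ entry x y z → V⊨ IsEntry e x y z
    ⇒IsEntry {x = x} {y} e = opair x y , ≣⇒IsOrdPair ≣-refl , ≣⇒IsOrdPair e

    Seq⇒ : ∀ {p x y z} → (V⊨ Seq p x y z) → entry x y z ∊ p
    Seq⇒ (e , m , h) = ∊-≣ˡ (IsEntry⇒ h) (mem (lower m))

    ⇒Seq : ∀ {p x y z} → entry x y z ∊ p → V⊨ Seq p x y z
    ⇒Seq {x = x} {y} {z} m = entry x y z , lift (un∊ m) , ⇒IsEntry ≣-refl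

    ⊆⇒≤ : ∀ {x y j k} → x ≣ val j → y ≣ val k → (V⊨ x ⊆̇ y) → j ≤ k
    ⊆⇒≤ {j = j} {k} ex ey h k<j = <-irrefl (∊⇒< {k} {k} (∊-≣ʳ ey (mem (lower (h (val k) (lift (un∊ (∊-≣ʳ (≣-sym ex) (<⇒∊ k<j)))))))))

    ≤⇒⊆ : ∀ {x y j k} → x ≣ val j → y ≣ val k → j ≤ k → V⊨ x ⊆̇ y
    ≤⇒⊆ {j = j} {k} ex ey h z m = case below j (∊-≣ʳ ex (mem (lower m))) of λ { (i , i<j , ez) →
      lift (un∊ (∊-≣ʳ (≣-sym ey) (∊-≣ˡ (≣-sym ez) (<⇒∊ (<-≤-trans i<j h))))) }

    SupV : V ℓ → K → Set ℓ
    SupV A = Sup (λ δ → val δ ∊ A)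

    SupIs⇒ : ∀ {A B x α} → A ≣ B → x ≣ val α → (V⊨ SupIs A x) → SupV B α
    SupIs⇒ {α = α} eA e ((z , mz) , h) =
        (case below α (∊-≣ʳ e (mem (lower mz))) of λ { (β , p , _) → β , p })
      , λ β β<α → case proj₁ (h (val β)) (lift (un∊ (∊-≣ʳ (≣-sym e) (<⇒∊ β<α)))) of λ { (y , my , mx , m) →
          case below α (∊-≣ʳ e (mem (lower mx))) of λ { (δ , δ<α , ey) →
            δ , ∊-≣ʳ eA (∊-≣ˡ ey (mem (lower my))) , δ<α , ∊⇒< (∊-≣ʳ ey (mem (lower m))) } }

    ⇒SupIs : ∀ {A B x α} → A ≣ B → x ≣ val α → SupV B α → V⊨ SupIs A x
    ⇒SupIs {α = α} eA e ((z , p) , h) = (val z , lift (un∊ (∊-≣ʳ (≣-sym e) (<⇒∊ p)))) , λ b →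
        (λ m → case below α (∊-≣ʳ e (mem (lower m))) of λ { (β , β<α , eb) → case h β β<α of λ { (δ , mδ , δ<α , β<δ) →
           val δ , lift (un∊ (∊-≣ʳ (≣-sym eA) mδ)) , lift (un∊ (∊-≣ʳ (≣-sym e) (<⇒∊ δ<α))) , lift (un∊ (∊-≣ˡ (≣-sym eb) (<⇒∊ β<δ))) } })
      , (λ { (y , my , mx , m) → case below α (∊-≣ʳ e (mem (lower mx))) of λ { (δ , δ<α , ey) →
           case below δ (∊-≣ʳ ey (mem (lower m))) of λ { (β , β<δ , eb) →
             lift (un∊ (∊-≣ˡ (≣-sym eb) (∊-≣ʳ (≣-sym e) (<⇒∊ (RegularOrder.<-trans R β<δ δ<α))))) } } })

    -- The clauses of `IsℙCondition` with ordinals replaced by elements of `K`; the clubs remain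
    -- sets, compared up to `≣`.
    record Facts (p : V ℓ) (h : K) : Set (suc ℓ) where
      field
        height-limit : Lim h
        entries : ∀ {e} → e ∊ p → Σ K λ α → Σ K λ i → Σ (V ℓ) λ c → Lim α × α ≤ h × e ≣ entry (val α) (val i) c
        functional : ∀ {α i c c′} → entry (val α) (val i) c ∊ p → entry (val α) (val i) c′ ∊ p → c ≣ c′
        starts : ∀ {α} → Lim α → α ≤ h → Σ K λ ι → ι < θᵏ ×
                 (∀ {i c} → entry (val α) (val i) c ∊ p → i < θᵏ × ι ≤ i) ×
                 (∀ {i} → i < θᵏ → ι ≤ i → Σ (V ℓ) λ c → entry (val α) (val i) c ∊ p)
        club-⊆ : ∀ {α i c x} → entry (val α) (val i) c ∊ p → x ∊ c → x ∊ val α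
        club-sup : ∀ {α i c} → entry (val α) (val i) c ∊ p → SupV c α
        club-closed : ∀ {α i c β} → entry (val α) (val i) c ∊ p → β < α → SupV c β → val β ∊ c
        monotone : ∀ {α i j c c′ x} → entry (val α) (val i) c ∊ p → entry (val α) (val j) c′ ∊ p → i ≤ j → x ∊ c → x ∊ c′
        cover : ∀ {α β} → Lim α → α ≤ h → Lim β → β < α → Σ K λ i → Σ (V ℓ) λ c → entry (val α) (val i) c ∊ p × SupV c β
        coherent : ∀ {α i c β} → entry (val α) (val i) c ∊ p → val β ∊ c → SupV c β →
                   Σ (V ℓ) λ c̄ → entry (val β) (val i) c̄ ∊ p × ∀ δ → (δ < β → val δ ∊ c → val δ ∊ c̄) × (val δ ∊ c̄ → val δ ∊ c)

    private
      Lim⇒SupV : ∀ {A α} → (∀ {δ} → δ < α → val δ ∊ A) → Lim α → SupV A α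
      Lim⇒SupV f = Sup-map λ δ p _ → f p

      successor-∊ : ∀ {s γ h x} → γ ≣ val h → (V⊨ IsSuccessor s γ) → x ∊ s → Σ K λ α → x ≣ val α × α ≤ h
      successor-∊ {h = h} eγ succ m = [ (λ m′ → case below h (∊-≣ʳ eγ (mem (lower m′))) of λ { (α , p , e) → α , e , <⇒≤ p })
                                      , (λ e → h , ≣-trans (eq (lower e)) eγ , ≤-refl) ]′ (proj₁ (succ _) (lift (un∊ m)))

      ∊-successor : ∀ {s γ h α} → γ ≣ val h → (V⊨ IsSuccessor s γ) → α ≤ h → val α ∊ s
      ∊-successor {α = α} eγ succ p = mem (lower (proj₂ (succ (val α)) (case ≤-split p of λ
        { (inj₁ q) → inj₁ (lift (un∊ (∊-≣ʳ (≣-sym eγ) (<⇒∊ q)))) ; (inj₂ refl) → inj₂ (lift (un≣ (≣-sym eγ))) })))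

      InAcc-successor⇒ : ∀ {s γ h x} → γ ≣ val h → (V⊨ IsSuccessor s γ) → (V⊨ InAcc s x) → Σ K λ α → x ≣ val α × α ≤ h × Lim α
      InAcc-successor⇒ eγ succ (m , s) = case successor-∊ eγ succ (mem (lower m)) of λ { (α , e , p) → α , e , p , Sup⇒Lim (SupIs⇒ ≣-refl e s) }

      ⇒InAcc-successor : ∀ {s γ h x α} → γ ≣ val h → (V⊨ IsSuccessor s γ) → x ≣ val α → α ≤ h → Lim α → V⊨ InAcc s x
      ⇒InAcc-successor {α = α} eγ succ e p l = lift (un∊ (∊-≣ˡ (≣-sym e) (∊-successor {α = α} eγ succ p))) ,
        ⇒SupIs ≣-refl e (Lim⇒SupV {α = α} (λ {δ} q → ∊-successor {α = δ} eγ succ (<⇒≤ (<-≤-trans q p))) l)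

      θ-∊ : ∀ {i} → i < θᵏ → V⊨ val i ∈̇ θ
      θ-∊ p = lift (un∊ (∊-≣ʳ (≣-sym θ≣) (<⇒∊ p)))

      ∊-θ : ∀ {x} → (V⊨ x ∈̇ θ) → Σ K λ i → x ≣ val i × i < θᵏ
      ∊-θ m = case below θᵏ (∊-≣ʳ θ≣ (mem (lower m))) of λ { (i , p , e) → i , e , p }

    abstract
      facts : ∀ {p} → (V⊨ IsℙCondition κ θ p) → Σ K (Facts p)
      facts {p} (γ , s , (γ∈κ , γ-sup) , succ , ents , func , start , club , mono , cov , coh) =
          case represent (mem (lower γ∈κ)) of λ { (h , eγ) → h , with-height h eγ }
        where
        with-height : ∀ h → γ ≣ val h → Facts p h
        with-height h eγ = record
          { height-limit = Sup⇒Lim (SupIs⇒ ≣-refl eγ γ-sup)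
          ; entries = λ m → case ents _ (lift (un∊ m)) of λ { (x , y , c , ac , e) →
              case InAcc-successor⇒ eγ succ ac of λ { (α , ex , α≤h , l) → case start x ac of λ { (ι , _ , st) →
              case ∊-θ (proj₁ (proj₁ (st y) (c , ⇒Seq (∊-≣ˡ (IsEntry⇒ e) m)))) of λ { (i , ey , _) →
                α , i , c , l , α≤h , ≣-trans (IsEntry⇒ e) (entry-cong ex ey ≣-refl) } } } }
          ; functional = λ m m′ → eq (lower (func _ _ _ _ (⇒Seq m) (⇒Seq m′)))
          ; starts = λ {α} l α≤h → case start (val α) (⇒InAcc-successor eγ succ ≣-refl α≤h l) of λ { (y , y∈θ , st) →
              case ∊-θ y∈θ of λ { (ι , ey , ι<θ) → ι , ι<θ
                , (λ {i} {c} m → case proj₁ (st (val i)) (c , ⇒Seq m) of λ { (i∈θ , y⊆i) →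
                     case ∊-θ i∈θ of λ { (i′ , e , p) → subst (_< θᵏ) (sym (val-injective {i} {i′} e)) p , ⊆⇒≤ ey ≣-refl y⊆i } })
                , (λ {i} i<θ ι≤i → case proj₂ (st (val i)) (θ-∊ i<θ , ≤⇒⊆ ey ≣-refl ι≤i) of λ { (c , sq′) → c , Seq⇒ sq′ }) } }
          ; club-⊆ = λ m mx → mem (lower (proj₁ (club _ _ _ (⇒Seq m)) _ (lift (un∊ mx))))
          ; club-sup = λ m → SupIs⇒ ≣-refl ≣-refl (proj₁ (proj₂ (club _ _ _ (⇒Seq m))))
          ; club-closed = λ {β = β} m β<α sp → mem (lower (proj₂ (proj₂ (club _ _ _ (⇒Seq m))) (val β) (lift (un∊ (<⇒∊ β<α))) (⇒SupIs ≣-refl ≣-refl sp)))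
          ; monotone = λ m m′ i≤j mx → mem (lower (mono _ _ _ _ _ (⇒Seq m) (⇒Seq m′) (≤⇒⊆ ≣-refl ≣-refl i≤j) _ (lift (un∊ mx))))
          ; cover = λ {α} {β} l α≤h lβ β<α → case proj₁ (cov (val α) (⇒InAcc-successor eγ succ ≣-refl α≤h l) (val β))
                (lift (un∊ (<⇒∊ β<α)) , ⇒SupIs ≣-refl ≣-refl (Lim⇒SupV {α = β} (λ q → <⇒∊ (RegularOrder.<-trans R q β<α)) lβ)) of λ { (y , c , sq′ , (_ , sp)) →
              case start (val α) (⇒InAcc-successor eγ succ ≣-refl α≤h l) of λ { (_ , _ , st) →
              case ∊-θ (proj₁ (proj₁ (st y) (c , sq′))) of λ { (i , ey , _) →
                i , c , ∊-≣ˡ (entry-cong ≣-refl ey ≣-refl) (Seq⇒ sq′) , SupIs⇒ ≣-refl ≣-refl sp } } }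
          ; coherent = λ {β = β} m mβ sp → case proj₂ (coh _ _ _ (val β) (⇒Seq m) (lift (un∊ mβ) , ⇒SupIs ≣-refl ≣-refl sp)) of λ { (c̄ , sq′ , inter) →
              c̄ , Seq⇒ sq′ , λ δ → (λ p q → mem (lower (proj₂ (inter (val δ)) (lift (un∊ q) , lift (un∊ (<⇒∊ p))))))
                                  , (λ q → mem (lower (proj₁ (proj₁ (inter (val δ)) (lift (un∊ q)))))) }
          }

    module Abstract {p : V ℓ} {h : K} (F : Facts p h) where
      open Facts F

      Point : K → K → K → Set (suc ℓ)
      Point α i β = Σ (V ℓ) λ c → entry (val α) (val i) c ∊ p × val β ∊ c

      E : K → K → K → Bool
      E α i β = bool (Point α i β)

      private
        fromSup : ∀ {α i c β} → entry (val α) (val i) c ∊ p → Sup (λ δ → E α i δ ≡ true) β → SupV c β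
        fromSup m = Sup-map λ δ _ e → case true-bool e of λ { (c′ , m′ , q) → ∊-≣ʳ (functional m′ m) q }

        toSup : ∀ {α i c β} → entry (val α) (val i) c ∊ p → SupV c β → Sup (λ δ → E α i δ ≡ true) β
        toSup m = Sup-map λ δ _ q → bool-true (_ , m , q)

        inside : ∀ {α i c} → entry (val α) (val i) c ∊ p → Lim α × α ≤ h
        inside {α} m = case entries m of λ { (α′ , i′ , c′ , l , q , e) →
          case val-injective {α} {α′} (proj₁ (entry-injective e)) of λ { refl → l , q } }

        sup-entry : ∀ {α i β} → Sup (λ δ → E α i δ ≡ true) β → Σ (V ℓ) λ c → entry (val α) (val i) c ∊ p
        sup-entry s = case Sup-element s of λ { (_ , e , _) → case true-bool e of λ { (c , m , _) → c , m } }

        valid′ : Valid h E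
        valid′ = record
          { height-limit = height-limit
          ; entry = λ {α} {i} {β} e → case true-bool e of λ { (c , m , q) → case inside m of λ { (l , α≤h) →
              l , α≤h , (case starts l α≤h of λ { (_ , _ , f , _) → proj₁ (f m) }) , ∊⇒< (club-⊆ m q) } }
          ; start = λ α l α≤h → case starts l α≤h of λ { (ι , ι<θ , _ , g) → case g ι<θ ≤-refl of λ { (c , m) →
              case Sup-element (club-sup m) of λ { (β , q , _) → ι , β , bool-true (c , m , q) } } }
          ; monotone = λ i≤j j<θ e → case true-bool e of λ { (c , m , q) → case inside m of λ { (l , α≤h) →
              case starts l α≤h of λ { (ι , _ , f , g) → case g j<θ (≤-trans (proj₂ (f m)) i≤j) of λ { (c′ , m′) →
                bool-true (c′ , m′ , monotone m m′ i≤j q) } } } }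
          ; unbounded = λ e → case true-bool e of λ { (c , m , _) → toSup m (club-sup m) }
          ; closed = λ β<α s → case sup-entry s of λ { (c , m) → bool-true (c , m , club-closed m β<α (fromSup m s)) }
          ; cover = λ α β l α≤h lβ β<α → case cover l α≤h lβ β<α of λ { (i , c , m , s) → i , toSup m s }
          ; coherent = λ {α} {i} {β} β<α s → case sup-entry s of λ { (c , m) →
              case coherent m (club-closed m β<α (fromSup m s)) (fromSup m s) of λ { (c̄ , m̄ , f) →
                (case Sup-element (club-sup m̄) of λ { (δ , q , _) → δ , bool-true (c̄ , m̄ , q) }) ,
                λ δ δ<β → bool-≡ (λ e → case true-bool e of λ { (c′ , m′ , q) → bool-true (c , m , proj₂ (f δ) (∊-≣ʳ (functional m′ m̄) q)) })
                                 (λ e → case true-bool e of λ { (c′ , m′ , q) → bool-true (c̄ , m̄ , proj₁ (f δ) δ<β (∊-≣ʳ (functional m′ m) q)) }) } }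
          }

      condition-of : Condition
      condition-of = record { height = h ; C = E ; valid = valid′ }

    module _ (c : Condition) where

      club-of : K → K → V ℓ
      club-of α i = sup (Σ K λ β → C c α i β ≡ true) λ { (β , _) → val β }

      -- The witness β admits only nonempty clubs, since an undefined club is encoded by an empty
      -- one. The repetitions that it causes do not change the set.
      set-of : V ℓ
      set-of = sup (Σ (K × K) λ { (α , i) → Σ K λ β → C c α i β ≡ true }) λ { ((α , i) , _) → entry (val α) (val i) (club-of α i) }

      club-∊ : ∀ {α i x} → x ∊ club-of α i → Σ K λ β → x ≣ val β × C c α i β ≡ true
      club-∊ m = case sup-∊ m of λ { ((β , e) , ex) → β , ex , e }

      val-∊-club : ∀ {α i β} → val β ∊ club-of α i → C c α i β ≡ true
      val-∊-club {α} {i} {β} m = case club-∊ m of λ { (β′ , e , t) → case val-injective {β} {β′} e of λ { refl → t } }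

      ∊-club : ∀ {α i β} → C c α i β ≡ true → val β ∊ club-of α i
      ∊-club {β = β} e = ∊-sup (β , e)

      set-∊ : ∀ {x y z} → entry x y z ∊ set-of → Σ K λ α → Σ K λ i → Σ K λ β → C c α i β ≡ true × x ≣ val α × y ≣ val i × z ≣ club-of α i
      set-∊ m = case sup-∊ m of λ { (((α , i) , β , e) , e′) → case entry-injective e′ of λ { (ex , ey , ez) → α , i , β , e , ex , ey , ez } }

      set-∊ᵏ : ∀ {α i z} → entry (val α) (val i) z ∊ set-of → Σ K λ β → C c α i β ≡ true × z ≣ club-of α i
      set-∊ᵏ {α} {i} m = case set-∊ m of λ { (α′ , i′ , β , e , ex , ey , ez) →
        case val-injective {α} {α′} ex of λ { refl → case val-injective {i} {i′} ey of λ { refl → β , e , ez } } }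

      ∊-set : ∀ {x y z α i β} → C c α i β ≡ true → x ≣ val α → y ≣ val i → z ≣ club-of α i → entry x y z ∊ set-of
      ∊-set {α = α} {i} {β} e ex ey ez = ∊-≣ˡ (≣-sym (entry-cong ex ey ez)) (∊-sup ((α , i) , β , e))

      private
        toSupV : ∀ {α i β} → Sup (λ δ → C c α i δ ≡ true) β → SupV (club-of α i) β
        toSupV = Sup-map λ δ _ → ∊-club

        fromSupV : ∀ {α i β} → SupV (club-of α i) β → Sup (λ δ → C c α i δ ≡ true) β
        fromSupV = Sup-map λ δ _ → val-∊-club

        top : V ℓ
        top = sup (Σ K λ α → α ≤ height c) λ { (α , _) → val α }

        succ : V⊨ IsSuccessor top (val (height c))
        succ x = (λ m → case sup-∊ (mem (lower m)) of λ { ((α , p) , e) → case ≤-split p of λ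
                    { (inj₁ q) → inj₁ (lift (un∊ (∊-≣ˡ (≣-sym e) (<⇒∊ q)))) ; (inj₂ refl) → inj₂ (lift (un≣ e)) } })
               , [ (λ m → case below (height c) (mem (lower m)) of λ { (α , q , e) → lift (un∊ (∊-≣ˡ (≣-sym e) (∊-sup (α , <⇒≤ q)))) })
                 , (λ e → lift (un∊ (∊-≣ˡ (≣-sym (eq (lower e))) (∊-sup (height c , ≤-refl))))) ]′

        acc⇒ : ∀ {x} → (V⊨ InAcc top x) → Σ K λ α → x ≣ val α × α ≤ height c × Lim α
        acc⇒ = InAcc-successor⇒ {top} {val (height c)} {height c} ≣-refl succ

        ⇒acc : ∀ {x α} → x ≣ val α → α ≤ height c → Lim α → V⊨ InAcc top x
        ⇒acc = ⇒InAcc-successor {top} {val (height c)} {height c} ≣-refl succ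

        -- The ordinal i(α) is recovered as the least index with a nonempty club; by monotonicity
        -- the clubs at all later indices are nonempty too.
        starts-at : ∀ {x α} → x ≣ val α → Lim α → α ≤ height c → Σ K λ ι → (Σ K λ β → C c α ι β ≡ true) × (V⊨ StartsAt θ set-of x (val ι))
        starts-at {x} {α} ex l p = case Of.start c α l p of λ { (i , d) →
            found (least (λ i → Lift (suc ℓ) (Σ K λ β → C c α i β ≡ true)) (i , lift d)) }
          where
          found : (Σ K λ ι → Lift (suc ℓ) (Σ K λ β → C c α ι β ≡ true) × ∀ j → Lift (suc ℓ) (Σ K λ β → C c α j β ≡ true) → ι ≤ j) →
                  Σ K λ ι → (Σ K λ β → C c α ι β ≡ true) × (V⊨ StartsAt θ set-of x (val ι))
          found (ι , lift (β , e) , min) = ι , (β , e) , θ-∊ (proj₁ (proj₂ (proj₂ (Of.entry c e)))) , λ y →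
              (λ { (z , s) → case set-∊ (Seq⇒ s) of λ { (α′ , i , β′ , e′ , ex′ , ey , _) →
                 case val-injective {α} {α′} (≣-trans (≣-sym ex) ex′) of λ { refl →
                   lift (un∊ (∊-≣ˡ (≣-sym ey) (mem (lower (θ-∊ (proj₁ (proj₂ (proj₂ (Of.entry c e′))))))))) , ≤⇒⊆ ≣-refl ey (min i (lift (β′ , e′))) } } })
            , (λ { (y∈θ , ι⊆y) → case ∊-θ y∈θ of λ { (i , ey , i<θ) →
                 club-of α i , ⇒Seq (∊-set (Of.monotone c (⊆⇒≤ ≣-refl ey ι⊆y) i<θ e) ex ey ≣-refl) } })

      abstract
        set-condition : V⊨ IsℙCondition κ θ set-of
        set-condition = val (height c) , top
          , (lift (un∊ (val∊κ (height c))) , ⇒SupIs ≣-refl ≣-refl (Lim⇒SupV {α = height c} (λ {δ} _ → val∊κ δ) (Of.height-limit c)))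
          , succ
          , (λ e m → case sup-∊ (mem (lower m)) of λ { (((α , i) , β , t) , e′) → case Of.entry c t of λ { (l , p , _) →
               val α , val i , club-of α i , ⇒acc ≣-refl p l , ⇒IsEntry e′ } })
          , (λ x y z z′ s s′ → case set-∊ (Seq⇒ s) of λ { (α , i , β , t , ex , ey , ez) → case set-∊ (Seq⇒ s′) of λ { (α′ , i′ , β′ , t′ , ex′ , ey′ , ez′) →
               case val-injective {α} {α′} (≣-trans (≣-sym ex) ex′) of λ { refl → case val-injective {i} {i′} (≣-trans (≣-sym ey) ey′) of λ { refl →
                 lift (un≣ (≣-trans ez (≣-sym ez′))) } } } })
          , (λ x ac → case acc⇒ ac of λ { (α , ex , p , l) → case starts-at ex l p of λ { (ι , _ , s) → val ι , s } })
          , (λ x y z s → case set-∊ (Seq⇒ s) of λ { (α , i , β , t , ex , ey , ez) →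
               (λ u m → case club-∊ (∊-≣ʳ ez (mem (lower m))) of λ { (δ , eu , t′) →
                  lift (un∊ (∊-≣ˡ (≣-sym eu) (∊-≣ʳ (≣-sym ex) (<⇒∊ (proj₂ (proj₂ (proj₂ (Of.entry c t′)))))))) })
               , ⇒SupIs ez ex (toSupV (Of.unbounded c t))
               , (λ u m sp → case below α (∊-≣ʳ ex (mem (lower m))) of λ { (δ , δ<α , eu) →
                    lift (un∊ (∊-≣ˡ (≣-sym eu) (∊-≣ʳ (≣-sym ez) (∊-club (Of.closed c δ<α (fromSupV (SupIs⇒ ez eu sp))))))) }) })
          , (λ x y y′ z z′ s s′ y⊆y′ u m → case set-∊ (Seq⇒ s) of λ { (α , i , β , t , ex , ey , ez) → case set-∊ (Seq⇒ s′) of λ { (α′ , i′ , β′ , t′ , ex′ , ey′ , ez′) →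
               case val-injective {α} {α′} (≣-trans (≣-sym ex) ex′) of λ { refl → case club-∊ (∊-≣ʳ ez (mem (lower m))) of λ { (δ , eu , t″) →
                 lift (un∊ (∊-≣ˡ (≣-sym eu) (∊-≣ʳ (≣-sym ez′) (∊-club (Of.monotone c (⊆⇒≤ ey ey′ y⊆y′) (proj₁ (proj₂ (proj₂ (Of.entry c t′)))) t″))))) } } } })
          , (λ x ac y → case acc⇒ ac of λ { (α , ex , p , l) →
               (λ { (m , sp) → case below α (∊-≣ʳ ex (mem (lower m))) of λ { (δ , δ<α , ey) →
                  case Of.cover c α δ l p (Sup⇒Lim (SupIs⇒ ≣-refl ey sp)) δ<α of λ { (i , sp′) → case Sup-element sp′ of λ { (β , t , _) →
                    val i , club-of α i , ⇒Seq (∊-set t ex ≣-refl ≣-refl) ,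
                    lift (un∊ (∊-≣ˡ (≣-sym ey) (∊-club (Of.closed c δ<α sp′)))) , ⇒SupIs ≣-refl ey (toSupV sp′) } } } })
               , (λ { (i , z , s , m , sp) → case set-∊ (Seq⇒ s) of λ { (α′ , i′ , β , t , ex′ , ei , ez) → case val-injective {α} {α′} (≣-trans (≣-sym ex) ex′) of λ { refl →
                    case club-∊ (∊-≣ʳ ez (mem (lower m))) of λ { (δ , ey , t′) → let δ<α = proj₂ (proj₂ (proj₂ (Of.entry c t′))) in
                      lift (un∊ (∊-≣ˡ (≣-sym ey) (∊-≣ʳ (≣-sym ex) (<⇒∊ δ<α)))) ,
                      ⇒SupIs ≣-refl ey (Sup-map (λ ξ ξ<δ _ → ∊-≣ʳ (≣-sym ex) (<⇒∊ (RegularOrder.<-trans R ξ<δ δ<α))) (SupIs⇒ ≣-refl ey sp)) } } } }) })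
          , (λ x y z u s → λ { (m , sp) → case set-∊ (Seq⇒ s) of λ { (α , i , β , t , ex , ey , ez) → case club-∊ (∊-≣ʳ ez (mem (lower m))) of λ { (δ , eu , t′) →
               let δ<α = proj₂ (proj₂ (proj₂ (Of.entry c t′)))
                   sp′ = fromSupV {α} {i} {δ} (SupIs⇒ ez eu sp)
                   coh = Of.coherent c δ<α sp′ in
               (case starts-at eu (Sup⇒Lim sp′) (≤-trans (<⇒≤ δ<α) (proj₁ (proj₂ (Of.entry c t)))) of λ { (ι , d , st) →
                  val ι , st , proj₂ (proj₁ (proj₂ st y) (club-of δ i , ⇒Seq (∊-set (proj₂ (proj₁ coh)) eu ey ≣-refl))) })
               , club-of δ i , ⇒Seq (∊-set (proj₂ (proj₁ coh)) eu ey ≣-refl) , λ v →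
                   (λ m′ → case club-∊ (mem (lower m′)) of λ { (ξ , ev , t″) → let ξ<δ = proj₂ (proj₂ (proj₂ (Of.entry c t″))) in
                      lift (un∊ (∊-≣ˡ (≣-sym ev) (∊-≣ʳ (≣-sym ez) (∊-club (trans (sym (proj₂ coh ξ ξ<δ)) t″))))) ,
                      lift (un∊ (∊-≣ˡ (≣-sym ev) (∊-≣ʳ (≣-sym eu) (<⇒∊ ξ<δ)))) })
                   , (λ { (m′ , m″) → case below δ (∊-≣ʳ eu (mem (lower m″))) of λ { (ξ , ξ<δ , ev) →
                      lift (un∊ (∊-≣ˡ (≣-sym ev) (∊-club (trans (proj₂ coh ξ ξ<δ) (val-∊-club (∊-≣ˡ ev (∊-≣ʳ ez (mem (lower m′))))))))) } }) } } })

    abstract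
      condition-set : ∀ {p h} (F : Facts p h) → set-of (Abstract.condition-of F) ≣ p
      condition-set {p} {h} F = extensionality (λ e m → forward m) (λ e m → backward m)
        where
        open Facts F
        open Abstract F
        clubs : ∀ {α i c} → entry (val α) (val i) c ∊ p → c ≣ club-of condition-of α i
        clubs {α} {i} {c} m = extensionality
          (λ x mx → case below α (club-⊆ m mx) of λ { (β , _ , ex) → ∊-≣ˡ (≣-sym ex) (∊-club condition-of (bool-true (c , m , ∊-≣ˡ ex mx))) })
          (λ x mx → case club-∊ condition-of mx of λ { (β , ex , t) → case true-bool t of λ { (c′ , m′ , q) → ∊-≣ˡ (≣-sym ex) (∊-≣ʳ (functional m′ m) q) } })
        forward : ∀ {e} → e ∊ set-of condition-of → e ∊ p
        forward m = case sup-∊ m of λ { (((α , i) , β , t) , e) → case true-bool t of λ { (c , m′ , _) →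
          ∊-≣ˡ (≣-trans (entry-cong ≣-refl ≣-refl (clubs m′)) (≣-sym e)) m′ } }
        backward : ∀ {e} → e ∊ p → e ∊ set-of condition-of
        backward m = case entries m of λ { (α , i , c , _ , _ , e) → let m′ = ∊-≣ˡ e m in
          case Sup-element (club-sup m′) of λ { (β , q , _) →
            ∊-≣ˡ (≣-sym e) (∊-set condition-of (bool-true (c , m′ , q)) ≣-refl ≣-refl (clubs m′)) } }

      endExtends : ∀ c d → c ≼ d → V⊨ EndExtends (set-of c) (set-of d)
      endExtends c d (h≤ , agree) =
          (λ e m → case sup-∊ (mem (lower m)) of λ { (((α , i) , β , t) , e′) → let α≤d = proj₁ (proj₂ (Of.entry d t)) in
             lift (un∊ (∊-≣ˡ (≣-sym e′) (∊-set c (trans (agree α α≤d i β) t) ≣-refl ≣-refl (clubs α i α≤d)))) })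
        , (λ { e m (x , y , z , h , x′ , y′ , z′ , s , x⊆x′) → case sup-∊ (mem (lower m)) of λ { (((α , i) , β , t) , e′) →
             case entry-injective (≣-trans (≣-sym (IsEntry⇒ h)) e′) of λ { (ex , _ , _) →
             case set-∊ d (Seq⇒ s) of λ { (α′ , i′ , β′ , t′ , ex′ , _ , _) →
               let α≤d = ≤-trans (⊆⇒≤ ex ex′ x⊆x′) (proj₁ (proj₂ (Of.entry d t′))) in
               lift (un∊ (∊-≣ˡ (≣-sym e′) (∊-set d (trans (sym (agree α α≤d i β)) t) ≣-refl ≣-refl (≣-sym (clubs α i α≤d))))) } } } })
        where
        clubs : ∀ α i → α ≤ height d → club-of d α i ≣ club-of c α i
        clubs α i p = extensionality
          (λ x m → case club-∊ d m of λ { (β , ex , t) → ∊-≣ˡ (≣-sym ex) (∊-club c (trans (agree α p i β) t)) })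
          (λ x m → case club-∊ c m of λ { (β , ex , t) → ∊-≣ˡ (≣-sym ex) (∊-club d (trans (sym (agree α p i β)) t)) })

      -- Inclusion gives one direction. For the other, an entry of `c` at α ≤ `height d` is within
      -- the height of `d`, as witnessed by an entry of `d` at `height d` itself.
      endExtends⇒ : ∀ c d → (V⊨ EndExtends (set-of c) (set-of d)) → c ≼ d
      endExtends⇒ c d (sub , within) = h≤ , λ α α≤d i β → bool-≡ (down α≤d) up
        where
        up : ∀ {α i β} → C d α i β ≡ true → C c α i β ≡ true
        up {α} {i} t = case set-∊ᵏ c (mem (lower (sub _ (lift (un∊ (∊-set d {α = α} {i} t ≣-refl ≣-refl ≣-refl)))))) of λ { (_ , _ , e) →
          val-∊-club c (∊-≣ʳ e (∊-club d t)) }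
        top : Σ K λ i → Σ K λ β → C d (height d) i β ≡ true
        top = Of.start d (height d) (Of.height-limit d) ≤-refl
        h≤ : height d ≤ height c
        h≤ = case top of λ { (i , β , t) → proj₁ (proj₂ (Of.entry c (up t))) }
        down : ∀ {α i β} → α ≤ height d → C c α i β ≡ true → C d α i β ≡ true
        down {α} {i} {β} p t = case top of λ { (j , ζ , t′) →
          case set-∊ᵏ d (mem (lower (within (entry (val α) (val i) (club-of c α i)) (lift (un∊ (∊-set c {α = α} {i} t ≣-refl ≣-refl ≣-refl)))
            (val α , val i , club-of c α i , ⇒IsEntry ≣-refl , val (height d) , val j , club-of d (height d) j ,
             ⇒Seq (∊-set d {α = height d} {j} t′ ≣-refl ≣-refl ≣-refl) , ≤⇒⊆ ≣-refl ≣-refl p)))) of λ { (_ , _ , e) →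
            val-∊-club d (∊-≣ʳ e (∊-club c t)) } }

    ℙ : Poset (suc ℓ) ℓ (suc ℓ)
    ℙ = ℙ[ κ , θ ]

    open Poset ℙ using () renaming (Carrier to Condᴾ; _≤_ to _≤ᴾ_)

    ⟪_⟫ : Condition → Condᴾ
    ⟪ c ⟫ = set-of c , set-condition c

    underlying : Condᴾ → Condition
    underlying (p , h) = Abstract.condition-of (proj₂ (facts h))

    abstract
      ⟪⟫-mono : ∀ {c d} → c ≼ d → ⟪ c ⟫ ≤ᴾ ⟪ d ⟫
      ⟪⟫-mono {c} {d} = endExtends c d

      ⟪⟫-reflect : ∀ {c d} → ⟪ c ⟫ ≤ᴾ ⟪ d ⟫ → c ≼ d
      ⟪⟫-reflect {c} {d} = endExtends⇒ c d

      underlying-≤ : ∀ p → ⟪ underlying p ⟫ ≤ᴾ p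
      underlying-≤ p@(_ , h) = Poset.reflexive ℙ {⟪ underlying p ⟫} {p} (un≣ (condition-set (proj₂ (facts h))))

      ≤-underlying : ∀ p → p ≤ᴾ ⟪ underlying p ⟫
      ≤-underlying p@(_ , h) = Poset.reflexive ℙ {p} {⟪ underlying p ⟫} (un≣ (≣-sym (condition-set (proj₂ (facts h)))))

 open Bridge

 -- Assembling the hypotheses

 module Main where

  module Setting (𝕜 : RegularCardinal) where

    open RegularCardinal 𝕜 using (κ)
    open Uncountable 𝕜
    open RegularOrder R using (_<_; 0ᵏ; NoMaximum)
    open OverOrderˢ R
    open Cohen 𝕜 using (ℂ; ⟪_⟫ˢ; ⟪⟫-dense; MeasureName)
    open OverPoset ℂ using (forces-mono)

    -- A larger element is found within θ, by regularity of θ itself, and then carried over to its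
    -- representative in κ.
    no-maximum : ∀ θ k → θ ≣ val k → (V⊨ IsRegular θ) → NoMaximum k
    no-maximum θ k θ≣ regular-θ i i<θ = case Ordinal.represent θ ordinal (∊-≣ʳ (≣-sym θ≣) (<⇒∊ i<θ)) of λ { (i′ , e) →
        case Ordinal.Regular.limit θ ordinal regular-θ i′ of λ { (j′ , i′<j′) →
        case below k (∊-≣ʳ θ≣ (Ordinal.val∊κ θ ordinal j′)) of λ { (j , j<θ , e′) →
          j , ∊⇒< (∊-≣ˡ (≣-sym e) (∊-≣ʳ e′ (Ordinal.<⇒∊ θ ordinal i′<j′))) , j<θ } } }
      where
      ordinal : V⊨ IsOrdinal θ
      ordinal = proj₁ (proj₁ (proj₁ regular-θ))

    measure : (V^ Add[ κ ,1] ⊨ IsMeasurable (check κ)) → MeasureName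
    measure measurable = case proj₂ (proj₂ (measurable start)) start (Poset.refl ℂ {start}) of λ { (a , _ , U , u , n , c) →
        case ⟪⟫-dense a of λ { (s , s≤a) → record { base = s ; U = U
          ; ultra = forces-mono {a} {⟪ s ⟫ˢ} (IsUltrafilter U (check κ)) s≤a u
          ; nonprincipal = forces-mono {a} {⟪ s ⟫ˢ} (IsNonprincipal U (check κ)) s≤a n
          ; complete = forces-mono {a} {⟪ s ⟫ˢ} (IsComplete U (check κ) (check κ)) s≤a c } } }
      where
      start : Poset.Carrier ℂ
      start = ⟪ string 0ᵏ (λ _ → false) (λ _ _ → refl) ⟫ˢ

    module Generically (𝕀 : Index) (𝕄 : MeasureName) where

      open Index 𝕀 using (θ; θᵏ; θ-limit; W)
      open Correspondence 𝕜 𝕀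
      open Construction 𝕜 𝕀 𝕄 using (realization)

      presentation : Presentation R θᵏ θ-limit
      presentation = record
        { P = ℙ ; ⟪_⟫ = ⟪_⟫ ; underlying = underlying ; ⟪⟫-mono = λ {c} {d} → ⟪⟫-mono {c} {d} ; ⟪⟫-reflect = λ {c} {d} → ⟪⟫-reflect {c} {d}
        ; underlying-≤ = underlying-≤ ; ≤-underlying = ≤-underlying }

      realizations : ∀ q → Realization ℙ[ κ , θ ] κ θ W q
      realizations = realization presentation

    realizations-for : ∀ θ W → (V⊨ IsRegular θ) → (V⊨ θ ∈̇ κ) → (V⊨ IsUniformUltrafilter W θ) → MeasureName → ∀ q → Realization ℙ[ κ , θ ] κ θ W q
    realizations-for θ W regular-θ θ∈κ uniform 𝕄 = case represent (mem (lower θ∈κ)) of λ { (k , e) →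
      Generically.realizations (indexSet θ k e (no-maximum θ k e regular-θ) (proj₁ (proj₁ regular-θ)) W uniform) 𝕄 }

 open Main

theorem4p23 : ∀ {ℓ} → ExcludedMiddle (suc ℓ) → Extensionality (suc ℓ) (suc ℓ) →
    (θ κ W : V ℓ) →
    (V⊨ IsRegular θ) →
    (V⊨ IsRegular κ) →
    (V⊨ θ ∈̇ κ) →
    (V⊨ IsMeasurable κ) →
    (V^ Add[ κ ,1] ⊨ IsMeasurable (check κ)) →
    (V⊨ IsUniformUltrafilter W θ) →
    V^ ℙ[ κ , θ ] ⊨
    (∃̇ λ U →
    IsUniformUltrafilter U (check κ)
    ∧̇ (∀∈ (check κ) λ μ → IsInfiniteCardinal μ ⇒̇
    (IsDecomposable U (check κ) μ ⇔̇ IsDecomposable (check W) (check θ) μ))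
    ∧̇ (∀̇ λ ν → IsSuccessorCardinal ν (check θ) ⇒̇
    (∀∈ (check κ) λ μ → IsCardinal μ ⇒̇ ν ⊆̇ μ ⇒̇
    ¬̇ IsDecomposable U (check κ) μ)))
theorem4p23 em ext θ κ W regular-θ regular θ∈κ (_ , (w , omega , w∈κ) , _) measurable uniform =
  realized em ext {ℙ[ κ , θ ]} {κ} {θ} {W} (realizations-for em ext (regularCardinal κ regular w omega w∈κ) θ W regular-θ θ∈κ uniform
    (measure em ext (regularCardinal κ regular w omega w∈κ) measurable))
  where
  open Theory.Cardinal using (regularCardinal)
  open Theory.Generic using (realized)
  open Theory.Main.Setting using (realizations-for; measure)
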